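{- Let $G$ be a finite cyclic group of order at least $2000$. Then \[\Delta^{\ast}(G)\cap\mathbb N_{\ge |G|/10}=\bigcup_{m\mid |G|} I(m)\cap\mathbb N_{\ge |G|/10}.\]
   Context: $\mathbb N_{\ge a}=\{k\in\mathbb N:k\ge a\}$. For $G_0\subseteq G$: $\mathcal B(G_0)$ is the monoid of zero-sum sequences over $G_0$, whose atoms are the minimal zero-sum sequences; $\mathsf L(B)$ is the set of lengths of factorizations of $B$ into minimal zero-sum sequences; for $L=\{\ell_1<\dots<\ell_k\}$, $\Delta(L)=\{\ell_{i+1}-\ell_i\}$; $\Delta(G_0)=\bigcup_B\Delta(\mathsf L(B))$; $\min\Delta(G_0)$ is its minimum. $\Delta^{\ast}(G)=\{\min\Delta(G_0):G_0\subseteq G,\ \Delta(G_0)\ne\emptyset\}$. For a positive integer $n$: $M(n)$ is the set of triples $(c_1,c_2,d)$ of positive integers with $c_1,c_2\in[1,n]$, $d\mid n$, such that $\frac{n-c_1-c_2}{c_1c_2}$ and $\frac{(n-c_1-c_2)d}{c_2n}$ are positive integers; $I(n)$ is the set of all integers $\gcd\left\{\frac{n-c_1-c_2}{c_1c_2},\frac{(n-c_1-c_2)d}{c_2n}\right\}$ with $(c_1,c_2,d)\in M(n)$. -}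

module Defs where

open import Data.Nat using (ℕ; zero; suc; _+_; _*_; _∸_; _≤_; _<_)
open import Data.Nat.Divisibility using (_∣_)
open import Data.Nat.GCD using (gcd)
open import Data.Fin using (Fin; toℕ)
open import Data.Fin.Subset using (Subset; _∈_)
open import Data.List using (List; []; _∷_; length; map; allFin; foldr)
open import Data.Nat.ListAction using (sum)
open import Data.List.Relation.Unary.All using (All)
open import Data.Product using (Σ; ∃; ∃-syntax; _×_)
open import Relation.Binary.PropositionalEquality using (_≡_)
open import Relation.Nullary using (¬_)

-- The cyclic group of order n is modelled as ℤ/nℤ with carrier Fin n
-- (element g ↦ residue toℕ g).  A sequence (finite multiset) over ℤ/nℤ
-- is given by its multiplicity function.
Seq : ℕ → Set
Seq n = Fin n → ℕ

emptySeq : ∀ {n} → Seq n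
emptySeq _ = 0

_·_ : ∀ {n} → Seq n → Seq n → Seq n
(S · T) g = S g + T g

prodSeq : ∀ {n} → List (Seq n) → Seq n
prodSeq = foldr _·_ emptySeq

len : ∀ {n} → Seq n → ℕ
len {n} S = sum (map S (allFin n))

sumℕ : ∀ {n} → Seq n → ℕ
sumℕ {n} S = sum (map (λ g → S g * toℕ g) (allFin n))

ZeroSum : ∀ {n} → Seq n → Set
ZeroSum {n} S = n ∣ sumℕ S

_≼_ : ∀ {n} → Seq n → Seq n → Set
T ≼ S = ∀ g → T g ≤ S g

Over : ∀ {n} → Subset n → Seq n → Set
Over G0 S = ∀ g → 0 < S g → g ∈ G0

InB : ∀ {n} → Subset n → Seq n → Set
InB G0 S = Over G0 S × ZeroSum S

MinimalZeroSum : ∀ {n} → Seq n → Set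
MinimalZeroSum S = 0 < len S × ZeroSum S ×
  (∀ T → T ≼ S → ZeroSum T → 0 < len T → ∀ g → T g ≡ S g)

-- k ∈ L(B): B has a factorization into k minimal zero-sum sequences
-- (atoms of a factor of B lie automatically over supp(B) ⊆ G0)
InL : ∀ {n} → Seq n → ℕ → Set
InL {n} B k = ∃[ fs ] (All MinimalZeroSum fs × length fs ≡ k × (∀ g → prodSeq fs g ≡ B g))

InΔ : (ℕ → Set) → ℕ → Set
InΔ L d = 0 < d × ∃[ l ] (L l × L (l + d) × (∀ j → l < j → j < l + d → ¬ L j))

InΔG0 : ∀ {n} → Subset n → ℕ → Set
InΔG0 G0 d = ∃[ B ] (InB G0 B × InΔ (InL B) d)

IsMinΔ : ∀ {n} → Subset n → ℕ → Set
IsMinΔ G0 d = InΔG0 G0 d × (∀ e → InΔG0 G0 e → d ≤ e)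

InΔStar : ℕ → ℕ → Set
InΔStar n d = ∃[ G0 ] IsMinΔ {n} G0 d

-- (c1,c2,dd) ∈ M(m) together with the two positive integers
--   a = (m-c1-c2)/(c1 c2),  b = (m-c1-c2) dd /(c2 m)
-- and k = gcd(a,b) means k ∈ I(m)
InI : ℕ → ℕ → Set
InI m k = ∃[ c1 ] ∃[ c2 ] ∃[ dd ] ∃[ a ] ∃[ b ]
  ( (1 ≤ c1 × c1 ≤ m) × (1 ≤ c2 × c2 ≤ m) × dd ∣ m
  × c1 + c2 < m
  × (0 < a × a * (c1 * c2) ≡ m ∸ c1 ∸ c2)
  × (0 < b × b * (c2 * m) ≡ (m ∸ c1 ∸ c2) * dd)
  × k ≡ gcd a b )

{-# OPTIONS --safe #-}

-- All lengths of a sequence B over G0 are congruent modulo k = min Δ(G0), and k is large.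
--
-- "⊆": for g, h ∈ G0 let r·g and s·h generate ⟨g⟩ ∩ ⟨h⟩, with s·h = i·(r·g).  Comparing lengths
-- for a few atoms over {g , h} forces i = 1 or i = 1 + R j k with |⟨g⟩ ∩ ⟨h⟩| = Q i + R.  If i = 1
-- for all pairs, then U ↦ Σ U(x) gcd(x , n) / n is 1 modulo k and at most k on atoms, hence equal
-- to 1, so that G0 is half-factorial, a contradiction.  Otherwise Q R j ≤ 9, and k ∈ I(m) for some
-- m ∣ n is read off from Q, R and j, with finitely many exceptional shapes.  In these g and h generate
-- the group, every other x ∈ G0 satisfies x = d g = d h for a divisor d of n, and comparing the
-- weights of atoms in the bases g and h gives j ∣ Q + R, which fails in the exceptional shapes.
--
-- "⊇": with n = u m, the set G0 = {u , (1 + c₂ a) u , d u} works.  All its atoms have weight ≡ m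
-- modulo m k in the basis u, so lengths are congruent modulo k, while a and b occur as differences.

module Submission where

open import Defs
open import Data.Empty using (⊥; ⊥-elim)
open import Data.Fin using (Fin; zero; suc; toℕ; fromℕ<)
open import Data.Fin.Properties using (_≟_; all?; toℕ<n; toℕ-injective; toℕ-fromℕ<)
open import Data.Fin.Subset using (Subset; _∈_; _∪_; ⁅_⁆)
open import Data.Fin.Subset.Properties using (_∈?_; x∈⁅x⁆; x∈⁅y⁆⇒x≡y; x∈p∪q⁻; x∈p∪q⁺)
open import Data.List using (List; []; _∷_; _++_; length; map; allFin)
open import Data.List.Properties using (map-tabulate; length-++)
open import Data.List.Relation.Unary.All using (All; []; _∷_)
open import Data.List.Relation.Unary.All.Properties using (++⁺)
open import Data.List.Relation.Unary.Any using (Any; any?; satisfied)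
open import Data.Nat hiding (_≟_)
open import Data.Nat.Properties hiding (_≟_)
import Data.Nat.Properties as ℕₚ
open import Data.Nat.Induction using (<-rec)
open import Data.Nat.Coprimality using (Coprime; coprime-divisor; coprime-Bézout)
import Data.Nat.Coprimality as Coprimality
open import Data.Nat.Divisibility
open import Data.Nat.DivMod
open import Data.Nat.GCD
open import Data.Nat.ListAction using (sum)
open import Data.Nat.Tactic.RingSolver using (solve-∀)
open import Data.Product using (∃-syntax; _×_; _,_; proj₁; proj₂)
open import Data.Sum as Sum using (_⊎_; inj₁; inj₂; swap; fromInj₁; map₂)
open import Function using (_∘_; id)
open import Relation.Binary.PropositionalEquality
open import Relation.Nullary using (¬_; Dec; yes; no; contradiction)
open import Relation.Nullary.Decidable using (map′; toWitness; _×-dec_; _⊎-dec_; _→-dec_; ¬?)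
open import Function.Bundles using (_⇔_; mk⇔)

-- Every congruence modulo k comes from one trade: copies of an atom U and of f^o, with o the order
-- of f, are rearranged into copies of f^o and atoms x^r f^(o - s). The lengths show that the norm
-- of U in base f (its total coefficient with respect to f, divided by o) is 1 modulo k. Making this
-- an equality needs the upper bound k, and here the size of k enters: compatible elements are
-- determined by their index, at most n/20 + 20 indices occur, and each element adds at most 1 to
-- the norm. In the exceptional shapes this bound fails in base g when h occurs often. But g^R h^Q
-- is zero-sum, so every atom has few copies of h or few of g, and one of the two bases gives norm
-- 1. Changing the base has a price: for x = d g = d h the weights correspond only after
-- multiplication by Q + R, whence the conclusion j ∣ Q + R. In the converse, (1 + c₁ a)(1 + c₂ a) =
-- 1 + a m makes the two coefficients inverse modulo m, and the same two-base argument applies, with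
-- c₂ copies of u and c₁ copies of (1 + c₂ a) u in the role of g^R h^Q.

-- Congruences in ℕ

-- Congruence with explicit multiples on both sides avoids subtraction in ℕ.
infix 4 _≈_mod_
record _≈_mod_ (x y m : ℕ) : Set where
  constructor by
  field
    left right : ℕ
    balance    : x + left * m ≡ y + right * m

≈-refl : ∀ {m x} → x ≈ x mod m
≈-refl = by 0 0 refl

≈-reflexive : ∀ {m x y} → x ≡ y → x ≈ y mod m
≈-reflexive refl = ≈-refl

≈-sym : ∀ {m x y} → x ≈ y mod m → y ≈ x mod m
≈-sym (by p q e) = by q p (sym e)

private
  trans-lemma₁ : ∀ x p p′ m → x + (p + p′) * m ≡ (x + p * m) + p′ * m
  trans-lemma₁ = solve-∀
  trans-lemma₂ : ∀ y q p′ m → (y + q * m) + p′ * m ≡ (y + p′ * m) + q * m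
  trans-lemma₂ = solve-∀
  +-lemma : ∀ x p m x′ p′ → (x + x′) + (p + p′) * m ≡ (x + p * m) + (x′ + p′ * m)
  +-lemma = solve-∀
  *-lemma : ∀ c x p m → c * x + (c * p) * m ≡ c * (x + p * m)
  *-lemma = solve-∀

≈-trans : ∀ {m x y z} → x ≈ y mod m → y ≈ z mod m → x ≈ z mod m
≈-trans {m} {x} {y} {z} (by p q e) (by p′ q′ e′) = by (p + p′) (q + q′) (begin
  x + (p + p′) * m       ≡⟨ trans-lemma₁ x p p′ m ⟩
  (x + p * m) + p′ * m   ≡⟨ cong (_+ p′ * m) e ⟩
  (y + q * m) + p′ * m   ≡⟨ trans-lemma₂ y q p′ m ⟩
  (y + p′ * m) + q * m   ≡⟨ cong (_+ q * m) e′ ⟩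
  (z + q′ * m) + q * m   ≡⟨ trans-lemma₁ z q′ q m ⟨
  z + (q′ + q) * m       ≡⟨ cong (λ t → z + t * m) (+-comm q′ q) ⟩
  z + (q + q′) * m       ∎)
  where open ≡-Reasoning

≈-+ : ∀ {m x y x′ y′} → x ≈ y mod m → x′ ≈ y′ mod m → x + x′ ≈ y + y′ mod m
≈-+ {m} {x} {y} {x′} {y′} (by p q e) (by p′ q′ e′) = by (p + p′) (q + q′)
  (trans (+-lemma x p m x′ p′) (trans (cong₂ _+_ e e′) (sym (+-lemma y q m y′ q′))))

≈-*ˡ : ∀ {m x y} c → x ≈ y mod m → c * x ≈ c * y mod m
≈-*ˡ {m} {x} {y} c (by p q e) = by (c * p) (c * q)
  (trans (*-lemma c x p m) (trans (cong (c *_) e) (sym (*-lemma c y q m))))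

≈-*ʳ : ∀ {m x y} c → x ≈ y mod m → x * c ≈ y * c mod m
≈-*ʳ {m} {x} {y} c e = subst₂ (λ a b → a ≈ b mod m) (*-comm c x) (*-comm c y) (≈-*ˡ c e)

∣⇒≈0 : ∀ {m x} → m ∣ x → x ≈ 0 mod m
∣⇒≈0 {m} {x} (divides q e) = by 0 q (trans (+-identityʳ x) e)

≈⇒∣diff : ∀ {m x d} → x ≈ x + d mod m → m ∣ d
≈⇒∣diff {m} {x} {d} (by p q e) =
  ∣m+n∣m⇒∣n (divides p (+-cancelˡ-≡ x _ _ (begin
    x + (q * m + d)   ≡⟨ solve-lemma x (q * m) d ⟩
    x + d + q * m     ≡⟨ e ⟨
    x + p * m         ∎))) (n∣m*n q)
  where
  open ≡-Reasoning
  solve-lemma : ∀ x y d → x + (y + d) ≡ x + d + y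
  solve-lemma = solve-∀

≈0⇒∣ : ∀ {m x} → x ≈ 0 mod m → m ∣ x
≈0⇒∣ e = ≈⇒∣diff (≈-sym e)

∣-resp-≈ : ∀ {m x y} → x ≈ y mod m → m ∣ x → m ∣ y
∣-resp-≈ e d = ≈0⇒∣ (≈-trans (≈-sym e) (∣⇒≈0 d))

∣⇒≈ : ∀ {m x d} → m ∣ d → x + d ≈ x mod m
∣⇒≈ {m} {x} (divides q refl) = by 0 q (+-identityʳ _)

≈-mono-∣ : ∀ {κ m x y} → κ ∣ m → x ≈ y mod m → x ≈ y mod κ
≈-mono-∣ {κ} {m} {x} {y} (divides c refl) (by p q e) = by (p * c) (q * c)
  (trans (cong (x +_) (*-assoc p c κ)) (trans e (cong (y +_) (sym (*-assoc q c κ)))))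

≈-scale : ∀ {m x y} c → x ≈ y mod m → c * x ≈ c * y mod (c * m)
≈-scale {m} {x} {y} c (by p q e) = by p q (begin
  c * x + p * (c * m)  ≡⟨ lemma c x p m ⟩
  c * (x + p * m)      ≡⟨ cong (c *_) e ⟩
  c * (y + q * m)      ≡⟨ lemma c y q m ⟨
  c * y + q * (c * m)  ∎)
  where
  open ≡-Reasoning
  lemma : ∀ c x p m → c * x + p * (c * m) ≡ c * (x + p * m)
  lemma = solve-∀

-- For a symmetric claim only y = x + d with m ∣ d has to be treated; this replaces subtraction in
-- the uniqueness statements below.
≈-elim : ∀ {m} (P : ℕ → ℕ → Set) → (∀ {x y} → P x y → P y x) →
         (∀ x d → m ∣ d → P x (x + d)) → ∀ {x y} → x ≈ y mod m → P x y
≈-elim {m} P P-sym step {x} {y} e with ≤-total x y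
... | inj₁ x≤y = subst (P x) (m+[n∸m]≡n x≤y)
                   (step x (y ∸ x) (≈⇒∣diff (subst (λ t → x ≈ t mod m) (sym (m+[n∸m]≡n x≤y)) e)))
... | inj₂ y≤x = P-sym (subst (P y) (m+[n∸m]≡n y≤x)
                   (step y (x ∸ y) (≈⇒∣diff (subst (λ t → y ≈ t mod m) (sym (m+[n∸m]≡n y≤x)) (≈-sym e)))))

∣∧<⇒≡0 : ∀ {m d} → m ∣ d → d < m → d ≡ 0
∣∧<⇒≡0 {m} {zero}  _  _  = refl
∣∧<⇒≡0 {m} {suc d} m∣d d<m = contradiction (∣⇒≤ m∣d) (<⇒≱ d<m)

-- Representatives in [1 , m] are the ones used for weights and link coefficients, which must stay
-- positive; the zero element gets weight m.
≈∧range⇒≡ : ∀ {m x y} → 0 < x → x ≤ m → 0 < y → y ≤ m → x ≈ y mod m → x ≡ y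
≈∧range⇒≡ {m} 0<x x≤m 0<y y≤m e =
  ≈-elim P P-sym step e 0<x x≤m 0<y y≤m
  where
  P : ℕ → ℕ → Set
  P x y = 0 < x → x ≤ m → 0 < y → y ≤ m → x ≡ y
  P-sym : ∀ {x y} → P x y → P y x
  P-sym f a b c d = sym (f c d a b)
  step : ∀ x d → m ∣ d → P x (x + d)
  step x d m∣d 0<x _ _ x+d≤m =
    trans (sym (+-identityʳ x)) (cong (x +_) (sym (∣∧<⇒≡0 m∣d (<-≤-trans (m<n+m d 0<x) x+d≤m))))

≈∧<⇒≡ : ∀ {m x y} → x < m → y < m → x ≈ y mod m → x ≡ y
≈∧<⇒≡ {m} x<m y<m e = ≈-elim P P-sym step e x<m y<m
  where
  P : ℕ → ℕ → Set
  P x y = x < m → y < m → x ≡ y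
  P-sym : ∀ {x y} → P x y → P y x
  P-sym f a b = sym (f b a)
  step : ∀ x d → m ∣ d → P x (x + d)
  step x d m∣d _ x+d<m =
    trans (sym (+-identityʳ x)) (cong (x +_) (sym (∣∧<⇒≡0 m∣d (≤-<-trans (m≤n+m d x) x+d<m))))

-- Finite sums over the group

opaque
  ∑ : ∀ {n} → (Fin n → ℕ) → ℕ
  ∑ {n} F = sum (map F (allFin n))

  ∑-suc : ∀ {n} (F : Fin (suc n) → ℕ) → ∑ F ≡ F zero + ∑ (F ∘ suc)
  ∑-suc {n} F = cong (λ l → F zero + sum l)
    (trans (map-tabulate suc F) (sym (map-tabulate id (F ∘ suc))))

  ∑-cong : ∀ {n} {F G : Fin n → ℕ} → (∀ x → F x ≡ G x) → ∑ F ≡ ∑ G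
  ∑-cong {n} {F} {G} eq = go (allFin n)
    where
    go : ∀ xs → sum (map F xs) ≡ sum (map G xs)
    go []       = refl
    go (x ∷ xs) = cong₂ _+_ (eq x) (go xs)

  ∑-mono : ∀ {n} {F G : Fin n → ℕ} → (∀ x → F x ≤ G x) → ∑ F ≤ ∑ G
  ∑-mono {n} {F} {G} le = go (allFin n)
    where
    go : ∀ xs → sum (map F xs) ≤ sum (map G xs)
    go []       = z≤n
    go (x ∷ xs) = +-mono-≤ (le x) (go xs)

  ∑-+ : ∀ {n} (F G : Fin n → ℕ) → ∑ (λ x → F x + G x) ≡ ∑ F + ∑ G
  ∑-+ {n} F G = go (allFin n)
    where
    lemma : ∀ a b c d → a + b + (c + d) ≡ a + c + (b + d)
    lemma = solve-∀
    go : ∀ xs → sum (map (λ x → F x + G x) xs) ≡ sum (map F xs) + sum (map G xs)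
    go []       = refl
    go (x ∷ xs) = trans (cong (F x + G x +_) (go xs)) (lemma (F x) (G x) _ _)

  ∑-*ˡ : ∀ {n} c (F : Fin n → ℕ) → ∑ (λ x → c * F x) ≡ c * ∑ F
  ∑-*ˡ {n} c F = go (allFin n)
    where
    go : ∀ xs → sum (map (λ x → c * F x) xs) ≡ c * sum (map F xs)
    go []       = sym (*-zeroʳ c)
    go (x ∷ xs) = trans (cong (c * F x +_) (go xs)) (sym (*-distribˡ-+ c (F x) _))

  ∑-*ʳ : ∀ {n} (F : Fin n → ℕ) c → ∑ (λ x → F x * c) ≡ ∑ F * c
  ∑-*ʳ F c = trans (∑-cong (λ x → *-comm (F x) c)) (trans (∑-*ˡ c F) (*-comm c (∑ F)))

  ∑-zero : ∀ {n} (F : Fin n → ℕ) → (∀ x → F x ≡ 0) → ∑ F ≡ 0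
  ∑-zero F eq = trans (∑-cong eq) (∑-*ˡ 0 F)

  ∑-≈ : ∀ {n m} {F G : Fin n → ℕ} → (∀ x → F x ≈ G x mod m) → ∑ F ≈ ∑ G mod m
  ∑-≈ {n} {m} {F} {G} eq = go (allFin n)
    where
    go : ∀ xs → sum (map F xs) ≈ sum (map G xs) mod m
    go []       = ≈-refl
    go (x ∷ xs) = ≈-+ (eq x) (go xs)

  term≤∑ : ∀ {n} (F : Fin n → ℕ) x → F x ≤ ∑ F
  term≤∑ F zero    = ≤-trans (m≤m+n _ _) (≤-reflexive (sym (∑-suc F)))
  term≤∑ F (suc x) = ≤-trans (≤-trans (term≤∑ (F ∘ suc) x) (m≤n+m _ (F zero))) (≤-reflexive (sym (∑-suc F)))

  ∑-swap : ∀ {n m} (F : Fin n → Fin m → ℕ) → ∑ (λ x → ∑ (F x)) ≡ ∑ (λ y → ∑ (λ x → F x y))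
  ∑-swap {n} {m} F = go (allFin n)
    where
    go : ∀ xs → sum (map (λ x → ∑ (F x)) xs) ≡ ∑ (λ y → sum (map (λ x → F x y) xs))
    go []       = sym (∑-zero {m} (λ _ → 0) (λ _ → refl))
    go (x ∷ xs) = trans (cong (∑ (F x) +_) (go xs)) (sym (∑-+ (F x) _))

  len≡∑ : ∀ {n} (S : Seq n) → len S ≡ ∑ S
  len≡∑ S = refl

  sumℕ≡∑ : ∀ {n} (S : Seq n) → sumℕ S ≡ ∑ (λ x → S x * toℕ x)
  sumℕ≡∑ S = refl

∑-positive : ∀ {n} (F : Fin n → ℕ) → 0 < ∑ F → ∃[ x ] 0 < F x
∑-positive {zero}  F 0<∑ = contradiction (∑-zero F (λ ())) (n>0⇒n≢0 0<∑)
∑-positive {suc n} F 0<∑ = go (F zero) refl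
  where
  go : ∀ c → F zero ≡ c → ∃[ x ] 0 < F x
  go (suc c) eq = zero , subst (0 <_) (sym eq) z<s
  go zero    eq with ∑-positive (F ∘ suc) (≤-trans 0<∑ (≤-reflexive (trans (∑-suc F) (cong (_+ ∑ (F ∘ suc)) eq))))
  ... | x , 0<Fx = suc x , 0<Fx

δ : ∀ {n} → Fin n → Seq n
δ f x with f ≟ x
... | yes _ = 1
... | no  _ = 0

δ-same : ∀ {n} (f : Fin n) → δ f f ≡ 1
δ-same f with f ≟ f
... | yes _  = refl
... | no f≢f = contradiction refl f≢f

δ-diff : ∀ {n} {f x : Fin n} → f ≢ x → δ f x ≡ 0
δ-diff {f = f} {x} f≢x with f ≟ x
... | yes f≡x = contradiction f≡x f≢x
... | no _    = refl

δ-sym : ∀ {n} (f x : Fin n) → δ f x ≡ δ x f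
δ-sym f x with f ≟ x
... | yes refl = sym (δ-same f)
... | no f≢x   = sym (δ-diff (f≢x ∘ sym))

∑-δ : ∀ {n} (f : Fin n) (F : Fin n → ℕ) → ∑ (λ x → δ f x * F x) ≡ F f
∑-δ {suc n} zero F = begin
  ∑ (λ x → δ zero x * F x)                       ≡⟨ ∑-suc (λ x → δ zero x * F x) ⟩
  1 * F zero + ∑ (λ x → δ zero (suc x) * F (suc x)) ≡⟨ cong₂ _+_ (*-identityˡ (F zero)) (∑-zero {n} (λ _ → 0) (λ _ → refl)) ⟩
  F zero + 0                                      ≡⟨ +-identityʳ _ ⟩
  F zero                                          ∎
  where open ≡-Reasoning
∑-δ {suc n} (suc f) F = begin
  ∑ (λ x → δ (suc f) x * F x)             ≡⟨ ∑-suc (λ x → δ (suc f) x * F x) ⟩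
  ∑ (λ x → δ (suc f) (suc x) * F (suc x)) ≡⟨ ∑-cong (λ x → cong (_* F (suc x)) (δ-suc f x)) ⟩
  ∑ (λ x → δ f x * F (suc x))             ≡⟨ ∑-δ f (F ∘ suc) ⟩
  F (suc f)                               ∎
  where
  open ≡-Reasoning
  δ-suc : ∀ {n} (f x : Fin n) → δ (suc f) (suc x) ≡ δ f x
  δ-suc f x with f ≟ x
  ... | yes _ = refl
  ... | no _  = refl

≈-cancelʳ-+ : ∀ {m x y} z → x + z ≈ y + z mod m → x ≈ y mod m
≈-cancelʳ-+ {m} {x} {y} z (by p q e) =
  by p q (+-cancelʳ-≡ z _ _ (trans (lemma x (p * m) z) (trans e (lemma y z (q * m)))))
  where
  lemma : ∀ x y z → x + y + z ≡ x + z + y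
  lemma = solve-∀

-- Weights and factorizations

infixr 21 _⊛_
_⊛_ : ∀ {n} → ℕ → Seq n → Seq n
(c ⊛ S) x = c * S x

wt : ∀ {n} → (Fin n → ℕ) → Seq n → ℕ
wt W S = ∑ (λ x → S x * W x)

wt-cong : ∀ {n} (W : Fin n → ℕ) {S T : Seq n} → (∀ x → S x ≡ T x) → wt W S ≡ wt W T
wt-cong W eq = ∑-cong (λ x → cong (_* W x) (eq x))

wt-· : ∀ {n} (W : Fin n → ℕ) (S T : Seq n) → wt W (S · T) ≡ wt W S + wt W T
wt-· W S T = trans (∑-cong (λ x → *-distribʳ-+ (W x) (S x) (T x))) (∑-+ _ _)

wt-⊛ : ∀ {n} (W : Fin n → ℕ) c (S : Seq n) → wt W (c ⊛ S) ≡ c * wt W S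
wt-⊛ W c S = trans (∑-cong (λ x → *-assoc c (S x) (W x))) (∑-*ˡ c _)

wt-⊛δ : ∀ {n} (W : Fin n → ℕ) c f → wt W (c ⊛ δ f) ≡ c * W f
wt-⊛δ W c f = trans (wt-⊛ W c (δ f)) (cong (c *_) (∑-δ f W))

wt-pair : ∀ {n} (W : Fin n → ℕ) a g b f → wt W (a ⊛ δ g · b ⊛ δ f) ≡ a * W g + b * W f
wt-pair W a g b f = trans (wt-· W (a ⊛ δ g) (b ⊛ δ f)) (cong₂ _+_ (wt-⊛δ W a g) (wt-⊛δ W b f))

⊛δ-same : ∀ {n} c (f : Fin n) → (c ⊛ δ f) f ≡ c
⊛δ-same c f = trans (cong (c *_) (δ-same f)) (*-identityʳ c)

⊛δ-diff : ∀ {n} c {f x : Fin n} → f ≢ x → (c ⊛ δ f) x ≡ 0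
⊛δ-diff c f≢x = trans (cong (c *_) (δ-diff f≢x)) (*-zeroʳ c)

len-positive : ∀ {n} (S : Seq n) x → 0 < S x → 0 < len S
len-positive S x 0<Sx = ≤-trans 0<Sx (≤-trans (term≤∑ S x) (≤-reflexive (sym (len≡∑ S))))

len-positive⇒nonempty : ∀ {n} (S : Seq n) → 0 < len S → ∃[ x ] 0 < S x
len-positive⇒nonempty S 0<len = ∑-positive S (subst (0 <_) (len≡∑ S) 0<len)

zeroSum⇒∣wt : ∀ {n} (S : Seq n) → ZeroSum S → n ∣ wt toℕ S
zeroSum⇒∣wt {n} S = subst (n ∣_) (sumℕ≡∑ S)

∣wt⇒zeroSum : ∀ {n} (S : Seq n) → n ∣ wt toℕ S → ZeroSum S
∣wt⇒zeroSum {n} S = subst (n ∣_) (sym (sumℕ≡∑ S))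

atom-cong : ∀ {n} {S T : Seq n} → (∀ x → S x ≡ T x) → MinimalZeroSum S → MinimalZeroSum T
atom-cong {n} {S} {T} eq (0<len , zs , min) =
  subst (0 <_) (trans (len≡∑ S) (trans (∑-cong eq) (sym (len≡∑ T)))) 0<len ,
  ∣wt⇒zeroSum T (subst (n ∣_) (wt-cong toℕ eq) (zeroSum⇒∣wt S zs)) ,
  λ R R≼T zsR 0<R x → trans (min R (λ y → ≤-trans (R≼T y) (≤-reflexive (sym (eq y)))) zsR 0<R x) (eq x)

InL-cong : ∀ {n} {B B′ : Seq n} {l} → (∀ x → B x ≡ B′ x) → InL B l → InL B′ l
InL-cong eq (fs , atoms , len≡ , prod≡) = fs , atoms , len≡ , λ x → trans (prod≡ x) (eq x)

prodSeq-++ : ∀ {n} (fs gs : List (Seq n)) x → prodSeq (fs ++ gs) x ≡ prodSeq fs x + prodSeq gs x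
prodSeq-++ []       gs x = refl
prodSeq-++ (f ∷ fs) gs x = trans (cong (f x +_) (prodSeq-++ fs gs x)) (sym (+-assoc (f x) _ _))

InL-· : ∀ {n} {B B′ : Seq n} {l l′} → InL B l → InL B′ l′ → InL (B · B′) (l + l′)
InL-· (fs , atoms , len≡ , prod≡) (fs′ , atoms′ , len′≡ , prod′≡) =
  fs ++ fs′ , ++⁺ atoms atoms′ , trans (length-++ fs) (cong₂ _+_ len≡ len′≡) ,
  λ x → trans (prodSeq-++ fs fs′ x) (cong₂ _+_ (prod≡ x) (prod′≡ x))

InL-ε : ∀ {n} → InL {n} emptySeq 0
InL-ε = [] , [] , refl , λ _ → refl

InL-atom : ∀ {n} {A : Seq n} → MinimalZeroSum A → InL A 1
InL-atom {A = A} atom = A ∷ [] , atom ∷ [] , refl , λ x → +-identityʳ (A x)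

InL-⊛ : ∀ {n} {B : Seq n} {l} c → InL B l → InL (c ⊛ B) (c * l)
InL-⊛ zero    inL = InL-ε
InL-⊛ (suc c) inL = InL-· inL (InL-⊛ c inL)

opaque
  unfolding ∑

  InL-∑ : ∀ {n} (μ : Fin n → ℕ) (A : Fin n → Seq n) → (∀ x → 0 < μ x → MinimalZeroSum (A x)) →
          InL (λ y → ∑ (λ x → μ x * A x y)) (∑ μ)
  InL-∑ {n} μ A atoms = go (allFin n)
    where
    -- Splitting on the multiplicity separates the case μ x = 0, in which A x need not be an atom.
    power : ∀ x c → c ≡ μ x → InL (c ⊛ A x) c
    power x zero    _  = InL-ε
    power x (suc c) eq = subst (InL (suc c ⊛ A x)) (*-identityʳ (suc c))
      (InL-⊛ (suc c) (InL-atom (atoms x (subst (0 <_) eq z<s))))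
    go : ∀ xs → InL (λ y → sum (map (λ x → μ x * A x y) xs)) (sum (map μ xs))
    go []       = InL-ε
    go (x ∷ xs) = InL-· (power x (μ x) refl) (go xs)

InB-· : ∀ {n} {G0 : Subset n} {B B′} → InB G0 B → InB G0 B′ → InB G0 (B · B′)
InB-· {n} {G0} {B} {B′} (over , zs) (over′ , zs′) =
  (λ x → go x (B x) refl) , ∣wt⇒zeroSum (B · B′) (subst (n ∣_) (sym (wt-· toℕ B B′)) (∣m∣n⇒∣m+n (zeroSum⇒∣wt B zs) (zeroSum⇒∣wt B′ zs′)))
  where
  go : ∀ x b → B x ≡ b → 0 < B x + B′ x → x ∈ G0
  go x (suc b) eq 0<  = over x (subst (0 <_) (sym eq) z<s)
  go x zero    eq 0<  = over′ x (subst (λ b → 0 < b + B′ x) eq 0<)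

InB-⊛ : ∀ {n} {G0 : Subset n} {B} c → InB G0 B → InB G0 (c ⊛ B)
InB-⊛ {n} {G0} {B} c (over , zs) =
  (λ x 0< → over x (n≢0⇒n>0 λ eq → n>0⇒n≢0 0< (trans (cong (c *_) eq) (*-zeroʳ c)))) ,
  ∣wt⇒zeroSum (c ⊛ B) (subst (n ∣_) (sym (wt-⊛ toℕ c B)) (∣n⇒∣m*n c (zeroSum⇒∣wt B zs)))

-- Lengths modulo min Δ

minΔ-positive : ∀ {n} {G0 : Subset n} {k} → IsMinΔ G0 k → 0 < k
minΔ-positive ((_ , _ , 0<k , _) , _) = 0<k

-- A gap smaller than min Δ between two lengths contains, by descent, a pair of adjacent lengths.
minΔ-no-smaller-gap : ∀ {n} {G0 : Subset n} {k} → IsMinΔ G0 k → ∀ ρ → 0 < ρ → ρ < k →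
                      ∀ {B l} → InB G0 B → InL B l → ¬ InL B (l + ρ)
minΔ-no-smaller-gap {n} {G0} {k} (_ , minimal) = <-rec P step
  where
  P : ℕ → Set
  P ρ = 0 < ρ → ρ < k → ∀ {B l} → InB G0 B → InL B l → ¬ InL B (l + ρ)
  step : ∀ ρ → (∀ {σ} → σ < ρ → P σ) → P ρ
  step ρ rec 0<ρ ρ<k {B} {l} inB Ll Lρ =
    <⇒≱ ρ<k (minimal ρ (B , inB , 0<ρ , l , Ll , Lρ , λ j l<j j<l+ρ Lj →
      let σ<ρ = +-cancelˡ-< l _ _ (subst (_< l + ρ) (sym (m+[n∸m]≡n (<⇒≤ l<j))) j<l+ρ)
      in rec σ<ρ (m<n⇒0<n∸m l<j) (<-trans σ<ρ ρ<k) inB Ll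
           (subst (InL B) (sym (m+[n∸m]≡n (<⇒≤ l<j))) Lj)))

-- A sequence B₀ with lengths l₀ and l₀ + k acts as a correction: multiplying by x / k copies of it
-- reduces a gap x to x % k, which must be 0 because gaps below k do not occur.
minΔ⇒lengths-≈ : ∀ {n} {G0 : Subset n} {k} → IsMinΔ G0 k →
                 ∀ {B l l′} → InB G0 B → InL B l → InL B l′ → l ≈ l′ mod k
minΔ⇒lengths-≈ {n} {G0} {k} isMin@((B₀ , inB₀ , 0<k , l₀ , L₀ , L₀+k , _) , _) {B} {l} {l′} inB Ll Ll′
  = go (≤-total l l′)
  where
  instance _ = >-nonZero 0<k
  shift₁ : ∀ l q l₀ k → l + q * (l₀ + k) ≡ l + q * l₀ + q * k
  shift₁ = solve-∀
  shift₂ : ∀ l x y z → l + (z + x) + y ≡ l + y + x + z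
  shift₂ = solve-∀
  ordered : ∀ {l} x → InL B l → InL B (l + x) → k ∣ x
  ordered {l} x Ll Lx with x % k in eq
  ... | zero  = m%n≡0⇒n∣m x k eq
  ... | suc ρ = ⊥-elim (minΔ-no-smaller-gap isMin (suc ρ) z<s (subst (_< k) eq (m%n<n x k))
      (InB-· inB (InB-⊛ (x / k) inB₀))
      (subst (InL _) (shift₁ l (x / k) l₀ k) (InL-· Ll (InL-⊛ (x / k) L₀+k)))
      (subst (InL _) (trans (cong (λ t → l + t + x / k * l₀) (trans (m≡m%n+[m/n]*n x k) (cong (_+ x / k * k) eq)))
                            (shift₂ l (x / k * k) (x / k * l₀) (suc ρ)))
        (InL-· Lx (InL-⊛ (x / k) L₀))))
  go : l ≤ l′ ⊎ l′ ≤ l → l ≈ l′ mod k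
  go (inj₁ l≤l′) = subst (λ t → l ≈ t mod k) (m+[n∸m]≡n l≤l′)
    (≈-sym (∣⇒≈ (ordered (l′ ∸ l) Ll (subst (InL B) (sym (m+[n∸m]≡n l≤l′)) Ll′))))
  go (inj₂ l′≤l) = subst (λ t → t ≈ l′ mod k) (m+[n∸m]≡n l′≤l)
    (∣⇒≈ (ordered (l ∸ l′) Ll′ (subst (InL B) (sym (m+[n∸m]≡n l′≤l)) Ll)))

-- The weight of B is m times the sum of the norms N in any factorization, so it ties two lengths
-- together. The factor q serves for norms controlled only after multiplication by q; κ = 0 gives
-- equality of lengths.
length-functional : ∀ {n} {G0 : Subset n} (W : Fin n → ℕ) {m κ} q → 0 < m →
  (∀ U → MinimalZeroSum U → Over G0 U → ∃[ N ] (wt W U ≡ m * N × q * N ≈ q mod κ)) →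
  ∀ {B l l′} → Over G0 B → InL B l → InL B l′ → q * l ≈ q * l′ mod κ
length-functional {n} {G0} W {m} {κ} q 0<m atomic {B} overB Ll Ll′
  with weigh Ll | weigh Ll′
  where
  weigh-product : ∀ fs → All MinimalZeroSum fs → (∀ x → 0 < prodSeq fs x → x ∈ G0) →
                  ∃[ N ] (wt W (prodSeq fs) ≡ m * N × q * N ≈ q * length fs mod κ)
  weigh-product []       []             over = 0 , trans (∑-zero (λ _ → 0) (λ _ → refl)) (sym (*-zeroʳ m)) , ≈-refl
  weigh-product (U ∷ fs) (atom ∷ atoms) over
    with atomic U atom (λ x 0< → over x (≤-trans 0< (m≤m+n _ _)))
       | weigh-product fs atoms (λ x 0< → over x (≤-trans 0< (m≤n+m _ (U x))))
  ... | N , eq , cg | N′ , eq′ , cg′ = N + N′ ,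
    trans (wt-· W U (prodSeq fs)) (trans (cong₂ _+_ eq eq′) (sym (*-distribˡ-+ m N N′))) ,
    subst₂ (λ a b → a ≈ b mod κ) (sym (*-distribˡ-+ q N N′)) (sym (*-suc q (length fs))) (≈-+ cg cg′)
  weigh : ∀ {l} → InL B l → ∃[ N ] (wt W B ≡ m * N × q * N ≈ q * l mod κ)
  weigh (fs , atoms , refl , prod≡)
    with weigh-product fs atoms (λ x 0< → overB x (subst (0 <_) (prod≡ x) 0<))
  ... | N , eq , cg = N , trans (wt-cong W (λ x → sym (prod≡ x))) eq , cg
... | N , eq , cg | N′ , eq′ , cg′ =
  ≈-trans (≈-sym cg) (subst (λ t → q * t ≈ _ mod κ) (sym N≡N′) cg′)
  where
  instance _ = >-nonZero 0<m
  N≡N′ : N ≡ N′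
  N≡N′ = *-cancelˡ-≡ N N′ m (trans (sym eq) eq′)

-- The exchange, and atoms over one or two elements

-- Trading c copies of U together with copies of f^o for the atoms x^(r x) f^(o ∸ s x).
exchange : ∀ {n} {U : Seq n} {f o} → MinimalZeroSum U → MinimalZeroSum (o ⊛ δ f) →
  (c κ : ℕ) (μ r s : Fin n → ℕ) → (∀ x → s x ≤ o) →
  (∀ x → 0 < μ x → MinimalZeroSum (r x ⊛ δ x · (o ∸ s x) ⊛ δ f)) →
  (∀ x → c * U x ≡ μ x * r x) → ∑ (λ x → μ x * s x) ≡ κ * o →
  let B = c ⊛ U · ∑ μ ⊛ o ⊛ δ f in InL B (c + ∑ μ) × InL B (κ + ∑ μ)
exchange {n} {U} {f} {o} atomU atomF c κ μ r s s≤o atoms cU≡μr ∑μs≡κo =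
  InL-· (power c atomU) (power (∑ μ) atomF) ,
  InL-cong pointwise (InL-· (power κ atomF) (InL-∑ μ A atoms))
  where
  open ≡-Reasoning
  A : Fin n → Seq n
  A x = r x ⊛ δ x · (o ∸ s x) ⊛ δ f
  power : ∀ {S : Seq n} c → MinimalZeroSum S → InL (c ⊛ S) c
  power {S} c atom = subst (InL (c ⊛ S)) (*-identityʳ c) (InL-⊛ c (InL-atom atom))
  expand : ∀ μ r d t e → μ * (r * d + t * e) ≡ d * (μ * r) + (μ * t) * e
  expand = solve-∀
  regroup : ∀ κ o e c t → κ * (o * e) + (c + t * e) ≡ c + (κ * o + t) * e
  regroup = solve-∀
  total : κ * o + ∑ (λ x → μ x * (o ∸ s x)) ≡ ∑ μ * o
  total = begin
    κ * o + ∑ (λ x → μ x * (o ∸ s x))               ≡⟨ cong (_+ ∑ (λ x → μ x * (o ∸ s x))) ∑μs≡κo ⟨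
    ∑ (λ x → μ x * s x) + ∑ (λ x → μ x * (o ∸ s x)) ≡⟨ ∑-+ (λ x → μ x * s x) _ ⟨
    ∑ (λ x → μ x * s x + μ x * (o ∸ s x))           ≡⟨ ∑-cong (λ x → trans (sym (*-distribˡ-+ (μ x) (s x) _))
                                                         (cong (μ x *_) (m+[n∸m]≡n (s≤o x)))) ⟩
    ∑ (λ x → μ x * o)                               ≡⟨ ∑-*ʳ μ o ⟩
    ∑ μ * o                                         ∎
  pointwise : ∀ y → κ * (o * δ f y) + ∑ (λ x → μ x * A x y) ≡ c * U y + ∑ μ * (o * δ f y)
  pointwise y = begin
    κ * (o * δ f y) + ∑ (λ x → μ x * A x y)
      ≡⟨ cong (κ * (o * δ f y) +_) (trans
           (∑-cong (λ x → trans (expand (μ x) (r x) (δ x y) (o ∸ s x) (δ f y))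
             (cong (λ d → d * (μ x * r x) + μ x * (o ∸ s x) * δ f y) (δ-sym x y))))
           (trans (∑-+ (λ x → δ y x * (μ x * r x)) _)
             (cong₂ _+_ (∑-δ y (λ x → μ x * r x)) (∑-*ʳ (λ x → μ x * (o ∸ s x)) (δ f y))))) ⟩
    κ * (o * δ f y) + (μ y * r y + ∑ (λ x → μ x * (o ∸ s x)) * δ f y)
      ≡⟨ regroup κ o (δ f y) (μ y * r y) _ ⟩
    μ y * r y + (κ * o + ∑ (λ x → μ x * (o ∸ s x))) * δ f y
      ≡⟨ cong₂ _+_ (sym (cU≡μr y)) (cong (_* δ f y) total) ⟩
    c * U y + ∑ μ * o * δ f y
      ≡⟨ cong (c * U y +_) (*-assoc (∑ μ) o (δ f y)) ⟩
    c * U y + ∑ μ * (o * δ f y) ∎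

power-atom : ∀ {n} {f : Fin n} {o} → 0 < o → n ∣ o * toℕ f →
  (∀ y → y ≤ o → n ∣ y * toℕ f → y ≡ 0 ⊎ y ≡ o) → MinimalZeroSum (o ⊛ δ f)
power-atom {n} {f} {o} 0<o zs min =
  len-positive (o ⊛ δ f) f (subst (0 <_) (sym (⊛δ-same o f)) 0<o) ,
  ∣wt⇒zeroSum (o ⊛ δ f) (subst (n ∣_) (sym (wt-⊛δ toℕ o f)) zs) , minimal
  where
  minimal : ∀ T → T ≼ (o ⊛ δ f) → ZeroSum T → 0 < len T → ∀ x → T x ≡ (o ⊛ δ f) x
  minimal T T≼ zsT 0<T = go (min (T f) Tf≤o (subst (n ∣_) (trans (wt-cong toℕ T≡) (wt-⊛δ toℕ (T f) f)) (zeroSum⇒∣wt T zsT)))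
    where
    Tf≤o : T f ≤ o
    Tf≤o = ≤-trans (T≼ f) (≤-reflexive (⊛δ-same o f))
    T≡ : ∀ x → T x ≡ (T f ⊛ δ f) x
    T≡ x with f ≟ x
    ... | yes refl = sym (*-identityʳ (T f))
    ... | no f≢x   = trans (n≤0⇒n≡0 (≤-trans (T≼ x) (≤-reflexive (⊛δ-diff o f≢x)))) (sym (*-zeroʳ (T f)))
    go : T f ≡ 0 ⊎ T f ≡ o → ∀ x → T x ≡ (o ⊛ δ f) x
    go (inj₁ eq) = ⊥-elim (n>0⇒n≢0 0<T (trans (len≡∑ T) (∑-zero T (λ x → trans (T≡ x) (cong (_* δ f x) eq)))))
    go (inj₂ eq) x = trans (T≡ x) (cong (_* δ f x) eq)

pair-atom : ∀ {n} {f g : Fin n} {a b} → g ≢ f → 0 < a → n ∣ a * toℕ g + b * toℕ f →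
  (∀ y z → y ≤ a → z ≤ b → n ∣ y * toℕ g + z * toℕ f → (y ≡ 0 × z ≡ 0) ⊎ (y ≡ a × z ≡ b)) →
  MinimalZeroSum (a ⊛ δ g · b ⊛ δ f)
pair-atom {n} {f} {g} {a} {b} g≢f 0<a zs min =
  len-positive A g (subst (0 <_) (sym Ag≡a) 0<a) ,
  ∣wt⇒zeroSum A (subst (n ∣_) (sym (wt-pair toℕ a g b f)) zs) , minimal
  where
  A : Seq n
  A = a ⊛ δ g · b ⊛ δ f
  Ag≡a : A g ≡ a
  Ag≡a = trans (cong₂ _+_ (⊛δ-same a g) (⊛δ-diff b (g≢f ∘ sym))) (+-identityʳ a)
  Af≡b : A f ≡ b
  Af≡b = cong₂ _+_ (⊛δ-diff a g≢f) (⊛δ-same b f)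
  minimal : ∀ T → T ≼ A → ZeroSum T → 0 < len T → ∀ x → T x ≡ A x
  minimal T T≼ zsT 0<T = go (min (T g) (T f) (≤-trans (T≼ g) (≤-reflexive Ag≡a)) (≤-trans (T≼ f) (≤-reflexive Af≡b))
      (subst (n ∣_) (trans (wt-cong toℕ T≡) (wt-pair toℕ (T g) g (T f) f)) (zeroSum⇒∣wt T zsT)))
    where
    T≡ : ∀ x → T x ≡ (T g ⊛ δ g · T f ⊛ δ f) x
    T≡ x with g ≟ x | f ≟ x
    ... | yes refl | yes refl = ⊥-elim (g≢f refl)
    ... | yes refl | no _     = sym (trans (cong₂ _+_ (*-identityʳ (T g)) (*-zeroʳ (T f))) (+-identityʳ (T g)))
    ... | no _     | yes refl = sym (cong₂ _+_ (*-zeroʳ (T g)) (*-identityʳ (T f)))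
    ... | no g≢x   | no f≢x   = trans (n≤0⇒n≡0 (≤-trans (T≼ x) (≤-reflexive (cong₂ _+_ (⊛δ-diff a g≢x) (⊛δ-diff b f≢x)))))
                                  (sym (cong₂ _+_ (*-zeroʳ (T g)) (*-zeroʳ (T f))))
    go : (T g ≡ 0 × T f ≡ 0) ⊎ (T g ≡ a × T f ≡ b) → ∀ x → T x ≡ A x
    go (inj₁ (eq , eq′)) = ⊥-elim (n>0⇒n≢0 0<T (trans (len≡∑ T) (∑-zero T (λ x → trans (T≡ x) (cong₂ _+_ (cong (_* δ g x) eq) (cong (_* δ f x) eq′))))))
    go (inj₂ (eq , eq′)) x = trans (T≡ x) (cong₂ _+_ (cong (_* δ g x) eq) (cong (_* δ f x) eq′))

-- Inverses, orders and indices

inverse-mod : ∀ {M c} → Coprime M c → ∃[ t ] t * c ≈ 1 mod M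
inverse-mod {M} {c} cop with coprime-Bézout (Coprimality.sym cop)
... | Bézout.+- x y eq = x , by 0 y (trans (+-identityʳ _) (sym eq))
-- Here 1 + x c = y M, so x c ≡ -1, and x c x is an inverse of c because (x c)² ≡ 1.
... | Bézout.-+ x y eq = x * c * x , ≈-cancelʳ-+ (x * c)
  (≈-trans (∣⇒≈0 (divides (x * c * y) (trans (lemma x c) (trans (cong (x * c *_) eq) (sym (*-assoc (x * c) y M))))))
           (≈-sym (∣⇒≈0 (divides y eq))))
  where
  lemma : ∀ x c → x * c * x * c + x * c ≡ x * c * (1 + x * c)
  lemma = solve-∀

-- Residue 0 is represented by M. In particular M = 1 gives i = 1, so elements with trivial common
-- subgroup count as compatible.
positive-residue : ∀ M → 0 < M → ∀ x → ∃[ i ] (0 < i × i ≤ M × i ≈ x mod M)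
positive-residue M 0<M x = go (x % M) refl
  where
  instance _ = >-nonZero 0<M
  go : ∀ ρ → x % M ≡ ρ → ∃[ i ] (0 < i × i ≤ M × i ≈ x mod M)
  go zero    eq = M , 0<M , ≤-refl ,
    ≈-trans (∣⇒≈0 ∣-refl) (≈-sym (∣⇒≈0 (m%n≡0⇒n∣m x M eq)))
  go (suc ρ) eq = suc ρ , z<s , <⇒≤ (subst (_< M) eq (m%n<n x M)) ,
    by (x / M) 0 (trans (cong (_+ x / M * M) (sym eq)) (trans (sym (m≡m%n+[m/n]*n x M)) (sym (+-identityʳ x))))

record IsOrder {n} (x : Fin n) (o : ℕ) : Set where
  field
    order-positive : 0 < o
    order-zero     : n ∣ o * toℕ x
    order-divides  : ∀ {y} → n ∣ y * toℕ x → o ∣ y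
open IsOrder public

order-∣ : ∀ {n} {x : Fin n} {o y} → IsOrder x o → o ∣ y → n ∣ y * toℕ x
order-∣ {n} {x} {o} ox (divides q refl) = subst (n ∣_) (sym (*-assoc q o (toℕ x))) (∣n⇒∣m*n q (order-zero ox))

order-cancel : ∀ {n} {x : Fin n} {o a b} → IsOrder x o → a * toℕ x ≈ b * toℕ x mod n → a ≈ b mod o
order-cancel {n} {x} {o} {a} {b} ox e = go (≤-total a b)
  where
  ordered : ∀ {a b} → a ≤ b → a * toℕ x ≈ b * toℕ x mod n → a ≈ b mod o
  ordered {a} {b} a≤b e = subst (λ t → a ≈ t mod o) (m+[n∸m]≡n a≤b) (≈-sym (∣⇒≈
    (order-divides ox (≈⇒∣diff (subst (λ t → a * toℕ x ≈ t mod n)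
      (trans (cong (_* toℕ x) (sym (m+[n∸m]≡n a≤b))) (*-distribʳ-+ (toℕ x) a (b ∸ a))) e)))))
  go : a ≤ b ⊎ b ≤ a → a ≈ b mod o
  go (inj₁ a≤b) = ordered a≤b e
  go (inj₂ b≤a) = ≈-sym (ordered b≤a (≈-sym e))

order-atom : ∀ {n} {x : Fin n} {o} → IsOrder x o → MinimalZeroSum (o ⊛ δ x)
order-atom {n} {x} {o} ox = power-atom (order-positive ox) (order-zero ox) λ y y≤o zs → go (order-divides ox zs) y≤o
  where
  go : ∀ {y} → o ∣ y → y ≤ o → y ≡ 0 ⊎ y ≡ o
  go {zero}  _   _   = inj₁ refl
  go {suc y} o∣y y≤o = inj₂ (≤-antisym y≤o (∣⇒≤ o∣y))

Fin⇒positive : ∀ {n} → Fin n → 0 < n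
Fin⇒positive x = ≤-trans z<s (toℕ<n x)

opaque
  -- The index of ⟨x⟩ in ℤ/nℤ; since gcd(0 , n) = n, the zero element has index n and order 1.
  dv : ∀ {n} → Fin n → ℕ
  dv {n} x = gcd (toℕ x) n

  dv-∣ : ∀ {n} (x : Fin n) → dv x ∣ n
  dv-∣ {n} x = gcd[m,n]∣n (toℕ x) n

  ord : ∀ {n} → Fin n → ℕ
  ord x = quotient (dv-∣ x)

  cofactor : ∀ {n} → Fin n → ℕ
  cofactor {n} x = quotient (gcd[m,n]∣m (toℕ x) n)

  ord*dv : ∀ {n} (x : Fin n) → ord x * dv x ≡ n
  ord*dv x = sym (_∣_.equality (dv-∣ x))

  cofactor*dv : ∀ {n} (x : Fin n) → cofactor x * dv x ≡ toℕ x
  cofactor*dv {n} x = sym (_∣_.equality (gcd[m,n]∣m (toℕ x) n))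

  dv-positive : ∀ {n} (x : Fin n) → 0 < dv x
  dv-positive {n} x = n≢0⇒n>0 (gcd[m,n]≢0 (toℕ x) n (inj₂ (n>0⇒n≢0 (Fin⇒positive x))))

  ord-positive : ∀ {n} (x : Fin n) → 0 < ord x
  ord-positive {n} x = n≢0⇒n>0 λ eq → n>0⇒n≢0 (Fin⇒positive x) (trans (sym (ord*dv x)) (cong (_* dv x) eq))

  dv≤n : ∀ {n} (x : Fin n) → dv x ≤ n
  dv≤n {n} x = ∣⇒≤ {{>-nonZero (Fin⇒positive x)}} (dv-∣ x)

  ord-coprime : ∀ {n} (x : Fin n) → Coprime (ord x) (cofactor x)
  ord-coprime {n} x {e} (e∣o , e∣c) = ∣1⇒≡1 (*-cancelʳ-∣ (dv x) {{>-nonZero (dv-positive x)}}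
    (subst (e * dv x ∣_) (sym (*-identityˡ (dv x))) (gcd-greatest
      (subst (e * dv x ∣_) (cofactor*dv x) (*-monoˡ-∣ (dv x) e∣c))
      (subst (e * dv x ∣_) (ord*dv x) (*-monoˡ-∣ (dv x) e∣o)))))

isOrder : ∀ {n} (x : Fin n) → IsOrder x (ord x)
isOrder {n} x = record
  { order-positive = ord-positive x
  ; order-zero     = divides (cofactor x) (trans (cong (ord x *_) (sym (cofactor*dv x)))
                       (trans (lemma (ord x) (cofactor x) (dv x)) (cong (cofactor x *_) (ord*dv x))))
  ; order-divides  = λ {y} n∣yx → coprime-divisor (ord-coprime x)
      (*-cancelʳ-∣ (dv x) {{>-nonZero (dv-positive x)}}
        (subst₂ _∣_ (sym (ord*dv x)) (trans (cong (y *_) (sym (cofactor*dv x))) (lemma′ y (cofactor x) (dv x))) n∣yx))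
  }
  where
  lemma : ∀ o c d → o * (c * d) ≡ c * (o * d)
  lemma = solve-∀
  lemma′ : ∀ y c d → y * (c * d) ≡ c * y * d
  lemma′ = solve-∀

-- Two elements and their common subgroup

-- The cyclic groups generated by r·g and s·h both equal ⟨g⟩ ∩ ⟨h⟩, of order M, and s·h = i·(r·g).
record PairData {n} (g h : Fin n) : Set where
  field
    M T r s i : ℕ
    r*M       : r * M ≡ ord g
    s*M       : s * M ≡ ord h
    r*dv      : r * dv g ≡ T
    s*dv      : s * dv h ≡ T
    T*M       : T * M ≡ n
    r-s-coprime : Coprime r s
    0<i       : 0 < i
    i≤M       : i ≤ M
    link      : s * toℕ h ≈ i * (r * toℕ g) mod n

module _ {n} {g h : Fin n} (p : PairData g h) where
  open PairData p

  private
    combine-lemma : ∀ u r g v i → (u * r) * g + v * (i * (r * g)) ≡ ((u + i * v) * r) * g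
    combine-lemma = solve-∀

  positives : 0 < r * M × 0 < s * M
  positives = subst (0 <_) (sym r*M) (ord-positive g) , subst (0 <_) (sym s*M) (ord-positive h)

  r-positive : 0 < r
  r-positive = n≢0⇒n>0 λ eq → n>0⇒n≢0 (proj₁ positives) (cong (_* M) eq)

  s-positive : 0 < s
  s-positive = n≢0⇒n>0 λ eq → n>0⇒n≢0 (proj₂ positives) (cong (_* M) eq)

  M-positive : 0 < M
  M-positive = ≤-trans 0<i i≤M

  combine : ∀ u v → (u * r) * toℕ g + (v * s) * toℕ h ≈ ((u + i * v) * r) * toℕ g mod n
  combine u v = ≈-trans (≈-+ ≈-refl (subst (λ t → t ≈ v * (i * (r * toℕ g)) mod n) (sym (*-assoc v s (toℕ h))) (≈-*ˡ v link)))
    (≈-reflexive (combine-lemma u r (toℕ g) v i))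

  pair-zeroSum : ∀ {u v} → M ∣ u + i * v → n ∣ (u * r) * toℕ g + (v * s) * toℕ h
  pair-zeroSum {u} {v} dvd = ∣-resp-≈ (≈-sym (combine u v))
    (order-∣ (isOrder g) (subst₂ _∣_ (trans (*-comm M r) r*M) refl (*-monoˡ-∣ r dvd)))

  -- Multiplying a relation by ord g removes g, so s M = ord h divides r M z, and s ∣ z by
  -- coprimality; likewise r ∣ y. Relations therefore come in blocks of r copies of g and s copies
  -- of h.
  pair-zeroSum⁻¹ : ∀ {y z} → n ∣ y * toℕ g + z * toℕ h →
                   ∃[ u ] ∃[ v ] (y ≡ u * r × z ≡ v * s × M ∣ u + i * v)
  pair-zeroSum⁻¹ {y} {z} zs = go r∣y s∣z zs
    where
    instance
      _ = >-nonZero M-positive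
      _ = >-nonZero r-positive
    mixed : ∀ o y g z h → o * (y * g + z * h) ≡ (y * (o * g)) + (o * z) * h
    mixed = solve-∀
    mixed′ : ∀ o y g z h → o * (y * g + z * h) ≡ (z * (o * h)) + (o * y) * g
    mixed′ = solve-∀
    s∣z : s ∣ z
    s∣z = coprime-divisor (Coprimality.sym r-s-coprime) (*-cancelʳ-∣ M (subst₂ _∣_ (sym s*M)
      (trans (cong (_* z) (sym r*M)) (lemma r M z))
      (order-divides (isOrder h) (∣m+n∣m⇒∣n (subst (n ∣_) (mixed (ord g) y (toℕ g) z (toℕ h)) (∣n⇒∣m*n (ord g) zs))
        (∣n⇒∣m*n y (order-zero (isOrder g)))))))
      where
      lemma : ∀ r M z → r * M * z ≡ r * z * M
      lemma = solve-∀
    r∣y : r ∣ y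
    r∣y = coprime-divisor r-s-coprime (*-cancelʳ-∣ M (subst₂ _∣_ (sym r*M)
      (trans (cong (_* y) (sym s*M)) (lemma s M y))
      (order-divides (isOrder g) (∣m+n∣m⇒∣n (subst (n ∣_) (mixed′ (ord h) y (toℕ g) z (toℕ h)) (∣n⇒∣m*n (ord h) zs))
        (∣n⇒∣m*n z (order-zero (isOrder h)))))))
      where
      lemma : ∀ r M z → r * M * z ≡ r * z * M
      lemma = solve-∀
    go : ∀ {y z} → r ∣ y → s ∣ z → n ∣ y * toℕ g + z * toℕ h → ∃[ u ] ∃[ v ] (y ≡ u * r × z ≡ v * s × M ∣ u + i * v)
    go (divides u refl) (divides v refl) zs = u , v , refl , refl , *-cancelʳ-∣ r {{>-nonZero r-positive}} (subst₂ _∣_ (trans (sym r*M) (*-comm r M)) refl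
      (order-divides (isOrder g) (∣-resp-≈ (combine u v) zs)))

  pairData-atom : h ≢ g → ∀ {u v} → 0 < u → M ∣ v + i * u →
    (∀ {u′ v′} → u′ ≤ u → v′ ≤ v → M ∣ v′ + i * u′ → (u′ ≡ 0 × v′ ≡ 0) ⊎ (u′ ≡ u × v′ ≡ v)) →
    MinimalZeroSum ((u * s) ⊛ δ h · (v * r) ⊛ δ g)
  pairData-atom h≢g {u} {v} 0<u dvd min = pair-atom h≢g (*-mono-< 0<u s-positive)
    (subst (n ∣_) (+-comm _ ((u * s) * toℕ h)) (pair-zeroSum dvd)) minimal
    where
    instance
      _ = >-nonZero s-positive
      _ = >-nonZero r-positive
    minimal : ∀ y z → y ≤ u * s → z ≤ v * r → n ∣ y * toℕ h + z * toℕ g →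
              (y ≡ 0 × z ≡ 0) ⊎ (y ≡ u * s × z ≡ v * r)
    minimal y z y≤ z≤ zs =
      go (pair-zeroSum⁻¹ {y = z} {z = y} (subst (n ∣_) (+-comm (y * toℕ h) (z * toℕ g)) zs)) y≤ z≤
      where
      scale : ∀ {u′ v′} → (u′ ≡ 0 × v′ ≡ 0) ⊎ (u′ ≡ u × v′ ≡ v) →
              (u′ * s ≡ 0 × v′ * r ≡ 0) ⊎ (u′ * s ≡ u * s × v′ * r ≡ v * r)
      scale (inj₁ (refl , refl)) = inj₁ (refl , refl)
      scale (inj₂ (refl , refl)) = inj₂ (refl , refl)
      go : ∀ {y z} → ∃[ v′ ] ∃[ u′ ] (z ≡ v′ * r × y ≡ u′ * s × M ∣ v′ + i * u′) → y ≤ u * s → z ≤ v * r →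
           (y ≡ 0 × z ≡ 0) ⊎ (y ≡ u * s × z ≡ v * r)
      go (v′ , u′ , refl , refl , dvd′) y≤ z≤ =
        scale (min (*-cancelʳ-≤ u′ u s y≤) (*-cancelʳ-≤ v′ v r z≤) dvd′)

opaque
  pairData : ∀ {n} (g h : Fin n) → PairData g h
  pairData {n} g h = record
    { M = M ; T = r * dv g ; r = r ; s = s ; i = i
    ; r*M = r*M ; s*M = s*M ; r*dv = refl ; s*dv = sym T≡T′
    ; T*M = trans (lemma r (dv g) M) (trans (cong (_* dv g) r*M) (ord*dv g))
    ; r-s-coprime = r-s-coprime
    ; 0<i = proj₁ (proj₂ residue) ; i≤M = proj₁ (proj₂ (proj₂ residue))
    ; link = link }
    where
    lemma : ∀ a b c → a * b * c ≡ a * c * b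
    lemma = solve-∀
    M r s : ℕ
    M = gcd (ord g) (ord h)
    r = quotient (gcd[m,n]∣m (ord g) (ord h))
    s = quotient (gcd[m,n]∣n (ord g) (ord h))
    r*M : r * M ≡ ord g
    r*M = sym (_∣_.equality (gcd[m,n]∣m (ord g) (ord h)))
    s*M : s * M ≡ ord h
    s*M = sym (_∣_.equality (gcd[m,n]∣n (ord g) (ord h)))
    0<M : 0 < M
    0<M = n≢0⇒n>0 (gcd[m,n]≢0 (ord g) (ord h) (inj₁ (n>0⇒n≢0 (ord-positive g))))
    instance
      M-nonZero : NonZero M
      M-nonZero = >-nonZero 0<M
    r-s-coprime : Coprime r s
    r-s-coprime {e} (e∣r , e∣s) = ∣1⇒≡1 (*-cancelʳ-∣ M (subst (e * M ∣_) (sym (*-identityˡ M))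
      (gcd-greatest (subst (e * M ∣_) r*M (*-monoˡ-∣ M e∣r)) (subst (e * M ∣_) s*M (*-monoˡ-∣ M e∣s)))))
    T≡T′ : r * dv g ≡ s * dv h
    T≡T′ = *-cancelʳ-≡ _ _ M (begin
      r * dv g * M ≡⟨ lemma r (dv g) M ⟩
      r * M * dv g ≡⟨ cong (_* dv g) r*M ⟩
      ord g * dv g ≡⟨ trans (ord*dv g) (sym (ord*dv h)) ⟩
      ord h * dv h ≡⟨ cong (_* dv h) s*M ⟨
      s * M * dv h ≡⟨ lemma s (dv h) M ⟨
      s * dv h * M ∎)
      where open ≡-Reasoning
    -- The cofactor of g is a unit modulo M, so cofactor h ≡ i · cofactor g can be solved for i;
    -- scaling by r · dv g = s · dv h turns this into `link`.
    M-coprime : Coprime M (cofactor g)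
    M-coprime (e∣M , e∣c) = ord-coprime g (∣-trans e∣M (gcd[m,n]∣m (ord g) (ord h)) , e∣c)
    inverse : ∃[ t ] t * cofactor g ≈ 1 mod M
    inverse = inverse-mod M-coprime
    t : ℕ
    t = proj₁ inverse
    residue : ∃[ i ] (0 < i × i ≤ M × i ≈ cofactor h * t mod M)
    residue = positive-residue M 0<M (cofactor h * t)
    i : ℕ
    i = proj₁ residue
    cofactors : cofactor h ≈ i * cofactor g mod M
    cofactors = ≈-sym (≈-trans (≈-*ʳ (cofactor g) (proj₂ (proj₂ (proj₂ residue))))
      (subst₂ (λ a b → a ≈ b mod M) (sym (*-assoc (cofactor h) t (cofactor g))) (*-identityʳ (cofactor h))
        (≈-*ˡ (cofactor h) (proj₂ inverse))))
    link : s * toℕ h ≈ i * (r * toℕ g) mod n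
    link = subst₂ (λ a b → a ≈ b mod n) left right
      (subst (λ m → r * dv g * cofactor h ≈ r * dv g * (i * cofactor g) mod m)
        (trans (lemma r (dv g) M) (trans (cong (_* dv g) r*M) (ord*dv g)))
        (≈-scale (r * dv g) cofactors))
      where
      shuffle : ∀ s d c → s * d * c ≡ s * (c * d)
      shuffle = solve-∀
      shuffle′ : ∀ r d i c → r * d * (i * c) ≡ i * (r * (c * d))
      shuffle′ = solve-∀
      left : r * dv g * cofactor h ≡ s * toℕ h
      left = trans (cong (_* cofactor h) T≡T′) (trans (shuffle s (dv h) (cofactor h)) (cong (s *_) (cofactor*dv h)))
      right : r * dv g * (i * cofactor g) ≡ i * (r * toℕ g)
      right = trans (shuffle′ r (dv g) i (cofactor g)) (cong (λ x → i * (r * x)) (cofactor*dv g))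

-- Arithmetic of two elements

-- Minimality of a zero-sum sequence over {g , h} counted in blocks: u blocks of s copies of h and v
-- blocks of r copies of g.
Irreducible : (M i u v : ℕ) → Set
Irreducible M i u v = ∀ {u′ v′} → u′ ≤ u → v′ ≤ v → M ∣ v′ + i * u′ → (u′ ≡ 0 × v′ ≡ 0) ⊎ (u′ ≡ u × v′ ≡ v)

Incompatible : (k M i : ℕ) → Set
Incompatible k M i = ∃[ Q ] ∃[ R ] ∃[ j ]
  (0 < Q × 0 < R × 0 < j × i ≡ 1 + R * (j * k) × M ≡ Q * (1 + R * (j * k)) + R)

-- The atom (u , v) = (M , 0) gives i ≡ 1 mod k.  One division step M = Q i + R and the atom with
-- u = Q ⌈i/R⌉ + 1 give ⌈i/R⌉ ≡ 1 mod k; since R < k this forces i = 1 + R j k.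
two-generator-arithmetic : ∀ {k M i} → 10 ≤ k → 0 < i → i ≤ M → M ≤ 10 * k →
  (∀ {v} → M ∣ i * v → M ∣ v) →
  (∀ {u v} c → 0 < u → v + i * u ≡ c * M → Irreducible M i u v → 1 ≈ c mod k) →
  i ≡ 1 ⊎ Incompatible k M i
two-generator-arithmetic {k} {M} {suc zero}         _    _   _   _     _      _    = inj₁ refl
two-generator-arithmetic {k} {M} {i@(suc i₀@(suc _))} 10≤k 0<i i≤M M≤10k cancel cong-k =
  inj₂ (Q , R , j , 0<Q , 0<R , 0<j , i≡ , trans M≡ (trans (+-comm R (Q * i)) (cong (λ t → Q * t + R) i≡)))
  where
  Q R w ρ v u : ℕ
  Q = M / i
  R = M % i
  0<M : 0 < M
  0<M = ≤-trans 0<i i≤M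
  M≡ : M ≡ R + Q * i
  M≡ = m≡m%n+[m/n]*n M i
  0<Q : 0 < Q
  0<Q = m≥n⇒m/n>0 i≤M
  -- If R = 0, then M = Q i divides i Q, so `cancel` gives M ∣ Q, although Q < Q i because i ≥ 2.
  0<R : 0 < R
  0<R = n≢0⇒n>0 λ R≡0 → <⇒≱ (m<m*n Q i {{>-nonZero 0<Q}} (s≤s (s≤s z≤n)))
    (subst (_≤ Q) (trans M≡ (cong (_+ Q * i) R≡0))
      (∣⇒≤ {{>-nonZero 0<Q}} (cancel (∣-reflexive (trans M≡ (trans (cong (_+ Q * i) R≡0) (*-comm Q i)))))))
  instance _ = >-nonZero 0<R
  -- Dividing i - 1 instead of i makes `suc w` equal to ⌈i / R⌉; v = R ⌈i / R⌉ - i is the amount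
  -- that makes v + i u an exact multiple of M.
  w = i₀ / R
  ρ = i₀ % R
  i₀≡ : i₀ ≡ ρ + w * R
  i₀≡ = m≡m%n+[m/n]*n i₀ R
  ρ<R : ρ < R
  ρ<R = m%n<n i₀ R
  v = R ∸ suc ρ
  v+ρ : v + suc ρ ≡ R
  v+ρ = m∸n+n≡m ρ<R
  v<R : v < R
  v<R = subst (v <_) v+ρ (m<m+n v z<s)
  u = Q * suc w + 1
  wR≤i₀ : w * R ≤ i₀
  wR≤i₀ = subst (w * R ≤_) (sym i₀≡) (m≤n+m (w * R) ρ)
  i₀<M : i₀ < M
  i₀<M = i≤M
  balance : v + i * u ≡ suc w * M
  balance = begin
    v + i * (Q * suc w + 1)              ≡⟨ lemma₁ v i Q w ⟩
    v + i + i * Q * suc w                ≡⟨ cong (λ t → v + suc t + i * Q * suc w) i₀≡ ⟩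
    v + suc (ρ + w * R) + i * Q * suc w  ≡⟨ lemma₂ v ρ (w * R) (i * Q * suc w) ⟩
    v + suc ρ + w * R + i * Q * suc w    ≡⟨ cong (λ t → t + w * R + i * Q * suc w) v+ρ ⟩
    R + w * R + i * Q * suc w            ≡⟨ lemma₃ R w i Q ⟩
    suc w * (R + Q * i)                  ≡⟨ cong (suc w *_) M≡ ⟨
    suc w * M                            ∎
    where
    open ≡-Reasoning
    lemma₁ : ∀ v i Q w → v + i * (Q * (1 + w) + 1) ≡ v + i + i * Q * (1 + w)
    lemma₁ = solve-∀
    lemma₂ : ∀ v ρ x y → v + (1 + (ρ + x)) + y ≡ v + (1 + ρ) + x + y
    lemma₂ = solve-∀
    lemma₃ : ∀ R w i Q → R + w * R + i * Q * (1 + w) ≡ (1 + w) * (R + Q * i)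
    lemma₃ = solve-∀
  irreducible : Irreducible M i u v
  irreducible {u′} {v′} u′≤u v′≤v (divides c eq) = by-norm c eq
    where
    maximal : v + i * u ≤ v′ + i * u′ → u′ ≡ u × v′ ≡ v
    maximal le = u′≡u , ≤-antisym v′≤v (+-cancelʳ-≤ (i * u) v v′ (subst (λ t → v + i * u ≤ v′ + i * t) u′≡u le))
      where
      u′≡u : u′ ≡ u
      u′≡u with m≤n⇒m<n∨m≡n u′≤u
      ... | inj₁ u′<u = contradiction le (<⇒≱ (+-mono-≤-< v′≤v (*-monoʳ-< i u′<u)))
      ... | inj₂ eq   = eq
    -- A solution of norm c with 1 ≤ c ≤ w would make i divide c R - v′, which lies strictly between
    -- 0 and i. A norm above w is at least that of (u , v), which leaves only (u , v) itself.
    by-norm : ∀ c → v′ + i * u′ ≡ c * M → (u′ ≡ 0 × v′ ≡ 0) ⊎ (u′ ≡ u × v′ ≡ v)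
    by-norm zero eq with m*n≡0⇒m≡0∨n≡0 i {u′} (m+n≡0⇒n≡0 v′ eq)
    ... | inj₂ u′≡0 = inj₁ (u′≡0 , m+n≡0⇒m≡0 v′ eq)
    by-norm c@(suc c₀) eq with c ≤? w
    ... | no c≰w  = inj₂ (maximal (subst₂ _≤_ (sym balance) (sym eq) (*-monoˡ-≤ M (≰⇒> c≰w))))
    ... | yes c≤w = contradiction (∣∧<⇒≡0 i∣x x<i) (n>0⇒n≢0 (m<n⇒0<n∸m v′<cR))
      where
      v′<cR : v′ < c * R
      v′<cR = <-≤-trans (≤-<-trans v′≤v v<R) (m≤m+n R (c₀ * R))
      x<i : c * R ∸ v′ < i
      x<i = s≤s (≤-trans (m∸n≤m (c * R) v′) (≤-trans (*-monoˡ-≤ R c≤w) wR≤i₀))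
      regroup : ∀ c R Q i → c * (R + Q * i) ≡ c * R + c * Q * i
      regroup = solve-∀
      i∣x : i ∣ c * R ∸ v′
      i∣x = ∣m+n∣m⇒∣n (subst (i ∣_) (+-cancelˡ-≡ v′ _ _ (begin
          v′ + i * u′                        ≡⟨ trans eq (cong (c *_) M≡) ⟩
          c * (R + Q * i)                    ≡⟨ regroup c R Q i ⟩
          c * R + c * Q * i                  ≡⟨ cong (_+ c * Q * i) (m+[n∸m]≡n (<⇒≤ v′<cR)) ⟨
          v′ + (c * R ∸ v′) + c * Q * i      ≡⟨ +-assoc v′ _ _ ⟩
          v′ + ((c * R ∸ v′) + c * Q * i)    ≡⟨ cong (v′ +_) (+-comm (c * R ∸ v′) (c * Q * i)) ⟩
          v′ + (c * Q * i + (c * R ∸ v′))    ∎)) (m∣m*n u′))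
        (n∣m*n (c * Q))
        where open ≡-Reasoning
  k∣w : k ∣ w
  k∣w = ≈⇒∣diff (cong-k (suc w) (subst (0 <_) (+-comm 1 (Q * suc w)) z<s) balance irreducible)
  j : ℕ
  j = quotient k∣w
  w≡ : w ≡ j * k
  w≡ = _∣_.equality k∣w
  0<w : 0 < w
  0<w = m≥n⇒m/n>0 (≤-pred (m%n<n M i))
  0<j : 0 < j
  0<j = n≢0⇒n>0 λ j≡0 → n>0⇒n≢0 0<w (trans w≡ (cong (_* k) j≡0))
  0<k : 0 < k
  0<k = ≤-trans (s≤s z≤n) 10≤k
  k≤w : k ≤ w
  k≤w = ∣⇒≤ {{>-nonZero 0<w}} k∣w
  -- R k ≤ R w ≤ i₀ < M ≤ 10 k. This makes ρ < k below, and k divides ρ = i₀ - w R.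
  R<10 : R < 10
  R<10 = *-cancelˡ-< k R 10 (≤-<-trans (*-monoˡ-≤ R k≤w)
    (≤-<-trans wR≤i₀ (<-≤-trans i₀<M (subst (M ≤_) (*-comm 10 k) M≤10k))))
  k∣i₀ : k ∣ i₀
  k∣i₀ = ≈⇒∣diff (cong-k {M} {0} i 0<M refl trivial)
    where
    trivial : Irreducible M i M 0
    trivial {zero}   {v′} u′≤M v′≤0 dvd = inj₁ (refl , n≤0⇒n≡0 v′≤0)
    trivial {suc u′} {v′} u′≤M v′≤0 dvd = inj₂ (≤-antisym u′≤M (∣⇒≤ (cancel
      (subst (M ∣_) (cong (_+ i * suc u′) (n≤0⇒n≡0 v′≤0)) dvd))) , n≤0⇒n≡0 v′≤0)
  ρ≡0 : ρ ≡ 0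
  ρ≡0 = ∣∧<⇒≡0 (∣m+n∣m⇒∣n (subst (k ∣_) (trans i₀≡ (+-comm ρ (w * R))) k∣i₀) (∣m⇒∣m*n R k∣w))
    (<-≤-trans ρ<R (≤-trans (<⇒≤ R<10) 10≤k))
  i≡ : i ≡ 1 + R * (j * k)
  i≡ = cong suc (trans i₀≡ (trans (cong₂ _+_ ρ≡0 (cong (_* R) w≡)) (*-comm (j * k) R)))

-- Norms modulo k by exchange

pick : ∀ {n} → Fin n → ℕ → ℕ → Fin n → ℕ
pick h a b x with h ≟ x
... | yes _ = a
... | no _  = b

pick-same : ∀ {n} (h : Fin n) a b → pick h a b h ≡ a
pick-same h a b with h ≟ h
... | yes _  = refl
... | no h≢h = contradiction refl h≢h

pick-diff : ∀ {n} {h x : Fin n} a b → h ≢ x → pick h a b x ≡ b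
pick-diff {h = h} {x} a b h≢x with h ≟ x
... | yes h≡x = contradiction h≡x h≢x
... | no _    = refl

over-⊛δ : ∀ {n} {G0 : Subset n} {f} c → f ∈ G0 → Over G0 (c ⊛ δ f)
over-⊛δ {f = f} c f∈ x 0< with f ≟ x
... | yes refl = f∈
... | no f≢x   = contradiction (*-zeroʳ c) (n>0⇒n≢0 0<)

over-· : ∀ {n} {G0 : Subset n} {S T} → Over G0 S → Over G0 T → Over G0 (S · T)
over-· {S = S} overS overT x 0< = go (S x) refl
  where
  go : ∀ a → S x ≡ a → _
  go (suc a) eq = overS x (subst (0 <_) (sym eq) z<s)
  go zero    eq = overT x (subst (λ a → 0 < a + _) eq 0<)

inB-⊛δ : ∀ {n} {G0 : Subset n} {f o} → f ∈ G0 → IsOrder f o → InB G0 (o ⊛ δ f)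
inB-⊛δ {n} {G0} {f} {o} f∈ ordF = over-⊛δ o f∈ , ∣wt⇒zeroSum (o ⊛ δ f) (subst (n ∣_) (sym (wt-⊛δ toℕ o f)) (order-zero ordF))

atom-inB : ∀ {n} {G0 : Subset n} {U} → MinimalZeroSum U → Over G0 U → InB G0 U
atom-inB (_ , zs , _) over = over , zs

exchange-≈ : ∀ {n} {G0 : Subset n} {k} → IsMinΔ G0 k →
  ∀ {U f o} → MinimalZeroSum U → Over G0 U → f ∈ G0 → IsOrder f o →
  (c κ : ℕ) (μ r s : Fin n → ℕ) → (∀ x → s x ≤ o) →
  (∀ x → 0 < μ x → MinimalZeroSum (r x ⊛ δ x · (o ∸ s x) ⊛ δ f)) →
  (∀ x → c * U x ≡ μ x * r x) → wt s μ ≡ κ * o → c ≈ κ mod k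
exchange-≈ isMin {U} {f} {o} atom over f∈ ordF c κ μ r s s≤o atoms eq total =
  ≈-cancelʳ-+ (∑ μ) (minΔ⇒lengths-≈ isMin
    (InB-· (InB-⊛ c (atom-inB {U = U} atom over)) (InB-⊛ (∑ μ) (inB-⊛δ f∈ ordF)))
    (proj₁ lengths) (proj₂ lengths))
  where
  lengths = exchange atom (order-atom ordF) c κ μ r s s≤o atoms eq total

-- An exchange runs over all x, the base f included; splitting f^o as f · f^(o - 1) gives f the same
-- form as the other elements.
self-atom : ∀ {n} {f : Fin n} {o} → IsOrder f o → MinimalZeroSum (1 ⊛ δ f · (o ∸ 1) ⊛ δ f)
self-atom {f = f} {o} ordF = atom-cong
  (λ x → trans (cong (_* δ f x) (sym (m+[n∸m]≡n (order-positive ordF)))) (*-distribʳ-+ (δ f x) 1 (o ∸ 1)))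
  (order-atom ordF)

self-pair : ∀ {n} {g : Fin n} (p : PairData g g) → let open PairData p in r ≡ 1 × s ≡ 1 × i ≡ 1
self-pair {n} {g} p = r≡1 , s≡1 , sym (≈∧range⇒≡ z<s (M-positive p) 0<i i≤M (subst (λ m → 1 ≈ i mod m) ord≡M
    (order-cancel (isOrder g) (subst₂ (λ a b → a ≈ b mod n) (cong (_* toℕ g) s≡1)
      (cong (i *_) (trans (cong (_* toℕ g) r≡1) (*-identityˡ _))) link))))
  where
  open PairData p
  r≡s : r ≡ s
  r≡s = *-cancelʳ-≡ r s M {{>-nonZero (M-positive p)}} (trans r*M (sym s*M))
  r≡1 : r ≡ 1
  r≡1 = r-s-coprime (∣-refl , ∣-reflexive r≡s)
  s≡1 : s ≡ 1
  s≡1 = trans (sym r≡s) r≡1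
  ord≡M : ord g ≡ M
  ord≡M = trans (sym r*M) (trans (cong (_* M) r≡1) (*-identityˡ M))

linking-irreducible : ∀ {M i} → 0 < i → i ≤ M → Irreducible M i 1 (M ∸ i)
linking-irreducible {M} {i} 0<i i≤M {zero} {v′} _ v′≤ dvd =
  inj₁ (refl , ∣∧<⇒≡0 (subst (M ∣_) (trans (cong (v′ +_) (*-zeroʳ i)) (+-identityʳ v′)) dvd)
                        (≤-<-trans v′≤ (∸-monoʳ-< 0<i i≤M)))
linking-irreducible {M} {i} 0<i i≤M {suc zero} {v′} _ v′≤ dvd =
  inj₂ (refl , ≤-antisym v′≤ (m≤n+o⇒m∸n≤o M i (subst (M ≤_) (+-comm v′ i) (∣⇒≤ {{>-nonZero (≤-trans 0<i (m≤n+m i v′))}}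
    (subst (λ t → M ∣ v′ + t) (*-identityʳ i) dvd)))))
linking-irreducible _ _ {suc (suc _)} (s≤s ())

linking-atom : ∀ {n} {g h : Fin n} (p : PairData g h) → let open PairData p in
               MinimalZeroSum (s ⊛ δ h · (ord g ∸ i * r) ⊛ δ g)
linking-atom {n} {g} {h} p with h ≟ g
... | no h≢g = atom-cong (λ x → cong₂ _+_ (cong (_* δ h x) (*-identityˡ s)) (cong (_* δ g x)
      (trans (*-distribʳ-∸ r M i) (cong (_∸ i * r) (trans (*-comm M r) r*M)))))
    (pairData-atom p h≢g {1} {M ∸ i} z<s
      (∣-reflexive (trans (sym (m∸n+n≡m i≤M)) (cong (M ∸ i +_) (sym (*-identityʳ i))))) (linking-irreducible 0<i i≤M))
  where open PairData p
... | yes refl with self-pair p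
...   | r≡1 , s≡1 , i≡1 = atom-cong (λ x → cong₂ _+_ (cong (_* δ g x) (sym s≡1))
          (cong (λ t → (ord g ∸ t) * δ g x) (sym (cong₂ _*_ i≡1 r≡1)))) (self-atom (isOrder g))

-- The exchange in base g with u linking atoms, each absorbing one block of h, and v r atoms g ·
-- g^(ord g - 1); c is the number of copies of g^(ord g) set free.
pair-norm-≈ : ∀ {n} {G0 : Subset n} {k} → IsMinΔ G0 k →
  ∀ {g h} (p : PairData g h) → g ∈ G0 → h ∈ G0 → h ≢ g → let open PairData p in
  ∀ {u v} c → 0 < u → v + i * u ≡ c * M → Irreducible M i u v → 1 ≈ c mod k
pair-norm-≈ {n} {G0} isMin {g} {h} p g∈ h∈ h≢g {u} {v} c 0<u balance irreducible =
  exchange-≈ isMin {U} (pairData-atom p h≢g 0<u (divides c balance) irreducible)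
    (over-· (over-⊛δ (u * s) h∈) (over-⊛δ (v * r) g∈)) g∈ (isOrder g)
    1 c μ (pick h s 1) (pick h (i * r) 1) bounded atoms counts total
  where
  open PairData p
  U μ : Seq n
  U = (u * s) ⊛ δ h · (v * r) ⊛ δ g
  μ = u ⊛ δ h · (v * r) ⊛ δ g
  ir≤ : i * r ≤ ord g
  ir≤ = ≤-trans (*-monoˡ-≤ r i≤M) (≤-reflexive (trans (*-comm M r) r*M))
  bounded : ∀ x → pick h (i * r) 1 x ≤ ord g
  bounded x with h ≟ x
  ... | yes _ = ir≤
  ... | no _  = ord-positive g
  atoms : ∀ x → 0 < μ x → MinimalZeroSum (pick h s 1 x ⊛ δ x · (ord g ∸ pick h (i * r) 1 x) ⊛ δ g)
  atoms x 0<μ with h ≟ x | g ≟ x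
  ... | yes refl | _        = linking-atom p
  ... | no _     | yes refl = self-atom (isOrder g)
  ... | no _     | no _     = contradiction (cong₂ _+_ (*-zeroʳ u) (*-zeroʳ (v * r))) (n>0⇒n≢0 0<μ)
  counts : ∀ x → 1 * U x ≡ μ x * pick h s 1 x
  counts x with h ≟ x | g ≟ x
  ... | yes refl | yes refl = contradiction refl h≢g
  ... | yes _    | no _     = lemma u s (v * r)
    where
    lemma : ∀ u s y → 1 * (u * s * 1 + y * 0) ≡ (u * 1 + y * 0) * s
    lemma = solve-∀
  ... | no _     | _        = lemma (u * s) u (v * r * _)
    where
    lemma : ∀ a b y → 1 * (a * 0 + y) ≡ (b * 0 + y) * 1
    lemma = solve-∀
  total : wt (pick h (i * r) 1) μ ≡ c * ord g
  total = begin
    wt (pick h (i * r) 1) μ                                        ≡⟨ wt-pair _ u h (v * r) g ⟩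
    u * pick h (i * r) 1 h + v * r * pick h (i * r) 1 g            ≡⟨ cong₂ (λ a b → u * a + v * r * b) (pick-same h _ _) (pick-diff _ _ h≢g) ⟩
    u * (i * r) + v * r * 1                                        ≡⟨ lemma u i r v ⟩
    (v + i * u) * r                                                ≡⟨ cong (_* r) balance ⟩
    c * M * r                                                      ≡⟨ trans (*-assoc c M r) (cong (c *_) (trans (*-comm M r) r*M)) ⟩
    c * ord g                                                      ∎
    where
    open ≡-Reasoning
    lemma : ∀ u i r v → u * (i * r) + v * r * 1 ≡ (v + i * u) * r
    lemma = solve-∀

pair-structure : ∀ {n} {G0 : Subset n} {k} → IsMinΔ G0 k → 10 ≤ k → n ≤ 10 * k →
  ∀ {g h} (p : PairData g h) → g ∈ G0 → h ∈ G0 → let open PairData p in i ≡ 1 ⊎ Incompatible k M i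
pair-structure {n} {G0} {k} isMin 10≤k n≤10k {g} {h} p g∈ h∈ with h ≟ g
... | no h≢g = two-generator-arithmetic 10≤k 0<i i≤M (≤-trans M≤n n≤10k) cancel
    (λ c → pair-norm-≈ isMin p g∈ h∈ h≢g c)
  where
  open PairData p
  M≤n : M ≤ n
  M≤n = ∣⇒≤ {{>-nonZero (Fin⇒positive g)}} (divides T (sym T*M))
  -- M ∣ i v means that v s copies of h have sum zero, so ord h = s M divides v s.
  cancel : ∀ {v} → M ∣ i * v → M ∣ v
  cancel {v} dvd = *-cancelʳ-∣ s {{>-nonZero (s-positive p)}} (subst (_∣ v * s) (trans (sym s*M) (*-comm s M))
    (order-divides (isOrder h) (pair-zeroSum p {0} {v} dvd)))
... | yes refl = inj₁ (proj₂ (proj₂ (self-pair p)))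

base-atom : ∀ {n} {x f : Fin n} {o W} → IsOrder f o → 0 < W → W ≤ o → toℕ x ≈ W * toℕ f mod n →
            MinimalZeroSum (1 ⊛ δ x · (o ∸ W) ⊛ δ f)
base-atom {n} {x} {f} {o} {W} ordF 0<W W≤o x≈Wf with x ≟ f
... | yes refl = subst (λ w → MinimalZeroSum (1 ⊛ δ x · (o ∸ w) ⊛ δ x))
    (≈∧range⇒≡ z<s (order-positive ordF) 0<W W≤o
      (order-cancel ordF (subst (λ t → t ≈ W * toℕ x mod n) (sym (*-identityˡ (toℕ x))) x≈Wf)))
    (self-atom ordF)
... | no x≢f = pair-atom x≢f z<s (∣-resp-≈ (≈-sym (value 1 (o ∸ W)))
      (order-∣ ordF (∣-reflexive (sym (trans (cong (_+ (o ∸ W)) (*-identityˡ W)) (m+[n∸m]≡n W≤o)))))) minimal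
  where
  value : ∀ y z → y * toℕ x + z * toℕ f ≈ (y * W + z) * toℕ f mod n
  value y z = ≈-trans (≈-+ (≈-*ˡ y x≈Wf) ≈-refl) (≈-reflexive (lemma y W (toℕ f) z))
    where
    lemma : ∀ y W f z → y * (W * f) + z * f ≡ (y * W + z) * f
    lemma = solve-∀
  minimal : ∀ y z → y ≤ 1 → z ≤ o ∸ W → n ∣ y * toℕ x + z * toℕ f → (y ≡ 0 × z ≡ 0) ⊎ (y ≡ 1 × z ≡ o ∸ W)
  minimal zero z _ z≤ zs = inj₁ (refl , ∣∧<⇒≡0 (order-divides ordF zs) (≤-<-trans z≤ (∸-monoʳ-< 0<W W≤o)))
  minimal (suc zero) z _ z≤ zs = inj₂ (refl , ≤-antisym z≤ (m≤n+o⇒m∸n≤o o W (subst (λ w → o ≤ w + z) (*-identityˡ W)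
    (∣⇒≤ {{>-nonZero (≤-trans 0<W (≤-trans (≤-reflexive (sym (*-identityˡ W))) (m≤m+n (1 * W) z)))}}
      (order-divides ordF (∣-resp-≈ (value 1 z) zs))))))
  minimal (suc (suc _)) _ (s≤s ())

support-≈ : ∀ {n m} {U F G : Fin n → ℕ} → (∀ x → 0 < U x → F x ≈ G x mod m) → wt F U ≈ wt G U mod m
support-≈ {m = m} {U} {F} {G} eq = ∑-≈ (λ x → go x (U x) refl)
  where
  go : ∀ x u → U x ≡ u → u * F x ≈ u * G x mod m
  go x zero    _  = ≈-refl
  go x (suc u) Ux = ≈-*ˡ (suc u) (eq x (subst (0 <_) (sym Ux) z<s))

wt-*ʳ : ∀ {n} (W : Fin n → ℕ) c (S : Seq n) → wt (λ x → W x * c) S ≡ wt W S * c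
wt-*ʳ W c S = trans (∑-cong (λ x → sym (*-assoc (S x) (W x) c))) (∑-*ʳ _ c)

base-norm : ∀ {n} {f : Fin n} {o} {W U : Fin n → ℕ} → IsOrder f o →
            (∀ x → 0 < U x → toℕ x ≈ W x * toℕ f mod n) → ZeroSum U → o ∣ wt W U
base-norm {n} {f} {o} {W} {U} ordF eq zs = order-divides ordF
  (subst (n ∣_) (wt-*ʳ W (toℕ f) U) (∣-resp-≈ (support-≈ {U = U} eq) (zeroSum⇒∣wt U zs)))

base-lengths : ∀ {n} {f : Fin n} {o} {W U : Fin n → ℕ} → IsOrder f o → MinimalZeroSum U →
  (∀ x → 0 < W x × W x ≤ o) → (∀ x → 0 < U x → toℕ x ≈ W x * toℕ f mod n) → ∀ κ → wt W U ≡ κ * o →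
  let B = 1 ⊛ U · ∑ U ⊛ o ⊛ δ f in InL B (1 + ∑ U) × InL B (κ + ∑ U)
base-lengths {W = W} {U} ordF atom range eq κ total =
  exchange atom (order-atom ordF) 1 κ U (λ _ → 1) W (λ x → proj₂ (range x))
    (λ x 0<Ux → base-atom ordF (proj₁ (range x)) (proj₂ (range x)) (eq x 0<Ux))
    (λ x → *-comm 1 (U x)) total

base-norm-≈ : ∀ {n} {G0 : Subset n} {k} → IsMinΔ G0 k → ∀ {f o} {W U : Fin n → ℕ} → f ∈ G0 → IsOrder f o →
  MinimalZeroSum U → Over G0 U → (∀ x → 0 < W x × W x ≤ o) →
  (∀ x → 0 < U x → toℕ x ≈ W x * toℕ f mod n) → ∀ κ → wt W U ≡ κ * o → 1 ≈ κ mod k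
base-norm-≈ isMin {U = U} f∈ ordF atom over range eq κ total =
  ≈-cancelʳ-+ (∑ U) (minΔ⇒lengths-≈ isMin
    (InB-· (InB-⊛ 1 (atom-inB {U = U} atom over)) (InB-⊛ (∑ U) (inB-⊛δ f∈ ordF)))
    (proj₁ lengths) (proj₂ lengths))
  where
  lengths = base-lengths ordF atom range eq κ total

-- Upper bounds for norms

-- Otherwise x^(ord x) would be a proper zero-sum part of U.
atom-multiplicity : ∀ {n} {U : Seq n} → MinimalZeroSum U → ∀ x → U x ≤ ord x
atom-multiplicity {n} {U} (_ , _ , minimal) x = ≮⇒≥ λ ord<U →
  <⇒≢ ord<U (trans (sym (⊛δ-same (ord x) x)) (minimal (ord x ⊛ δ x) (below ord<U)
    (proj₁ (proj₂ (order-atom (isOrder x)))) (proj₁ (order-atom (isOrder x))) x))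
  where
  below : ord x < U x → (ord x ⊛ δ x) ≼ U
  below ord<U y with x ≟ y
  ... | yes refl = ≤-trans (≤-reflexive (*-identityʳ (ord x))) (<⇒≤ ord<U)
  ... | no _     = ≤-trans (≤-reflexive (*-zeroʳ (ord x))) z≤n

∑-const : ∀ K C → ∑ {K} (λ _ → C) ≡ K * C
∑-const zero    C = ∑-zero (λ _ → C) (λ ())
∑-const (suc K) C = trans (∑-suc (λ _ → C)) (cong (C +_) (∑-const K C))

∑-at-most-one : ∀ {n} (H : Fin n → ℕ) C → (∀ x y → 0 < H x → 0 < H y → x ≡ y) → (∀ x → H x ≤ C) → ∑ H ≤ C
∑-at-most-one H C unique bounded = go (∑ H) refl
  where
  go : ∀ t → ∑ H ≡ t → t ≤ C
  go zero    _  = z≤n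
  go (suc t) eq = ≤-trans (≤-reflexive (sym eq)) (≤-trans (∑-mono below) (≤-reflexive (∑-δ x₀ (λ _ → C))))
    where
    x₀ = proj₁ (∑-positive H (subst (0 <_) (sym eq) z<s))
    0<Hx₀ = proj₂ (∑-positive H (subst (0 <_) (sym eq) z<s))
    below : ∀ x → H x ≤ δ x₀ x * C
    below x with x₀ ≟ x
    ... | yes refl = ≤-trans (bounded x) (≤-reflexive (sym (*-identityˡ C)))
    ... | no x₀≢x  = ≮⇒≥ λ 0<Hx → x₀≢x (unique x₀ x 0<Hx₀ 0<Hx)

-- Double counting: summed key by key, at most one element contributes for each key.
∑-by-key : ∀ {n} (F key : Fin n → ℕ) C K → (∀ x → F x ≤ C) → (∀ x → key x < K) →
           (∀ x y → 0 < F x → 0 < F y → key x ≡ key y → x ≡ y) → ∑ F ≤ K * C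
∑-by-key {n} F key C K bounded key<K unique = begin
  ∑ F                              ≤⟨ ∑-mono (λ x → ≤-trans (≤-reflexive (diagonal x)) (term≤∑ (G x) (fromℕ< (key<K x)))) ⟩
  ∑ (λ x → ∑ (G x))                ≡⟨ ∑-swap G ⟩
  ∑ {K} (λ c → ∑ (λ x → G x c))    ≤⟨ ∑-mono (λ c → ∑-at-most-one (λ x → G x c) C (unique′ c) (bounded′ c)) ⟩
  ∑ {K} (λ _ → C)                  ≡⟨ ∑-const K C ⟩
  K * C                            ∎
  where
  open ≤-Reasoning
  G : Fin n → Fin K → ℕ
  G x c with key x ℕₚ.≟ toℕ c
  ... | yes _ = F x
  ... | no _  = 0
  diagonal : ∀ x → F x ≡ G x (fromℕ< (key<K x))
  diagonal x with key x ℕₚ.≟ toℕ (fromℕ< (key<K x))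
  ... | yes _ = refl
  ... | no ≢  = contradiction (sym (toℕ-fromℕ< (key<K x))) ≢
  bounded′ : ∀ c x → G x c ≤ C
  bounded′ c x with key x ℕₚ.≟ toℕ c
  ... | yes _ = bounded x
  ... | no _  = z≤n
  unique′ : ∀ c x y → 0 < G x c → 0 < G y c → x ≡ y
  unique′ c x y 0<x 0<y with key x ℕₚ.≟ toℕ c | key y ℕₚ.≟ toℕ c
  ... | yes p | yes q = unique x y 0<x 0<y (trans p (sym q))

-- Elements are told apart by their index if it is at most n / 20, and by their order (< 20) otherwise.
norm-bound : ∀ {n k} → n ≤ 10 * k → 42 ≤ k → (F : Fin n → ℕ) (p : Fin n) → (∀ x → F x ≤ n) →
  (∀ x y → 0 < F x → 0 < F y → x ≢ p → y ≢ p → dv x ≡ dv y → x ≡ y) → ∑ F ≤ k * n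
norm-bound {n} {k} n≤10k 42≤k F p bounded unique =
  ≤-trans (∑-by-key F key n (t + 21) bounded key<K key-unique) (*-monoˡ-≤ n t+21≤k)
  where
  t : ℕ
  t = n / 20
  -- 20 t ≤ n ≤ 10 k gives 2 t ≤ k, and 2 · 21 = 42 ≤ k; adding and halving yields the claim.
  t+21≤k : t + 21 ≤ k
  t+21≤k = *-cancelˡ-≤ 2 (≤-trans (≤-reflexive (*-distribˡ-+ 2 t 21)) (≤-trans (+-mono-≤ 2t≤k 42≤k)
    (≤-reflexive (cong (k +_) (sym (+-identityʳ k))))))
    where
    2t≤k : 2 * t ≤ k
    2t≤k = *-cancelˡ-≤ 10 (≤-trans (≤-reflexive (lemma t)) (≤-trans (m/n*n≤m n 20) n≤10k))
      where
      lemma : ∀ t → 10 * (2 * t) ≡ t * 20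
      lemma = solve-∀
  n<20dv : ∀ x → ¬ dv x ≤ t → ord x < 20
  n<20dv x dv≰t = *-cancelʳ-< (dv x) (ord x) 20 (≤-trans (s≤s (≤-reflexive (trans (ord*dv x) (m≡m%n+[m/n]*n n 20))))
    (≤-trans (+-monoˡ-≤ (t * 20) (m%n<n n 20)) (≤-trans (*-monoˡ-≤ 20 (≰⇒> dv≰t)) (≤-reflexive (*-comm (dv x) 20)))))
  indexKey key : Fin n → ℕ
  indexKey x with dv x ≤? t
  ... | yes _ = dv x
  ... | no _  = t + ord x
  -- Indices occupy the keys up to t and orders those from t + 1 to t + 19; p may share its index
  -- with another element, so it gets the separate key t + 20.
  key x with x ≟ p
  ... | yes _ = t + 20
  ... | no _  = indexKey x
  indexKey< : ∀ x → indexKey x < t + 20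
  indexKey< x with dv x ≤? t
  ... | yes dv≤t = ≤-<-trans dv≤t (m<m+n t z<s)
  ... | no dv≰t  = +-monoʳ-< t (n<20dv x dv≰t)
  key<K : ∀ x → key x < t + 21
  key<K x with x ≟ p
  ... | yes _ = ≤-reflexive (sym (+-suc t 20))
  ... | no _  = <-trans (indexKey< x) (≤-reflexive (sym (+-suc t 20)))
  indexKey-injective : ∀ x y → indexKey x ≡ indexKey y → dv x ≡ dv y
  indexKey-injective x y eq with dv x ≤? t | dv y ≤? t
  ... | yes _  | yes _  = eq
  ... | yes le | no _   = contradiction eq (<⇒≢ (≤-<-trans le (m<m+n t (ord-positive y))))
  ... | no _   | yes le = contradiction (sym eq) (<⇒≢ (≤-<-trans le (m<m+n t (ord-positive x))))
  ... | no _   | no _   = *-cancelˡ-≡ (dv x) (dv y) (ord x) {{>-nonZero (ord-positive x)}}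
        (trans (ord*dv x) (trans (sym (ord*dv y)) (cong (_* dv y) (sym (+-cancelˡ-≡ t _ _ eq)))))
  key-unique : ∀ x y → 0 < F x → 0 < F y → key x ≡ key y → x ≡ y
  key-unique x y 0<x 0<y eq with x ≟ p | y ≟ p
  ... | yes refl | yes refl = refl
  ... | yes _    | no _     = contradiction (sym eq) (<⇒≢ (indexKey< y))
  ... | no _     | yes _    = contradiction eq (<⇒≢ (indexKey< x))
  ... | no x≢p   | no y≢p   = unique x y 0<x 0<y x≢p y≢p (indexKey-injective x y eq)

norm≡1 : ∀ {k N} → 0 < N → N ≤ k → 1 ≈ N mod k → N ≡ 1
norm≡1 {k} {suc N} _ N<k e = cong suc (∣∧<⇒≡0 (≈⇒∣diff e) N<k)

-- Pairwise compatible sets are half-factorial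

gcdF : ∀ {n} → (Fin n → ℕ) → ℕ
gcdF {zero}  F = 0
gcdF {suc n} F = gcd (F zero) (gcdF (F ∘ suc))

gcdF-∣ : ∀ {n} (F : Fin n → ℕ) x → gcdF F ∣ F x
gcdF-∣ F zero    = gcd[m,n]∣m (F zero) _
gcdF-∣ F (suc x) = ∣-trans (gcd[m,n]∣n (F zero) _) (gcdF-∣ (F ∘ suc) x)

-- With the factor z this replaces a Bézout identity in many variables: it removes the factors c
-- both from n ∣ c · wt and from k ∣ c (N - 1).
gcdF-greatest : ∀ {n m} (F : Fin n → ℕ) z → (∀ x → m ∣ F x * z) → m ∣ gcdF F * z
gcdF-greatest {zero}      F z dvd = _ ∣0
gcdF-greatest {suc n} {m} F z dvd = subst (m ∣_) (sym (trans (*-comm (gcd (F zero) G) z) (c*gcd[m,n]≡gcd[cm,cn] z (F zero) G)))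
  (gcd-greatest (subst (m ∣_) (*-comm (F zero) z) (dvd zero))
                (subst (m ∣_) (*-comm G z) (gcdF-greatest (F ∘ suc) z (dvd ∘ suc))))
  where
  G = gcdF (F ∘ suc)

-- U x need not be a multiple of s x, the number of copies of x in a linking atom, hence the c
-- copies of U. For i = 1 a linking atom trades s copies of x for r copies of f, and s · dv x = r ·
-- dv f, so the norm can be read off from indices alone.
compatible-exchange : ∀ {n} {G0 : Subset n} {k} → IsMinΔ G0 k →
  ∀ {U f} → MinimalZeroSum U → Over G0 U → f ∈ G0 →
  (∀ {x} → x ∈ G0 → PairData.i (pairData f x) ≡ 1) →
  ∀ c → 0 < c → (∀ x → 0 < U x → PairData.s (pairData f x) ∣ c) →
  ∃[ κ ] (κ * n ≡ c * wt dv U × c ≈ κ mod k)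
compatible-exchange {n} {G0} {k} isMin {U} {f} atom over f∈ compat c 0<c s∣c =
  κ , κn≡ , exchange-≈ isMin atom over f∈ (isOrder f) c κ μ s ir
    (λ x → ≤-trans (*-monoˡ-≤ (r x) (P.i≤M x)) (≤-reflexive (trans (*-comm (P.M x) (r x)) (P.r*M x))))
    (λ x _ → linking-atom (pairData f x)) cU≡μs total
  where
  module P (x : Fin n) = PairData (pairData f x)
  s r ir μ : Fin n → ℕ
  s = P.s
  r = P.r
  ir x = P.i x * r x
  s∣cU : ∀ x → s x ∣ c * U x
  s∣cU x = go (U x) refl
    where
    go : ∀ u → U x ≡ u → s x ∣ c * u
    go zero    _  = subst (s x ∣_) (sym (*-zeroʳ c)) (s x ∣0)
    go (suc u) eq = ∣m⇒∣m*n (suc u) (s∣c x (subst (0 <_) (sym eq) z<s))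
  μ x = quotient (s∣cU x)
  cU≡μs : ∀ x → c * U x ≡ μ x * s x
  cU≡μs x = _∣_.equality (s∣cU x)
  lemma : ∀ μ s x → μ * s * x ≡ μ * (s * x)
  lemma = solve-∀
  values : wt (λ x → ir x * toℕ f) μ ≈ wt (λ x → toℕ x) (c ⊛ U) mod n
  values = ∑-≈ λ x → ≈-sym (subst₂ (λ a b → a ≈ b mod n)
    (trans (sym (*-assoc (μ x) (s x) (toℕ x))) (cong (_* toℕ x) (sym (cU≡μs x))))
    (cong (μ x *_) (sym (*-assoc (P.i x) (r x) (toℕ f))))
    (≈-*ˡ (μ x) (P.link x)))
  o∣ : ord f ∣ wt ir μ
  o∣ = order-divides (isOrder f) (subst (n ∣_) (wt-*ʳ ir (toℕ f) μ) (∣-resp-≈ (≈-sym values)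
    (subst (n ∣_) (sym (wt-⊛ toℕ c U)) (∣n⇒∣m*n c (zeroSum⇒∣wt U (proj₁ (proj₂ atom)))))))
  κ : ℕ
  κ = quotient o∣
  total : wt ir μ ≡ κ * ord f
  total = _∣_.equality o∣
  pointwise : ∀ x → μ x * (ir x * dv f) ≡ (c ⊛ U) x * dv x
  pointwise x = go (U x) refl
    where
    open ≡-Reasoning
    go : ∀ u → U x ≡ u → μ x * (ir x * dv f) ≡ (c ⊛ U) x * dv x
    go zero    eq = trans (cong (_* (ir x * dv f)) μ≡0) (sym (cong (_* dv x) (trans (cong (c *_) eq) (*-zeroʳ c))))
      where
      μ≡0 : μ x ≡ 0
      μ≡0 = *-cancelʳ-≡ (μ x) 0 (s x) {{>-nonZero (s-positive (pairData f x))}}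
        (trans (sym (cU≡μs x)) (trans (cong (c *_) eq) (*-zeroʳ c)))
    go (suc u) eq = begin
      μ x * (P.i x * r x * dv f) ≡⟨ cong (λ i → μ x * (i * r x * dv f)) (compat (over x (subst (0 <_) (sym eq) z<s))) ⟩
      μ x * (1 * r x * dv f)     ≡⟨ cong (λ t → μ x * (t * dv f)) (*-identityˡ (r x)) ⟩
      μ x * (r x * dv f)         ≡⟨ cong (μ x *_) (trans (P.r*dv x) (sym (P.s*dv x))) ⟩
      μ x * (s x * dv x)         ≡⟨ *-assoc (μ x) (s x) (dv x) ⟨
      μ x * s x * dv x           ≡⟨ cong (_* dv x) (cU≡μs x) ⟨
      c * U x * dv x             ∎
  κn≡ : κ * n ≡ c * wt dv U
  κn≡ = begin
    κ * n                     ≡⟨ cong (κ *_) (ord*dv f) ⟨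
    κ * (ord f * dv f)        ≡⟨ *-assoc κ (ord f) (dv f) ⟨
    κ * ord f * dv f          ≡⟨ cong (_* dv f) total ⟨
    wt ir μ * dv f            ≡⟨ wt-*ʳ ir (dv f) μ ⟨
    wt (λ x → ir x * dv f) μ  ≡⟨ ∑-cong pointwise ⟩
    wt dv (c ⊛ U)             ≡⟨ wt-⊛ dv c U ⟩
    c * wt dv U               ∎
    where open ≡-Reasoning

-- The norms for the different base elements f of the support differ by the factors c = dv f / γ, whose gcd is 1.
compatible-norm : ∀ {n} {G0 : Subset n} {k} → IsMinΔ G0 k →
  (∀ {g h} → g ∈ G0 → h ∈ G0 → PairData.i (pairData g h) ≡ 1) →
  ∀ {U} → MinimalZeroSum U → Over G0 U → ∃[ N ] (wt dv U ≡ N * n × 1 ≈ N mod k)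
compatible-norm {n} {G0} {k} isMin compat {U} atom over = N , wt≡ , go N refl
  where
  -- `1 ⊓ U x` is the indicator of the support, so elements outside it enter the gcd as 0.
  F : Fin n → ℕ
  F x = (1 ⊓ U x) * dv x
  γ : ℕ
  γ = gcdF F
  F-support : ∀ {x} → 0 < U x → F x ≡ dv x
  F-support {x} 0<Ux = trans (cong (_* dv x) (m≤n⇒m⊓n≡m 0<Ux)) (*-identityˡ (dv x))
  x₀ : ∃[ x ] 0 < U x
  x₀ = len-positive⇒nonempty U (proj₁ atom)
  γ∣dv : ∀ {x} → 0 < U x → γ ∣ dv x
  γ∣dv {x} 0<Ux = subst (γ ∣_) (F-support 0<Ux) (gcdF-∣ F x)
  0<γ : 0 < γ
  0<γ = n≢0⇒n>0 λ γ≡0 → n>0⇒n≢0 (dv-positive (proj₁ x₀)) (0∣⇒≡0 (subst (_∣ dv (proj₁ x₀)) γ≡0 (γ∣dv (proj₂ x₀))))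
  instance _ = >-nonZero 0<γ
  local : ∀ {f} (0<Uf : 0 < U f) → let c = quotient (γ∣dv 0<Uf) in ∃[ κ ] (κ * n ≡ c * wt dv U × c ≈ κ mod k)
  local {f} 0<Uf = compatible-exchange isMin atom over (over f 0<Uf) (compat (over f 0<Uf)) c
    (n≢0⇒n>0 λ c≡0 → n>0⇒n≢0 (dv-positive f) (trans c*γ (cong (_* γ) c≡0))) s∣c
    where
    c : ℕ
    c = quotient (γ∣dv 0<Uf)
    c*γ : dv f ≡ c * γ
    c*γ = _∣_.equality (γ∣dv 0<Uf)
    -- Cancelling γ in r · dv f = s · dv x gives s ∣ r c, and r is prime to s.
    s∣c : ∀ x → 0 < U x → PairData.s (pairData f x) ∣ c
    s∣c x 0<Ux = coprime-divisor (Coprimality.sym r-s-coprime) (divides e (*-cancelʳ-≡ _ _ γ (begin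
      r * c * γ    ≡⟨ *-assoc r c γ ⟩
      r * (c * γ)  ≡⟨ cong (r *_) c*γ ⟨
      r * dv f     ≡⟨ trans r*dv (sym s*dv) ⟩
      s * dv x     ≡⟨ cong (s *_) (_∣_.equality (γ∣dv 0<Ux)) ⟩
      s * (e * γ)  ≡⟨ lemma s e γ ⟩
      e * s * γ    ∎)))
      where
      open ≡-Reasoning
      open PairData (pairData f x)
      e = quotient (γ∣dv 0<Ux)
      lemma : ∀ s e γ → s * (e * γ) ≡ e * s * γ
      lemma = solve-∀
  F-∣ : ∀ {m} z → (∀ {f} (0<Uf : 0 < U f) → m ∣ quotient (γ∣dv 0<Uf) * z) → m ∣ z
  F-∣ {m} z dvd = *-cancelˡ-∣ γ (gcdF-greatest F z λ x → below x (U x) refl)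
    where
    lemma : ∀ γ c z → γ * (c * z) ≡ c * γ * z
    lemma = solve-∀
    below : ∀ x u → U x ≡ u → γ * m ∣ F x * z
    below x zero    eq = subst (λ u → γ * m ∣ (1 ⊓ u) * dv x * z) (sym eq) (_ ∣0)
    below x (suc u) eq = subst (γ * m ∣_)
      (trans (lemma γ (quotient (γ∣dv 0<Ux)) z) (cong (_* z) (trans (sym (_∣_.equality (γ∣dv 0<Ux))) (sym (F-support 0<Ux)))))
      (*-monoʳ-∣ γ (dvd 0<Ux))
      where
      0<Ux : 0 < U x
      0<Ux = subst (0 <_) (sym eq) z<s
  n∣wt : n ∣ wt dv U
  n∣wt = F-∣ (wt dv U) λ 0<Uf → divides (proj₁ (local 0<Uf)) (sym (proj₁ (proj₂ (local 0<Uf))))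
  N : ℕ
  N = quotient n∣wt
  wt≡ : wt dv U ≡ N * n
  wt≡ = _∣_.equality n∣wt
  0<wt : 0 < wt dv U
  0<wt = ≤-trans (*-mono-≤ (proj₂ x₀) (dv-positive (proj₁ x₀))) (term≤∑ (λ x → U x * dv x) (proj₁ x₀))
  go : ∀ N′ → N ≡ N′ → 1 ≈ N′ mod k
  go zero     eq = contradiction (trans wt≡ (cong (_* n) eq)) (n>0⇒n≢0 0<wt)
  go (suc N′) eq = ≈-sym (∣⇒≈ (F-∣ N′ λ {f} 0<Uf →
    let c = quotient (γ∣dv 0<Uf)
        κ , κn≡ , c≈κ = local 0<Uf
        κ≡ = *-cancelʳ-≡ κ (c * suc N′) n {{>-nonZero (Fin⇒positive f)}}
               (trans κn≡ (trans (cong (c *_) (trans wt≡ (cong (_* n) eq))) (sym (*-assoc c (suc N′) n))))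
    in ≈⇒∣diff (subst (λ t → c ≈ t mod k) (trans κ≡ (*-suc c N′)) c≈κ)))

-- Equal indices and coprimality give r = s = 1, and then the link with i = 1 identifies x with y.
index-unique : ∀ {n} {x y : Fin n} → PairData.i (pairData x y) ≡ 1 → dv x ≡ dv y → x ≡ y
index-unique {n} {x} {y} i≡1 dv≡ = toℕ-injective (≈∧<⇒≡ (toℕ<n x) (toℕ<n y)
  (≈-sym (subst₂ (λ a b → a ≈ b mod n) (trans (cong (_* toℕ y) s≡1) (*-identityˡ _))
    (trans (cong (_* (r * toℕ x)) i≡1) (trans (*-identityˡ _) (trans (cong (_* toℕ x) r≡1) (*-identityˡ _)))) link)))
  where
  open PairData (pairData x y)
  r≡s : r ≡ s
  r≡s = *-cancelʳ-≡ r s (dv x) {{>-nonZero (dv-positive x)}} (trans r*dv (trans (sym s*dv) (cong (s *_) (sym dv≡))))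
  r≡1 : r ≡ 1
  r≡1 = r-s-coprime (∣-refl , ∣-reflexive r≡s)
  s≡1 : s ≡ 1
  s≡1 = trans (sym r≡s) r≡1

0-≈ : ∀ {x y} → x ≈ y mod 0 → x ≡ y
0-≈ {x} {y} (by p q eq) = trans (sym (trans (cong (x +_) (*-zeroʳ p)) (+-identityʳ x)))
  (trans eq (trans (cong (y +_) (*-zeroʳ q)) (+-identityʳ y)))

minΔ-lengths : ∀ {n} {G0 : Subset n} {k} → IsMinΔ G0 k → ∃[ B ] ∃[ l ] (Over G0 B × InL B l × InL B (l + k))
minΔ-lengths ((B , inB , _ , l , Ll , Ll+k , _) , _) = B , l , proj₁ inB , Ll , Ll+k

not-all-compatible : ∀ {n} {G0 : Subset n} {k} → IsMinΔ G0 k → n ≤ 10 * k → 42 ≤ k → 0 < n →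
  ¬ (∀ {g h} → g ∈ G0 → h ∈ G0 → PairData.i (pairData g h) ≡ 1)
not-all-compatible {n} {G0} {k} isMin n≤10k 42≤k 0<n compat =
  n>0⇒n≢0 (minΔ-positive isMin) (+-cancelˡ-≡ l k 0 (trans (sym l≡l+k) (sym (+-identityʳ l))))
  where
  instance _ = >-nonZero 0<n
  l = proj₁ (proj₂ (minΔ-lengths isMin))
  -- Modulus 0: since all norms are exactly 1, weight determines length, against the lengths l and l
  -- + k.
  atomic : ∀ U → MinimalZeroSum U → Over G0 U → ∃[ N ] (wt dv U ≡ n * N × 1 * N ≈ 1 mod 0)
  atomic U atom over = N , trans wt≡ (*-comm N n) , ≈-reflexive (trans (*-identityˡ N) (norm≡1 0<N N≤k 1≈N))
    where
    norm = compatible-norm isMin compat atom over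
    N = proj₁ norm
    wt≡ = proj₁ (proj₂ norm)
    1≈N = proj₂ (proj₂ norm)
    x₀ = len-positive⇒nonempty U (proj₁ atom)
    member : ∀ {x} → 0 < U x * dv x → x ∈ G0
    member {x} 0< = over x (n≢0⇒n>0 λ eq → n>0⇒n≢0 0< (cong (_* dv x) eq))
    0<N : 0 < N
    0<N = n≢0⇒n>0 λ eq → n>0⇒n≢0 (≤-trans (*-mono-≤ (proj₂ x₀) (dv-positive (proj₁ x₀))) (term≤∑ (λ x → U x * dv x) (proj₁ x₀)))
      (trans wt≡ (cong (_* n) eq))
    N≤k : N ≤ k
    N≤k = *-cancelʳ-≤ N k n (subst (_≤ k * n) wt≡ (norm-bound n≤10k 42≤k (λ x → U x * dv x) (fromℕ< 0<n)
      (λ x → ≤-trans (*-monoˡ-≤ (dv x) (atom-multiplicity atom x)) (≤-reflexive (ord*dv x)))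
      (λ x y 0<x 0<y _ _ → index-unique (compat (member 0<x) (member 0<y)))))
  l≡l+k : l ≡ l + k
  l≡l+k =
    let over , Ll , Ll+k = proj₂ (proj₂ (minΔ-lengths isMin))
    in 0-≈ (subst₂ (λ a b → a ≈ b mod 0) (*-identityˡ l) (*-identityˡ (l + k)) (length-functional dv 1 0<n atomic over Ll Ll+k))

-- Membership in I(m) from Q, R and j

InDivisorI : ℕ → ℕ → Set
InDivisorI n k = ∃[ m ] (m ∣ n × InI m k)

-- For m = S + P k the triple (c₁ , c₂ , m / D) lies in M(m), with quotients α k and β k.
record Certificate (S P c₁ c₂ α β D : ℕ) : Set where
  constructor certificate
  field
    c₁-positive : 0 < c₁
    c₂-positive : 0 < c₂
    α-positive  : 0 < α
    β-positive  : 0 < β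
    sum≡        : c₁ + c₂ ≡ S
    α≡          : α * (c₁ * c₂) ≡ P
    β≡          : β * c₂ * D ≡ P
    D∣S         : D ∣ S
    coprime     : gcd α β ≡ 1

certificate⇒InI : ∀ {m k S P c₁ c₂ α β D} → 0 < k → m ≡ S + P * k → Certificate S P c₁ c₂ α β D → InI m k
certificate⇒InI {m} {k} {S} {P} {c₁} {c₂} {α} {β} {D} 0<k m≡ cert =
  c₁ , c₂ , d , α * k , β * k ,
  (c₁-positive , ≤-trans (m≤m+n c₁ c₂) (<⇒≤ c₁+c₂<m)) ,
  (c₂-positive , ≤-trans (m≤n+m c₂ c₁) (<⇒≤ c₁+c₂<m)) ,
  divides D (trans d*D (*-comm d D)) , c₁+c₂<m ,
  (*-mono-≤ α-positive 0<k , trans a≡ (sym rest)) ,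
  (*-mono-≤ β-positive 0<k , trans b≡ (cong (_* d) (sym rest))) ,
  sym gcd≡
  where
  open Certificate cert
  0<P : 0 < P
  0<P = subst (0 <_) α≡ (*-mono-≤ α-positive (*-mono-≤ c₁-positive c₂-positive))
  c₁+c₂<m : c₁ + c₂ < m
  c₁+c₂<m = subst₂ _<_ (sym sum≡) (sym m≡) (m<m+n S (*-mono-≤ 0<P 0<k))
  D∣m : D ∣ m
  D∣m = subst (D ∣_) (sym m≡) (∣m∣n⇒∣m+n D∣S (∣m⇒∣m*n k (divides (β * c₂) (sym β≡))))
  d : ℕ
  d = quotient D∣m
  d*D : m ≡ d * D
  d*D = _∣_.equality D∣m
  rest : m ∸ c₁ ∸ c₂ ≡ P * k
  rest = trans (∸-+-assoc m c₁ c₂) (trans (cong₂ _∸_ m≡ sum≡) (m+n∸m≡n S (P * k)))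
  a≡ : α * k * (c₁ * c₂) ≡ P * k
  a≡ = trans (lemma α k (c₁ * c₂)) (cong (_* k) α≡)
    where
    lemma : ∀ α k c → α * k * c ≡ α * c * k
    lemma = solve-∀
  b≡ : β * k * (c₂ * m) ≡ P * k * d
  b≡ = trans (cong (λ t → β * k * (c₂ * t)) d*D) (trans (lemma β k c₂ d D) (cong (λ t → t * k * d) β≡))
    where
    lemma : ∀ β k c d D → β * k * (c * (d * D)) ≡ β * c * D * k * d
    lemma = solve-∀
  gcd≡ : gcd (α * k) (β * k) ≡ k
  gcd≡ = trans (cong₂ gcd (*-comm α k) (*-comm β k))
    (trans (sym (c*gcd[m,n]≡gcd[cm,cn] k α β)) (trans (cong (k *_) coprime) (*-identityʳ k)))

certificate? : ∀ S P c₁ c₂ α β D → Dec (Certificate S P c₁ c₂ α β D)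
certificate? S P c₁ c₂ α β D = map′
  (λ (a , b , c , d , e , f , g , h , i) → certificate a b c d e f g h i)
  (λ (certificate a b c d e f g h i) → a , b , c , d , e , f , g , h , i)
  (0 <? c₁ ×-dec 0 <? c₂ ×-dec 0 <? α ×-dec 0 <? β ×-dec c₁ + c₂ ℕₚ.≟ S ×-dec
   α * (c₁ * c₂) ℕₚ.≟ P ×-dec β * c₂ * D ℕₚ.≟ P ×-dec D ∣? S ×-dec gcd α β ℕₚ.≟ 1)

Valid : ℕ → ℕ → ℕ × ℕ × ℕ × ℕ × ℕ → Set
Valid S P (c₁ , c₂ , α , β , D) = Certificate S P c₁ c₂ α β D

-- In order, these triples cover (S , P) = (2 , 2), (3 , 6), (4 , 6), (4 , 8), (6 , 8), (6 , 9). For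
-- j ≥ 2 the last two arise only from m = T M, with T = 2 and T = 3.
Certified : ℕ → ℕ → Set
Certified S P = Any (Valid S P)
  ((1 , 1 , 2 , 1 , 2) ∷ (1 , 2 , 3 , 1 , 3) ∷ (1 , 3 , 2 , 1 , 2) ∷
   (2 , 2 , 2 , 1 , 4) ∷ (2 , 4 , 1 , 2 , 1) ∷ (3 , 3 , 1 , 3 , 1) ∷ [])

certified⇒InI : ∀ {m k S P} → 0 < k → m ≡ S + P * k → Certified S P → InI m k
certified⇒InI 0<k m≡ cert = certificate⇒InI 0<k m≡ (proj₂ (satisfied cert))

-- T is the index of ⟨g⟩ ∩ ⟨h⟩, so the two certificates are for m = M and for m = T M = n. If both
-- are missing, T = 1 says that g and h generate the whole group.
Cases : ℕ → ℕ → ℕ → ℕ → Set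
Cases T Q R j = T * (Q * R * j) ≤ 9 →
  Certified (Q + R) (Q * R * j) ⊎ Certified (T * (Q + R)) (T * (Q * R * j)) ⊎
  (T ≡ 1 × ¬ j ∣ Q + R × (Q ≡ 1 ⊎ R ≡ 1))

-- A finite search: the product is at most 9, which bounds every factor. It starts at j = 2 because
-- j = 1 has a uniform certificate.
cases-small : ∀ (T Q R j : Fin 9) → Cases (1 + toℕ T) (1 + toℕ Q) (1 + toℕ R) (2 + toℕ j)
cases-small = toWitness {a? = all? λ T → all? λ Q → all? λ R → all? λ j → cases? (1 + toℕ T) (1 + toℕ Q) (1 + toℕ R) (2 + toℕ j)} _
  where
  certified? : ∀ S P → Dec (Certified S P)
  certified? S P = any? (λ (c₁ , c₂ , α , β , D) → certificate? S P c₁ c₂ α β D) _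
  cases? : ∀ T Q R j → Dec (Cases T Q R j)
  cases? T Q R j = T * (Q * R * j) ≤? 9 →-dec
    (certified? (Q + R) (Q * R * j) ⊎-dec certified? (T * (Q + R)) (T * (Q * R * j)) ⊎-dec
     (T ℕₚ.≟ 1 ×-dec ¬? (j ∣? Q + R) ×-dec (Q ℕₚ.≟ 1 ⊎-dec R ℕₚ.≟ 1)))

cases : ∀ {T Q R j} → 0 < T → 0 < Q → 0 < R → 2 ≤ j → Cases T Q R j
cases {j = suc zero} _ _ _ (s≤s ())
cases {suc T} {suc Q} {suc R} {suc (suc j)} _ _ _ _ small =
  go (fromℕ< T<) (fromℕ< Q<) (fromℕ< R<) (fromℕ< j<) (toℕ-fromℕ< T<) (toℕ-fromℕ< Q<) (toℕ-fromℕ< R<) (toℕ-fromℕ< j<) small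
  where
  m≤m*suc : ∀ x y → suc x ≤ suc x * suc y
  m≤m*suc x y = m≤m*n (suc x) (suc y)
  QRj : ℕ
  QRj = suc Q * suc R * suc (suc j)
  T< : T < 9
  T< = ≤-trans (m≤m*suc T _) small
  QRj≤9 : QRj ≤ 9
  QRj≤9 = ≤-trans (m≤n*m QRj (suc T)) small
  QR≤9 : suc Q * suc R ≤ 9
  QR≤9 = ≤-trans (m≤m*n (suc Q * suc R) (suc (suc j))) QRj≤9
  Q< : Q < 9
  Q< = ≤-trans (m≤m*n (suc Q) (suc R)) QR≤9
  R< : R < 9
  R< = ≤-trans (m≤n*m (suc R) (suc Q)) QR≤9
  j< : j < 9
  j< = ≤-trans (n≤1+n (suc j)) (≤-trans (m≤n*m (suc (suc j)) (suc Q * suc R)) QRj≤9)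
  go : ∀ (t q r i : Fin 9) → toℕ t ≡ T → toℕ q ≡ Q → toℕ r ≡ R → toℕ i ≡ j → Cases (suc T) (suc Q) (suc R) (suc (suc j))
  go t q r i refl refl refl refl = cases-small t q r i

-- The values of n for which two generators g and i g of the whole group do not put k into any I(m);
-- here only the rest of G0 leads to a contradiction.
record Exceptional (k n i : ℕ) : Set where
  field
    Q R j : ℕ
    Q-positive : 0 < Q
    R-positive : 0 < R
    j-positive : 0 < j
    small      : Q * R * j ≤ 9
    i≡         : i ≡ 1 + R * (j * k)
    n≡         : n ≡ Q * (1 + R * (j * k)) + R
    j∤         : ¬ j ∣ Q + R
    one        : Q ≡ 1 ⊎ R ≡ 1

incompatible-cases : ∀ {k M T n i} → 0 < k → 0 < T → T * M ≡ n → n ≤ 10 * k → Incompatible k M i →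
                     InDivisorI n k ⊎ (T ≡ 1 × Exceptional k n i)
incompatible-cases {k} {M} {T} {n} {i} 0<k 0<T TM≡n n≤10k (Q , R , j , 0<Q , 0<R , 0<j , i≡ , M≡) = go j refl
  where
  M≡′ : M ≡ Q + R + Q * R * j * k
  M≡′ = trans M≡ (lemma Q R j k)
    where
    lemma : ∀ Q R j k → Q * (1 + R * (j * k)) + R ≡ Q + R + Q * R * j * k
    lemma = solve-∀
  n≡′ : n ≡ T * (Q + R) + T * (Q * R * j) * k
  n≡′ = trans (sym TM≡n) (trans (cong (T *_) M≡′) (lemma T (Q + R) (Q * R * j) k))
    where
    lemma : ∀ T S P k → T * (S + P * k) ≡ T * S + T * P * k
    lemma = solve-∀
  M∣n : M ∣ n
  M∣n = divides T (sym TM≡n)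
  -- The summand T (Q + R) of n is positive, so T Q R j k < n ≤ 10 k; the strict inequality gives 9
  -- rather than 10.
  small : T * (Q * R * j) ≤ 9
  small = ≤-pred (*-cancelʳ-< k (T * (Q * R * j)) 10 (<-≤-trans
    (m<n+m _ (*-mono-≤ 0<T (≤-trans 0<Q (m≤m+n Q R)))) (≤-trans (≤-reflexive (sym n≡′)) n≤10k)))
  go : ∀ j′ → j ≡ j′ → InDivisorI n k ⊎ (T ≡ 1 × Exceptional k n i)
  go zero eq = contradiction eq (n>0⇒n≢0 0<j)
  -- For j = 1 the triple (Q , R , m) has the quotients k and Q k, whose gcd is k.
  go (suc zero) eq = inj₁ (M , M∣n , certificate⇒InI 0<k (trans M≡′ (cong (λ j → Q + R + Q * R * j * k) eq))
    (certificate {c₁ = Q} {R} {1} {Q} {1} 0<Q 0<R z<s 0<Q refl (trans (*-identityˡ _) (sym (*-identityʳ _))) refl (1∣ (Q + R)) (gcd[1,n]≡1 Q)))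
    where
    gcd[1,n]≡1 : ∀ n → gcd 1 n ≡ 1
    gcd[1,n]≡1 n = ∣1⇒≡1 (gcd[m,n]∣m 1 n)
  go (suc (suc j′)) eq = conclude (cases 0<T 0<Q 0<R (subst (2 ≤_) (sym eq) (s≤s (s≤s z≤n))) small)
    where
    conclude : Certified (Q + R) (Q * R * j) ⊎ Certified (T * (Q + R)) (T * (Q * R * j)) ⊎
               (T ≡ 1 × ¬ j ∣ Q + R × (Q ≡ 1 ⊎ R ≡ 1)) → InDivisorI n k ⊎ (T ≡ 1 × Exceptional k n i)
    conclude (inj₁ cert)        = inj₁ (M , M∣n , certified⇒InI 0<k M≡′ cert)
    conclude (inj₂ (inj₁ cert)) = inj₁ (n , ∣-refl , certified⇒InI 0<k n≡′ cert)
    conclude (inj₂ (inj₂ (T≡1 , j∤ , one))) = inj₂ (T≡1 , record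
      { Q-positive = 0<Q ; R-positive = 0<R ; j-positive = 0<j ; small = ≤-trans (≤-reflexive (sym (trans (cong (_* (Q * R * j)) T≡1) (*-identityˡ _)))) small
      ; i≡ = i≡ ; n≡ = trans (sym TM≡n) (trans (trans (cong (_* M) T≡1) (*-identityˡ M)) M≡) ; j∤ = j∤ ; one = one })

-- Elements compared with a generator

generator-order : ∀ {n} {g : Fin n} → dv g ≡ 1 → IsOrder g n
generator-order {n} {g} dv≡1 =
  subst (IsOrder g) (trans (sym (*-identityʳ (ord g))) (trans (cong (ord g *_) (sym dv≡1)) (ord*dv g))) (isOrder g)

-- With dv g = 1 the equation r · dv g = s · dv x makes s divide r, so s = 1.
generator-index : ∀ {n} {g x : Fin n} → dv g ≡ 1 → (p : PairData g x) → PairData.T p ≡ dv x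
generator-index {n} {g} {x} dv≡1 p = trans (sym s*dv) (trans (cong (_* dv x) s≡1) (*-identityˡ (dv x)))
  where
  open PairData p
  s∣r : s ∣ r
  s∣r = divides (dv x) (trans (trans (sym (trans (cong (r *_) dv≡1) (*-identityʳ r))) r*dv) (trans (sym s*dv) (*-comm s (dv x))))
  s≡1 : s ≡ 1
  s≡1 = r-s-coprime (s∣r , ∣-refl)

generator-link : ∀ {n} {g x : Fin n} → dv g ≡ 1 → (p : PairData g x) → toℕ x ≈ PairData.i p * (dv x * toℕ g) mod n
generator-link {n} {g} {x} dv≡1 p = subst₂ (λ a b → a ≈ b mod n)
  (trans (cong (_* toℕ x) s≡1) (*-identityˡ (toℕ x))) (cong (λ r → i * (r * toℕ g)) r≡dv) link
  where
  open PairData p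
  r≡dv : r ≡ dv x
  r≡dv = trans (sym (trans (cong (r *_) dv≡1) (*-identityʳ r))) (trans r*dv (generator-index dv≡1 p))
  s≡1 : s ≡ 1
  s≡1 = *-cancelʳ-≡ s 1 (dv x) {{>-nonZero (dv-positive x)}} (trans s*dv (trans (generator-index dv≡1 p) (sym (*-identityˡ (dv x)))))

generator-compatible : ∀ {n} {g x : Fin n} → dv g ≡ 1 → (p : PairData g x) → PairData.i p ≡ 1 → toℕ x ≈ dv x * toℕ g mod n
generator-compatible {n} {g} {x} dv≡1 p i≡1 = subst (λ t → toℕ x ≈ t mod n)
  (trans (cong (_* (dv x * toℕ g)) i≡1) (*-identityˡ _)) (generator-link dv≡1 p)

generators-link : ∀ {n} {g x : Fin n} → dv g ≡ 1 → dv x ≡ 1 → (p : PairData g x) → toℕ x ≈ PairData.i p * toℕ g mod n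
generators-link {n} {g} {x} dv≡1 dv≡1′ p = subst (λ t → toℕ x ≈ PairData.i p * t mod n)
  (trans (cong (_* toℕ g) dv≡1′) (*-identityˡ (toℕ g))) (generator-link dv≡1 p)

generators-M : ∀ {n} {g x : Fin n} → dv g ≡ 1 → dv x ≡ 1 → (p : PairData g x) → PairData.M p ≡ n
generators-M dv≡1 dv≡1′ p = trans (sym (*-identityˡ _)) (trans (cong (_* PairData.M p) (sym (trans (generator-index dv≡1 p) dv≡1′))) (PairData.T*M p))

-- The exceptional shapes

module ExceptionalData {k n i} (b : Exceptional k n i) where
  open Exceptional b public

  κ i′ S P : ℕ
  κ  = j * k
  i′ = 1 + Q * κ
  S  = Q + R
  P  = Q * R * j

  -- i′ is the inverse of i modulo n, that is, the coefficient of g in base h: exchanging g and h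
  -- exchanges Q and R.
  i*i′ : i * i′ ≡ 1 + κ * n
  i*i′ = trans (cong (_* i′) i≡) (trans (lemma Q R κ) (cong (λ t → 1 + κ * t) (sym n≡)))
    where
    lemma : ∀ Q R κ → (1 + R * κ) * (1 + Q * κ) ≡ 1 + κ * (Q * (1 + R * κ) + R)
    lemma = solve-∀

  n≡Qi+R : n ≡ Q * i + R
  n≡Qi+R = trans n≡ (cong (λ t → Q * t + R) (sym i≡))

  n≡Ri′+Q : n ≡ R * i′ + Q
  n≡Ri′+Q = trans n≡ (lemma Q R κ)
    where
    lemma : ∀ Q R κ → Q * (1 + R * κ) + R ≡ R * (1 + Q * κ) + Q
    lemma = solve-∀

  n≡S+Pk : n ≡ S + P * k
  n≡S+Pk = trans n≡ (lemma Q R j k)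
    where
    lemma : ∀ Q R j k → Q * (1 + R * (j * k)) + R ≡ Q + R + Q * R * j * k
    lemma = solve-∀

  QR≤9 : Q * R ≤ 9
  QR≤9 = ≤-trans (m≤m*n (Q * R) j {{>-nonZero j-positive}}) small

  Q≤9 : Q ≤ 9
  Q≤9 = ≤-trans (m≤m*n Q R {{>-nonZero R-positive}}) QR≤9

  R≤9 : R ≤ 9
  R≤9 = ≤-trans (m≤n*m R Q {{>-nonZero Q-positive}}) QR≤9

  i≤n : i ≤ n
  i≤n = subst (i ≤_) (sym n≡Qi+R) (≤-trans (m≤n*m i Q {{>-nonZero Q-positive}}) (m≤m+n (Q * i) R))

  i′≤n : i′ ≤ n
  i′≤n = subst (i′ ≤_) (sym n≡Ri′+Q) (≤-trans (m≤n*m i′ R {{>-nonZero R-positive}}) (m≤m+n (R * i′) Q))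

  i-positive : 0 < i
  i-positive = subst (0 <_) (sym i≡) z<s

  sym-exceptional : Exceptional k n i′
  sym-exceptional = record
    { Q = R ; R = Q ; j = j ; Q-positive = R-positive ; R-positive = Q-positive ; j-positive = j-positive
    ; small = subst (λ t → t * j ≤ 9) (*-comm Q R) small ; i≡ = refl ; n≡ = n≡Ri′+Q
    ; j∤ = j∤ ∘ subst (j ∣_) (+-comm R Q) ; one = swap one }

+-*-unique : ∀ {k S P S′ P′} → S < k → S′ < k → S + P * k ≡ S′ + P′ * k → S ≡ S′ × P ≡ P′
+-*-unique {k} {S} {P} {S′} {P′} S<k S′<k eq = S≡ , P≡
  where
  S≡ : S ≡ S′
  S≡ = ≈∧<⇒≡ S<k S′<k (by P P′ eq)
  P≡ : P ≡ P′
  P≡ = *-cancelʳ-≡ P P′ k {{>-nonZero (≤-trans z<s S<k)}} (+-cancelˡ-≡ S _ _ (trans eq (cong (_+ P′ * k) (sym S≡))))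

unit-pairs : ∀ {Q R Q′ R′} → Q ≡ 1 ⊎ R ≡ 1 → Q′ ≡ 1 ⊎ R′ ≡ 1 → Q + R ≡ Q′ + R′ →
             (Q ≡ Q′ × R ≡ R′) ⊎ (Q ≡ R′ × R ≡ Q′)
unit-pairs         (inj₁ refl) (inj₁ refl) eq = inj₁ (refl , suc-injective eq)
unit-pairs {Q′ = Q′} (inj₁ refl) (inj₂ refl) eq = inj₂ (refl , suc-injective (trans eq (+-comm Q′ 1)))
unit-pairs {Q} (inj₂ refl) (inj₁ refl) eq = inj₂ (suc-injective (trans (+-comm 1 Q) eq) , refl)
unit-pairs {Q} {Q′ = Q′} (inj₂ refl) (inj₂ refl) eq = inj₁ (+-cancelʳ-≡ 1 Q Q′ eq , refl)

-- Since S < k, division of n by k recovers S and P. As Q or R is 1, S determines the unordered pair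
-- {Q , R}, and then P determines j.
exceptional-unique : ∀ {k n i i₁} → 20 ≤ k → (b : Exceptional k n i) → Exceptional k n i₁ → i₁ ≡ i ⊎ i₁ ≡ ExceptionalData.i′ b
exceptional-unique {k} {n} {i} {i₁} 20≤k b b₁ = go (unit-pairs B.one B₁.one (proj₁ parts))
  where
  module B = ExceptionalData b
  module B₁ = ExceptionalData b₁
  S<k : ∀ {Q R} → Q ≤ 9 → R ≤ 9 → Q + R < k
  S<k Q≤9 R≤9 = <-≤-trans (s≤s (+-mono-≤ Q≤9 R≤9)) (≤-trans (n≤1+n 19) 20≤k)
  parts : B.S ≡ B₁.S × B.P ≡ B₁.P
  parts = +-*-unique (S<k B.Q≤9 B.R≤9) (S<k B₁.Q≤9 B₁.R≤9) (trans (sym B.n≡S+Pk) B₁.n≡S+Pk)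
  j≡ : B.Q * B.R ≡ B₁.Q * B₁.R → B.j ≡ B₁.j
  j≡ eq = *-cancelˡ-≡ B.j B₁.j (B.Q * B.R) {{>-nonZero (*-mono-≤ B.Q-positive B.R-positive)}}
    (trans (proj₂ parts) (cong (_* B₁.j) (sym eq)))
  go : (B.Q ≡ B₁.Q × B.R ≡ B₁.R) ⊎ (B.Q ≡ B₁.R × B.R ≡ B₁.Q) → i₁ ≡ i ⊎ i₁ ≡ B.i′
  go (inj₁ (Q≡ , R≡)) = inj₁ (trans B₁.i≡ (trans (cong₂ (λ R j → 1 + R * (j * k)) (sym R≡) (sym (j≡ (cong₂ _*_ Q≡ R≡)))) (sym B.i≡)))
  go (inj₂ (Q≡ , R≡)) = inj₂ (trans B₁.i≡ (cong₂ (λ R j → 1 + R * (j * k)) (sym Q≡)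
    (sym (j≡ (trans (cong₂ _*_ Q≡ R≡) (*-comm B₁.R B₁.Q))))))

-- The coefficient q² would lie between 4 and 81 < k, whereas the coefficient of a pair is 1 or
-- exceeds k.
small-multiple-excluded : ∀ {n} {G0 : Subset n} {k} → IsMinΔ G0 k → 100 ≤ k → n ≤ 10 * k → 100 ≤ n →
  ∀ {y z} → y ∈ G0 → z ∈ G0 → dv y ≡ 1 → dv z ≡ 1 → ∀ {q} → 2 ≤ q → q ≤ 9 → ¬ toℕ z ≈ (q * q) * toℕ y mod n
small-multiple-excluded {n} {G0} {k} isMin 100≤k n≤10k 100≤n {y} {z} y∈ z∈ dy dz {q} 2≤q q≤9 z≈ =
  go (pair-structure isMin (≤-trans (m≤m+n 10 90) 100≤k) n≤10k p y∈ z∈)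
  where
  p = pairData y z
  open PairData p
  i≡q² : i ≡ q * q
  i≡q² = ≈∧range⇒≡ 0<i (≤-trans i≤M (≤-reflexive (generators-M dy dz p))) (≤-trans z<s (*-mono-≤ 2≤q 2≤q))
    (≤-trans (*-mono-≤ q≤9 q≤9) (≤-trans (m≤m+n 81 19) 100≤n))
    (order-cancel (generator-order dy) (≈-trans (≈-sym (generators-link dy dz p)) z≈))
  go : i ≡ 1 ⊎ Incompatible k M i → ⊥
  go (inj₁ i≡1) = contradiction (trans (sym i≡1) i≡q²) (<⇒≢ (≤-trans (m≤m+n 2 2) (*-mono-≤ 2≤q 2≤q)))
  go (inj₂ (Q , R , j , 0<Q , 0<R , 0<j , i≡ , _)) = <⇒≱ k<i (≤-trans (≤-reflexive i≡q²)
    (≤-trans (*-mono-≤ q≤9 q≤9) (≤-trans (m≤m+n 81 19) 100≤k)))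
    where
    k<i : k < i
    k<i = subst (k <_) (sym i≡) (s≤s (≤-trans (m≤n*m k j {{>-nonZero 0<j}}) (m≤n*m (j * k) R {{>-nonZero 0<R}})))

complement-square : ∀ {n i q} → n ≡ i + q → i * i ≈ q * q mod n
complement-square {n} {i} {q} refl = by q i (lemma i q)
  where
  lemma : ∀ i q → i * i + q * (i + q) ≡ q * q + i * (i + q)
  lemma = solve-∀

square-link : ∀ {n} {x y z : Fin n} c → toℕ y ≈ c * toℕ x mod n → toℕ z ≈ c * toℕ y mod n → toℕ z ≈ (c * c) * toℕ x mod n
square-link {n} {x} {y} c y≈ z≈ = ≈-trans z≈ (subst (λ t → c * toℕ y ≈ t mod n) (sym (*-assoc c c (toℕ x))) (≈-*ˡ c y≈))

inverse-link : ∀ {n} {x y : Fin n} {c c′ m} → c * c′ ≡ 1 + m * n → toℕ y ≈ c * toℕ x mod n → toℕ x ≈ c′ * toℕ y mod n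
inverse-link {n} {x} {y} {c} {c′} {m} cc′ y≈ = ≈-sym (≈-trans (≈-*ˡ c′ y≈)
  (by 0 (m * toℕ x) (trans (+-identityʳ _) (trans (lemma₁ c′ c (toℕ x)) (trans (cong (_* toℕ x) cc′) (lemma₂ m n (toℕ x)))))))
  where
  lemma₁ : ∀ c′ c x → c′ * (c * x) ≡ c * c′ * x
  lemma₁ = solve-∀
  lemma₂ : ∀ m n x → (1 + m * n) * x ≡ x + m * x * n
  lemma₂ = solve-∀

-- Q = 1 gives i ≡ −R and R = 1 gives i′ ≡ −Q modulo n, so a third generator would be the square of
-- a small number times another one.
third-generator-excluded : ∀ {n} {G0 : Subset n} {k i} → IsMinΔ G0 k → 100 ≤ k → n ≤ 10 * k → 100 ≤ n →
  (b : Exceptional k n i) → ∀ {g h x} → g ∈ G0 → h ∈ G0 → x ∈ G0 → dv g ≡ 1 → dv h ≡ 1 → dv x ≡ 1 →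
  toℕ h ≈ i * toℕ g mod n → toℕ x ≈ ExceptionalData.i′ b * toℕ g mod n → ExceptionalData.Q b ≡ ExceptionalData.R b
third-generator-excluded {n} {G0} {k} {i} isMin 100≤k n≤10k 100≤n b {g} {h} {x} g∈ h∈ x∈ dg dh dx h≈ x≈ = go one
  where
  open ExceptionalData b
  1≡ : ∀ {q} → 0 < q → ¬ 2 ≤ q → 1 ≡ q
  1≡ 0<q q≱2 = ≤-antisym 0<q (≤-pred (≰⇒> q≱2))
  go : Q ≡ 1 ⊎ R ≡ 1 → Q ≡ R
  -- x = i′ g means g = i x, hence h = i² x = R² x.
  go (inj₁ Q≡1) = trans Q≡1 (1≡ R-positive λ 2≤R →
    small-multiple-excluded isMin 100≤k n≤10k 100≤n x∈ h∈ dx dh 2≤R R≤9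
      (≈-trans (square-link {x = x} {y = g} {z = h} i (inverse-link {x = g} {y = x} {i′} {i} {κ} (trans (*-comm i′ i) i*i′) x≈) h≈)
        (≈-*ʳ (toℕ x) (complement-square {i = i} {R} (trans n≡Qi+R (cong (_+ R) (trans (cong (_* i) Q≡1) (*-identityˡ i))))))))
  go (inj₂ R≡1) = trans (sym (1≡ Q-positive λ 2≤Q →
    small-multiple-excluded isMin 100≤k n≤10k 100≤n h∈ x∈ dh dx 2≤Q Q≤9
      (≈-trans (square-link {x = h} {y = g} {z = x} i′ (inverse-link {x = g} {y = h} {i} {i′} {κ} i*i′ h≈) x≈)
        (≈-*ʳ (toℕ h) (complement-square {i = i′} {Q} (trans n≡Ri′+Q (cong (_+ Q) (trans (cong (_* i′) R≡1) (*-identityˡ i′)))))))))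
    (sym R≡1)

-- A pair (g , x) with coefficient other than 1 either yields the goal `InDivisorI n k` or is
-- exceptional for the same n and k, which leaves only i and i′ as coefficients.
exceptional-element : ∀ {n} {G0 : Subset n} {k i} → IsMinΔ G0 k → 100 ≤ k → n ≤ 10 * k → 100 ≤ n →
  Exceptional k n i → ∀ {g h} → g ∈ G0 → h ∈ G0 → dv g ≡ 1 → dv h ≡ 1 → toℕ h ≈ i * toℕ g mod n →
  ∀ {x} → x ∈ G0 → InDivisorI n k ⊎ (x ≡ h ⊎ toℕ x ≈ dv x * toℕ g mod n)
exceptional-element {n} {G0} {k} {i} isMin 100≤k n≤10k 100≤n b {g} {h} g∈ h∈ dg dh h≈ {x} x∈ =
  go (pair-structure isMin (≤-trans (m≤m+n 10 90) 100≤k) n≤10k p g∈ x∈)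
  where
  p = pairData g x
  module P = PairData p
  open ExceptionalData b
  same : toℕ x ≈ i * toℕ g mod n → x ≡ h
  same x≈ = toℕ-injective (≈∧<⇒≡ (toℕ<n x) (toℕ<n h) (≈-trans x≈ (≈-sym h≈)))
  conclude : dv x ≡ 1 → Exceptional k n P.i → x ≡ h
  conclude dx b₁ = split (exceptional-unique (≤-trans (m≤m+n 20 80) 100≤k) b b₁)
    where
    x≈ : toℕ x ≈ P.i * toℕ g mod n
    x≈ = generators-link dg dx p
    split : P.i ≡ i ⊎ P.i ≡ i′ → x ≡ h
    split (inj₁ eq) = same (subst (λ t → toℕ x ≈ t * toℕ g mod n) eq x≈)
    -- The coefficient i′ forces Q = R, and then i′ = i.
    split (inj₂ eq) = same (subst (λ t → toℕ x ≈ t * toℕ g mod n)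
      (trans eq (trans (cong (λ t → 1 + t * κ) (third-generator-excluded isMin 100≤k n≤10k 100≤n b g∈ h∈ x∈ dg dh dx h≈
        (subst (λ t → toℕ x ≈ t * toℕ g mod n) eq x≈))) (sym i≡))) x≈)
  go : P.i ≡ 1 ⊎ Incompatible k P.M P.i → InDivisorI n k ⊎ (x ≡ h ⊎ toℕ x ≈ dv x * toℕ g mod n)
  go (inj₁ i≡1) = inj₂ (inj₂ (generator-compatible dg p i≡1))
  go (inj₂ inc) = finish (incompatible-cases (≤-trans z<s 100≤k) 0<T P.T*M n≤10k inc)
    where
    0<T : 0 < P.T
    0<T = subst (0 <_) (sym (generator-index dg p)) (dv-positive x)
    finish : InDivisorI n k ⊎ (P.T ≡ 1 × Exceptional k n P.i) → InDivisorI n k ⊎ (x ≡ h ⊎ toℕ x ≈ dv x * toℕ g mod n)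
    finish (inj₁ goal)       = inj₁ goal
    finish (inj₂ (T≡1 , b₁)) = inj₂ (inj₁ (conclude (trans (sym (generator-index dg p)) T≡1) b₁))

-- Weights in two bases

≈-unscale : ∀ {m x y} c → 0 < c → c * x ≈ c * y mod (c * m) → x ≈ y mod m
≈-unscale {m} {x} {y} c 0<c (by p q e) = by p q (*-cancelˡ-≡ _ _ c {{>-nonZero 0<c}}
  (trans (lemma c x p m) (trans e (sym (lemma c y q m)))))
  where
  lemma : ∀ c x p m → c * (x + p * m) ≡ c * x + p * (c * m)
  lemma = solve-∀

wt-*ˡ : ∀ {n} (W : Fin n → ℕ) c (S : Seq n) → wt (λ x → c * W x) S ≡ c * wt W S
wt-*ˡ W c S = trans (∑-cong (λ x → cong (S x *_) (*-comm c (W x)))) (trans (wt-*ʳ W c S) (*-comm (wt W S) c))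

-- Weights with respect to two bases are proportional up to κ, so norm 1 in either base suffices.
two-base : ∀ {n} {U : Seq n} {W W′ : Fin n → ℕ} {m κ N N′} q i → 0 < m →
  (∀ x → 0 < U x → q * (i * W′ x) ≈ q * W x mod (m * κ)) → q * i ≈ q mod κ →
  wt W U ≡ m * N → wt W′ U ≡ m * N′ → N ≡ 1 ⊎ N′ ≡ 1 → q * N ≈ q mod κ
two-base {n} {U} {W} {W′} {m} {κ} {N} {N′} q i 0<m relation qi≈q wt≡ wt′≡ = go
  where
  norms : q * N ≈ q * N′ mod κ
  norms = ≈-sym (≈-trans (≈-sym (≈-*ʳ N′ qi≈q)) (≈-unscale m 0<m (subst₂ (λ a b → a ≈ b mod (m * κ))
    (trans (wt-*ˡ (λ x → i * W′ x) q U) (trans (cong (q *_) (trans (wt-*ˡ W′ i U) (cong (i *_) wt′≡))) (lemma q i m N′)))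
    (trans (wt-*ˡ W q U) (trans (cong (q *_) wt≡) (lemma′ q m N)))
    (support-≈ {U = U} relation))))
    where
    lemma : ∀ q i m N → q * (i * (m * N)) ≡ m * (q * i * N)
    lemma = solve-∀
    lemma′ : ∀ q m N → q * (m * N) ≡ m * (q * N)
    lemma′ = solve-∀
  go : N ≡ 1 ⊎ N′ ≡ 1 → q * N ≈ q mod κ
  go (inj₁ N≡1)  = ≈-reflexive (trans (cong (q *_) N≡1) (*-identityʳ q))
  go (inj₂ N′≡1) = ≈-trans norms (≈-reflexive (trans (cong (q *_) N′≡1) (*-identityʳ q)))

-- The coefficients in base g: i for h, and the index for all other members of G0.
pickWeight : ∀ {n} → Fin n → ℕ → Fin n → ℕ
pickWeight h i x = pick h i (dv x) x

module PickWeight {n} {G0 : Subset n} {k i} (isMin : IsMinΔ G0 k) (n≤10k : n ≤ 10 * k) (42≤k : 42 ≤ k)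
  {g h : Fin n} (g∈ : g ∈ G0) (h∈ : h ∈ G0) (dg : dv g ≡ 1) (0<i : 0 < i) (i≤n : i ≤ n)
  (h≈ : toℕ h ≈ i * toℕ g mod n) (class : ∀ {x} → x ∈ G0 → x ≡ h ⊎ toℕ x ≈ dv x * toℕ g mod n) where

  private
    W : Fin n → ℕ
    W = pickWeight h i

  0<n : 0 < n
  0<n = Fin⇒positive g

  W-at : W h ≡ i
  W-at = pick-same h i (dv h)

  W-off : ∀ {x} → h ≢ x → W x ≡ dv x
  W-off {x} h≢x = pick-diff i (dv x) h≢x

  range : ∀ x → 0 < W x × W x ≤ n
  range x = go (h ≟ x)
    where
    go : Dec (h ≡ x) → 0 < W x × W x ≤ n
    go (yes refl) = subst (0 <_) (sym W-at) 0<i , subst (_≤ n) (sym W-at) i≤n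
    go (no h≢x)   = subst (0 <_) (sym (W-off h≢x)) (dv-positive x) , subst (_≤ n) (sym (W-off h≢x)) (dv≤n x)

  off-link : ∀ {x} → x ∈ G0 → h ≢ x → toℕ x ≈ dv x * toℕ g mod n
  off-link x∈ h≢x = go (class x∈)
    where
    go : _ ⊎ _ → _
    go (inj₁ x≡h) = contradiction (sym x≡h) h≢x
    go (inj₂ x≈)  = x≈

  value : ∀ {x} → x ∈ G0 → toℕ x ≈ W x * toℕ g mod n
  value {x} x∈ = go (h ≟ x)
    where
    go : Dec (h ≡ x) → toℕ x ≈ W x * toℕ g mod n
    go (yes refl) = subst (λ w → toℕ x ≈ w * toℕ g mod n) (sym W-at) h≈
    go (no h≢x)   = subst (λ w → toℕ x ≈ w * toℕ g mod n) (sym (W-off h≢x)) (off-link x∈ h≢x)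

  norm : ∀ {U} → MinimalZeroSum U → Over G0 U → ∃[ N ] (wt W U ≡ n * N × 1 ≈ N mod k)
  norm {U} atom over = N , trans wt≡ (*-comm N n) ,
    base-norm-≈ isMin {W = W} {U = U} g∈ (generator-order dg) atom over range (λ x 0<Ux → value (over x 0<Ux)) N wt≡
    where
    n∣wt = base-norm {W = W} {U = U} (generator-order dg) (λ x 0<Ux → value (over x 0<Ux)) (proj₁ (proj₂ atom))
    N = quotient n∣wt
    wt≡ : wt W U ≡ N * n
    wt≡ = _∣_.equality n∣wt

  -- Only h can have a contribution above n, because its coefficient is not its index. If it does
  -- not, `norm-bound` applies with h as the distinguished element.
  norm≡1-if-few : ∀ {U N} → MinimalZeroSum U → Over G0 U → wt W U ≡ n * N → 1 ≈ N mod k → U h * i ≤ n → N ≡ 1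
  norm≡1-if-few {U} {N} atom over wt≡ 1≈N few = norm≡1 0<N N≤k 1≈N
    where
    x₀ = len-positive⇒nonempty U (proj₁ atom)
    0<N : 0 < N
    0<N = n≢0⇒n>0 λ eq → n>0⇒n≢0 (≤-trans (*-mono-≤ (proj₂ x₀) (proj₁ (range (proj₁ x₀)))) (term≤∑ (λ x → U x * W x) (proj₁ x₀)))
      (trans wt≡ (trans (cong (n *_) eq) (*-zeroʳ n)))
    member : ∀ {x} → 0 < U x * W x → x ∈ G0
    member {x} 0< = over x (n≢0⇒n>0 λ eq → n>0⇒n≢0 0< (cong (_* W x) eq))
    bounded : ∀ x → U x * W x ≤ n
    bounded x = go (h ≟ x)
      where
      go : Dec (h ≡ x) → U x * W x ≤ n
      go (yes refl) = ≤-trans (≤-reflexive (cong (U h *_) W-at)) few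
      go (no h≢x)   = ≤-trans (≤-reflexive (cong (U x *_) (W-off h≢x)))
        (≤-trans (*-monoˡ-≤ (dv x) (atom-multiplicity atom x)) (≤-reflexive (ord*dv x)))
    unique : ∀ x y → 0 < U x * W x → 0 < U y * W y → x ≢ h → y ≢ h → dv x ≡ dv y → x ≡ y
    unique x y 0<x 0<y x≢h y≢h dv≡ = toℕ-injective (≈∧<⇒≡ (toℕ<n x) (toℕ<n y)
      (≈-trans (off-link (member 0<x) (x≢h ∘ sym)) (≈-sym
        (subst (λ d → toℕ y ≈ d * toℕ g mod n) (sym dv≡) (off-link (member 0<y) (y≢h ∘ sym))))))
    N≤k : N ≤ k
    N≤k = *-cancelʳ-≤ N k n {{>-nonZero 0<n}} (subst (_≤ k * n) (trans wt≡ (*-comm n N))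
      (norm-bound n≤10k 42≤k (λ x → U x * W x) h bounded unique))

exceptional-contradiction : ∀ {n} {G0 : Subset n} {k i} → IsMinΔ G0 k → 100 ≤ k → n ≤ 10 * k → 100 ≤ n → (b : Exceptional k n i) →
  ∀ {g h} → g ∈ G0 → h ∈ G0 → dv g ≡ 1 → dv h ≡ 1 → toℕ h ≈ i * toℕ g mod n →
  (∀ {x} → x ∈ G0 → x ≡ h ⊎ toℕ x ≈ dv x * toℕ g mod n) →
  (∀ {x} → x ∈ G0 → x ≡ g ⊎ toℕ x ≈ dv x * toℕ h mod n) → ⊥
exceptional-contradiction {n} {G0} {k} {i} isMin 100≤k n≤10k 100≤n b {g} {h} g∈ h∈ dg dh h≈ class class′ =
  -- The lengths l and l + k satisfy S l ≡ S (l + k) modulo j k, so j k ∣ S k.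
  j∤ (*-cancelʳ-∣ k {{>-nonZero 0<k}} (≈⇒∣diff (subst (λ t → S * l ≈ t mod κ) (*-distribˡ-+ S l k)
    (length-functional W S 0<n atomic (proj₁ lengths) (proj₁ (proj₂ lengths)) (proj₂ (proj₂ lengths))))))
  where
  open ExceptionalData b
  42≤k : 42 ≤ k
  42≤k = ≤-trans (m≤m+n 42 58) 100≤k
  0<k : 0 < k
  0<k = ≤-trans z<s 100≤k
  0<n : 0 < n
  0<n = ≤-trans z<s 100≤n
  g≈ : toℕ g ≈ i′ * toℕ h mod n
  g≈ = inverse-link {x = g} {y = h} {i} {i′} {κ} i*i′ h≈
  module A = PickWeight isMin n≤10k 42≤k {g} {h} g∈ h∈ dg i-positive i≤n h≈ class
  module B = PickWeight isMin n≤10k 42≤k {h} {g} h∈ g∈ dh z<s i′≤n g≈ class′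
  W W′ : Fin n → ℕ
  W  = pickWeight h i
  W′ = pickWeight g i′
  l = proj₁ (proj₂ (minΔ-lengths isMin))
  lengths = proj₂ (proj₂ (minΔ-lengths isMin))
  g≢h : g ≢ h
  g≢h g≡h = n>0⇒n≢0 (*-mono-≤ R-positive (*-mono-≤ j-positive 0<k)) (sym (suc-injective (trans 1≡i i≡)))
    where
    1≡i : 1 ≡ i
    1≡i = ≈∧range⇒≡ z<s 0<n i-positive i≤n (order-cancel (generator-order dg)
      (subst₂ (λ a b → a ≈ b mod n) (trans (sym (cong toℕ g≡h)) (sym (*-identityˡ (toℕ g)))) refl h≈))
  Si≡ : S * i ≡ S + S * R * κ
  Si≡ = trans (cong (S *_) i≡) (lemma S R κ)
    where
    lemma : ∀ S R κ → S * (1 + R * κ) ≡ S + S * R * κ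
    lemma = solve-∀
  Si≈S : S * i ≈ S mod κ
  Si≈S = subst (λ t → t ≈ S mod κ) (sym Si≡) (∣⇒≈ (n∣m*n (S * R)))
  -- The origin of the factor S: d g = d h gives d (i - 1) = d R κ = δ′ n, and n = Q R κ + S then
  -- yields κ ∣ S δ′.
  generic : ∀ {d} → d * toℕ g ≈ d * toℕ h mod n → S * (i * d) ≈ S * d mod (n * κ)
  generic {d} dg≈dh = subst (λ t → t ≈ S * d mod (n * κ)) (sym expand) (∣⇒≈ n*κ∣)
    where
    n∣ : n ∣ d * (R * κ)
    n∣ = ≈⇒∣diff (subst (λ t → d ≈ t mod n) (trans (cong (d *_) i≡) (*-suc d (R * κ)))
      (order-cancel (generator-order dg) (≈-trans dg≈dh (≈-trans (≈-*ˡ d h≈) (≈-reflexive (sym (*-assoc d i (toℕ g))))))))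
    δ′ = quotient n∣
    δ≡ : d * (R * κ) ≡ δ′ * n
    δ≡ = _∣_.equality n∣
    κ∣Sδ : κ ∣ S * δ′
    κ∣Sδ = ∣m+n∣m⇒∣n {m = δ′ * (Q * R) * κ} {n = S * δ′} (divides (d * R) (begin
      δ′ * (Q * R) * κ + S * δ′   ≡⟨ lemma₁ Q R δ′ κ ⟩
      δ′ * (Q * (1 + R * κ) + R)  ≡⟨ cong (δ′ *_) n≡ ⟨
      δ′ * n                      ≡⟨ δ≡ ⟨
      d * (R * κ)                 ≡⟨ *-assoc d R κ ⟨
      d * R * κ                   ∎)) (n∣m*n (δ′ * (Q * R)))
      where
      open ≡-Reasoning
      lemma₁ : ∀ Q R δ κ → δ * (Q * R) * κ + (Q + R) * δ ≡ δ * (Q * (1 + R * κ) + R)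
      lemma₁ = solve-∀
    n*κ∣ : n * κ ∣ S * (d * (R * κ))
    n*κ∣ = subst (n * κ ∣_) (trans (lemma₂ n S δ′) (cong (S *_) (sym δ≡))) (*-monoʳ-∣ n κ∣Sδ)
      where
      lemma₂ : ∀ n S δ → n * (S * δ) ≡ S * (δ * n)
      lemma₂ = solve-∀
    expand : S * (i * d) ≡ S * d + S * (d * (R * κ))
    expand = trans (cong (λ i → S * (i * d)) i≡) (lemma₃ S R κ d)
      where
      lemma₃ : ∀ S R κ d → S * ((1 + R * κ) * d) ≡ S * d + S * (d * (R * κ))
      lemma₃ = solve-∀
  relation : ∀ {x} → x ∈ G0 → S * (i * W′ x) ≈ S * W x mod (n * κ)
  relation {x} x∈ = go (h ≟ x) (g ≟ x)
    where
    go : Dec (h ≡ x) → Dec (g ≡ x) → S * (i * W′ x) ≈ S * W x mod (n * κ)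
    go (yes refl) _ = ≈-reflexive (cong (S *_) (trans (cong (i *_) (trans (B.W-off g≢h) dh)) (trans (*-identityʳ i) (sym A.W-at))))
    go (no h≢x) (yes refl) = subst₂ (λ a b → S * a ≈ S * b mod (n * κ))
      (trans (sym i*i′) (cong (i *_) (sym B.W-at))) (sym (trans (A.W-off h≢x) dg))
      (≈-*ˡ S (∣⇒≈ (∣-reflexive (*-comm n κ))))
    go (no h≢x) (no g≢x) = subst₂ (λ a b → S * (i * a) ≈ S * b mod (n * κ)) (sym (B.W-off g≢x)) (sym (A.W-off h≢x))
      (generic (≈-trans (≈-sym (A.off-link x∈ h≢x)) (B.off-link x∈ g≢x)))
  -- R + Q i = n makes g^R h^Q zero-sum, so no atom contains it properly.
  few : ∀ {U} → MinimalZeroSum U → U h ≤ Q ⊎ U g ≤ R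
  few {U} atom@(_ , _ , minimal) = go (U h ≤? Q) (U g ≤? R)
    where
    T : Seq n
    T = R ⊛ δ g · Q ⊛ δ h
    Tg : T g ≡ R
    Tg = trans (cong₂ _+_ (⊛δ-same R g) (⊛δ-diff Q (g≢h ∘ sym))) (+-identityʳ R)
    T-zeroSum : ZeroSum T
    T-zeroSum = ∣wt⇒zeroSum T (subst (n ∣_) (sym (wt-pair toℕ R g Q h)) (∣-resp-≈ (≈-sym
      (≈-trans (≈-+ ≈-refl (≈-*ˡ Q h≈)) (≈-reflexive (lemma R (toℕ g) Q i))))
      (divides (toℕ g) (trans (cong (_* toℕ g) (sym n≡Qi+R)) (*-comm n (toℕ g))))))
      where
      lemma : ∀ R g Q i → R * g + Q * (i * g) ≡ (Q * i + R) * g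
      lemma = solve-∀
    T≼U : Q < U h → R < U g → T ≼ U
    T≼U Q<U R<U x with g ≟ x | h ≟ x
    ... | yes refl | yes refl = contradiction refl g≢h
    ... | yes refl | no _     = ≤-trans (≤-reflexive (trans (cong₂ _+_ (*-identityʳ R) (*-zeroʳ Q)) (+-identityʳ R))) (<⇒≤ R<U)
    ... | no _     | yes refl = ≤-trans (≤-reflexive (cong₂ _+_ (*-zeroʳ R) (*-identityʳ Q))) (<⇒≤ Q<U)
    ... | no _     | no _     = ≤-trans (≤-reflexive (cong₂ _+_ (*-zeroʳ R) (*-zeroʳ Q))) z≤n
    go : Dec (U h ≤ Q) → Dec (U g ≤ R) → U h ≤ Q ⊎ U g ≤ R
    go (yes le) _        = inj₁ le
    go (no _)   (yes le) = inj₂ le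
    go (no h≰)  (no g≰)  = contradiction
      (trans (sym Tg) (minimal T (T≼U (≰⇒> h≰) (≰⇒> g≰)) T-zeroSum (len-positive T g (subst (0 <_) (sym Tg) R-positive)) g))
      (<⇒≢ (≰⇒> g≰))
  atomic : ∀ U → MinimalZeroSum U → Over G0 U → ∃[ N ] (wt W U ≡ n * N × S * N ≈ S mod κ)
  atomic U atom over = N , wt≡ , two-base {U = U} {W} {W′} S i 0<n (λ x 0<Ux → relation (over x 0<Ux)) Si≈S wt≡ wt′≡ (split (few atom))
    where
    normA = A.norm atom over
    normB = B.norm atom over
    N  = proj₁ normA
    N′ = proj₁ normB
    wt≡ = proj₁ (proj₂ normA)
    wt′≡ = proj₁ (proj₂ normB)
    split : U h ≤ Q ⊎ U g ≤ R → N ≡ 1 ⊎ N′ ≡ 1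
    split (inj₁ le) = inj₁ (A.norm≡1-if-few atom over wt≡ (proj₂ (proj₂ normA))
      (≤-trans (*-monoˡ-≤ i le) (subst (Q * i ≤_) (sym n≡Qi+R) (m≤m+n (Q * i) R))))
    split (inj₂ le) = inj₂ (B.norm≡1-if-few atom over wt′≡ (proj₂ (proj₂ normB))
      (≤-trans (*-monoˡ-≤ i′ le) (subst (R * i′ ≤_) (sym n≡Ri′+Q) (m≤m+n (R * i′) Q))))

-- The inclusion of Δ* in the union of the I(m)

-- A constructive search: it either finds one element that yields the goal A or collects B for all
-- of them.
⊎-Fin : ∀ {n} {A : Set} {B : Fin n → Set} → (∀ x → A ⊎ B x) → A ⊎ (∀ x → B x)
⊎-Fin {zero}          f = inj₂ λ ()
⊎-Fin {suc n} {A} {B} f = go (f zero) (⊎-Fin (f ∘ suc))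
  where
  go : A ⊎ B zero → A ⊎ (∀ x → B (suc x)) → A ⊎ (∀ x → B x)
  go (inj₁ a) _        = inj₁ a
  go (inj₂ _) (inj₁ a) = inj₁ a
  go (inj₂ b) (inj₂ bs) = inj₂ λ { zero → b ; (suc x) → bs x }

⊎-Subset : ∀ {n} {G0 : Subset n} {A : Set} {B : Fin n → Set} → (∀ {x} → x ∈ G0 → A ⊎ B x) → A ⊎ (∀ {x} → x ∈ G0 → B x)
⊎-Subset {n} {G0} {A} {B} f = go (⊎-Fin λ x → decide x (x ∈? G0))
  where
  decide : ∀ x → Dec (x ∈ G0) → A ⊎ (x ∈ G0 → B x)
  decide x (yes x∈) = map₂ (λ b _ → b) (f x∈)
  decide x (no x∉)  = inj₂ λ x∈ → contradiction x∈ x∉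
  go : A ⊎ (∀ x → x ∈ G0 → B x) → A ⊎ (∀ {x} → x ∈ G0 → B x)
  go = map₂ λ b {x} → b x

minΔ⇒divisorI : ∀ {n} {G0 : Subset n} {k} → IsMinΔ G0 k → 100 ≤ k → n ≤ 10 * k → 100 ≤ n → InDivisorI n k
minΔ⇒divisorI {n} {G0} {k} isMin 100≤k n≤10k 100≤n =
  fromInj₁ (λ compat → ⊥-elim (not-all-compatible isMin n≤10k (≤-trans (m≤m+n 42 58) 100≤k) (≤-trans z<s 100≤n)
             (λ g∈ h∈ → compat g∈ h∈)))
    (⊎-Subset {B = λ g → ∀ {h} → h ∈ G0 → PairData.i (pairData g h) ≡ 1} λ g∈ → ⊎-Subset λ h∈ → pair g∈ h∈)
  where
  exceptional⇒divisorI : ∀ {g h} → g ∈ G0 → h ∈ G0 → dv g ≡ 1 → dv h ≡ 1 → let p = pairData g h in Exceptional k n (PairData.i p) → InDivisorI n k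
  exceptional⇒divisorI {g} {h} g∈ h∈ dg dh b = conclude
    (⊎-Subset (exceptional-element isMin 100≤k n≤10k 100≤n b g∈ h∈ dg dh h≈))
    (⊎-Subset (exceptional-element isMin 100≤k n≤10k 100≤n sym-exceptional h∈ g∈ dh dg g≈))
    where
    open ExceptionalData b
    h≈ = generators-link dg dh (pairData g h)
    g≈ = inverse-link {x = g} {y = h} {PairData.i (pairData g h)} {i′} {κ} i*i′ h≈
    conclude : InDivisorI n k ⊎ (∀ {x} → x ∈ G0 → x ≡ h ⊎ toℕ x ≈ dv x * toℕ g mod n) →
               InDivisorI n k ⊎ (∀ {x} → x ∈ G0 → x ≡ g ⊎ toℕ x ≈ dv x * toℕ h mod n) → InDivisorI n k
    conclude (inj₁ goal)  _             = goal
    conclude (inj₂ _)     (inj₁ goal)   = goal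
    conclude (inj₂ class) (inj₂ class′) =
      ⊥-elim (exceptional-contradiction isMin 100≤k n≤10k 100≤n b g∈ h∈ dg dh h≈ class class′)
  pair : ∀ {g h} → g ∈ G0 → h ∈ G0 → InDivisorI n k ⊎ PairData.i (pairData g h) ≡ 1
  pair {g} {h} g∈ h∈ = go (pair-structure isMin (≤-trans (m≤m+n 10 90) 100≤k) n≤10k p g∈ h∈)
    where
    p = pairData g h
    open PairData p
    0<T : 0 < T
    0<T = subst (0 <_) r*dv (*-mono-≤ (r-positive p) (dv-positive g))
    factor≡1 : ∀ {a} (x : Fin n) → a * dv x ≡ T → T ≡ 1 → dv x ≡ 1
    factor≡1 {a} x eq T≡1 = m*n≡1⇒n≡1 a (dv x) (trans eq T≡1)
    finish : InDivisorI n k ⊎ (T ≡ 1 × Exceptional k n i) → InDivisorI n k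
    finish (inj₁ goal)      = goal
    finish (inj₂ (T≡1 , b)) = exceptional⇒divisorI g∈ h∈ (factor≡1 {r} g r*dv T≡1) (factor≡1 {s} h s*dv T≡1) b
    go : i ≡ 1 ⊎ Incompatible k M i → InDivisorI n k ⊎ i ≡ 1
    go (inj₁ i≡1) = inj₂ i≡1
    go (inj₂ inc) = inj₁ (finish (incompatible-cases (≤-trans z<s 100≤k) 0<T T*M n≤10k inc))

-- Atoms over three elements

module Triple {n} {f y h : Fin n} (f≢y : f ≢ y) (f≢h : f ≢ h) (y≢h : y ≢ h) where

  triple : ℕ → ℕ → ℕ → Seq n
  triple a b c = a ⊛ δ f · (b ⊛ δ y · c ⊛ δ h)

  Supported : Seq n → Set
  Supported U = ∀ x → 0 < U x → x ≡ f ⊎ x ≡ y ⊎ x ≡ h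

  triple-f : ∀ a b c → triple a b c f ≡ a
  triple-f a b c = trans (cong₂ _+_ (⊛δ-same a f) (cong₂ _+_ (⊛δ-diff b (f≢y ∘ sym)) (⊛δ-diff c (f≢h ∘ sym)))) (+-identityʳ a)

  triple-y : ∀ a b c → triple a b c y ≡ b
  triple-y a b c = trans (cong₂ _+_ (⊛δ-diff a f≢y) (cong₂ _+_ (⊛δ-same b y) (⊛δ-diff c (y≢h ∘ sym)))) (+-identityʳ b)

  triple-h : ∀ a b c → triple a b c h ≡ c
  triple-h a b c = cong₂ _+_ (⊛δ-diff a f≢h) (cong₂ _+_ (⊛δ-diff b y≢h) (⊛δ-same c h))

  triple-other : ∀ a b c {x} → f ≢ x → y ≢ x → h ≢ x → triple a b c x ≡ 0
  triple-other a b c f≢x y≢x h≢x = cong₂ _+_ (⊛δ-diff a f≢x) (cong₂ _+_ (⊛δ-diff b y≢x) (⊛δ-diff c h≢x))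

  wt-triple : ∀ V a b c → wt V (triple a b c) ≡ a * V f + (b * V y + c * V h)
  wt-triple V a b c = trans (wt-· V (a ⊛ δ f) _) (cong₂ _+_ (wt-⊛δ V a f) (wt-pair V b y c h))

  triple-elim : ∀ {P : Fin n → Set} → P f → P y → P h → (∀ {x} → f ≢ x → y ≢ x → h ≢ x → P x) → ∀ x → P x
  triple-elim Pf Py Ph Pother x with f ≟ x | y ≟ x | h ≟ x
  ... | yes refl | _        | _        = Pf
  ... | no _     | yes refl | _        = Py
  ... | no _     | no _     | yes refl = Ph
  ... | no f≢x   | no y≢x   | no h≢x   = Pother f≢x y≢x h≢x

  supported-triple : ∀ {U} → Supported U → ∀ x → U x ≡ triple (U f) (U y) (U h) x
  supported-triple {U} supp = triple-elim (sym (triple-f (U f) (U y) (U h))) (sym (triple-y (U f) (U y) (U h)))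
    (sym (triple-h (U f) (U y) (U h))) λ f≢x y≢x h≢x → trans (outside f≢x y≢x h≢x) (sym (triple-other (U f) (U y) (U h) f≢x y≢x h≢x))
    where
    outside : ∀ {x} → f ≢ x → y ≢ x → h ≢ x → U x ≡ 0
    outside {x} f≢x y≢x h≢x = n≤0⇒n≡0 (≮⇒≥ λ 0<Ux → go (supp x 0<Ux))
      where
      go : x ≡ f ⊎ x ≡ y ⊎ x ≡ h → ⊥
      go (inj₁ eq)        = f≢x (sym eq)
      go (inj₂ (inj₁ eq)) = y≢x (sym eq)
      go (inj₂ (inj₂ eq)) = h≢x (sym eq)

  triple-≼ : ∀ {U : Seq n} {a b c} → a ≤ U f → b ≤ U y → c ≤ U h → triple a b c ≼ U
  triple-≼ {U} {a} {b} {c} a≤ b≤ c≤ = triple-elim (subst (_≤ U f) (sym (triple-f a b c)) a≤)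
    (subst (_≤ U y) (sym (triple-y a b c)) b≤) (subst (_≤ U h) (sym (triple-h a b c)) c≤)
    λ {x} f≢x y≢x h≢x → subst (_≤ U x) (sym (triple-other a b c f≢x y≢x h≢x)) z≤n

  wt-supported : ∀ {U} → Supported U → ∀ V → wt V U ≡ U f * V f + (U y * V y + U h * V h)
  wt-supported {U} supp V = trans (wt-cong V (supported-triple supp)) (wt-triple V (U f) (U y) (U h))

  module Atoms {m I d} (0<m : 0 < m) (0<I : 0 < I) (ordF : IsOrder f m) (y≈ : toℕ y ≈ I * toℕ f mod n) (h≈ : toℕ h ≈ d * toℕ f mod n)
    (d∣m : d ∣ m) where

    weight : ℕ → ℕ → ℕ → ℕ
    weight a b c = a + b * I + c * d

    value : ∀ a b c → a * toℕ f + (b * toℕ y + c * toℕ h) ≈ weight a b c * toℕ f mod n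
    value a b c = ≈-trans (≈-+ (≈-refl {x = a * toℕ f}) (≈-+ (≈-*ˡ b y≈) (≈-*ˡ c h≈))) (≈-reflexive (lemma a b c I d (toℕ f)))
      where
      lemma : ∀ a b c I d f → a * f + (b * (I * f) + c * (d * f)) ≡ (a + b * I + c * d) * f
      lemma = solve-∀

    -- A part of weight m is a nonempty zero-sum sequence, so by minimality it is all of U.
    exact-weight : ∀ {U} → MinimalZeroSum U → ∀ {a b c} → a ≤ U f → b ≤ U y → c ≤ U h →
                   weight a b c ≡ m → weight (U f) (U y) (U h) ≡ m
    exact-weight {U} (_ , _ , minimal) {a} {b} {c} a≤ b≤ c≤ weight≡ =
      trans (sym (cong₂ _+_ (cong₂ (λ a b → a + b * I) (trans (sym (triple-f a b c)) (U≡ f)) (trans (sym (triple-y a b c)) (U≡ y)))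
        (cong (_* d) (trans (sym (triple-h a b c)) (U≡ h))))) weight≡
      where
      T : Seq n
      T = triple a b c
      T-weight : n ∣ wt toℕ T
      T-weight = subst (n ∣_) (sym (wt-triple toℕ a b c)) (∣-resp-≈ (≈-sym (value a b c))
        (order-∣ ordF (∣-reflexive (sym weight≡))))
      nonempty : 0 < len T
      nonempty = n≢0⇒n>0 λ len≡0 → n>0⇒n≢0 0<m (trans (sym weight≡)
        (cong₂ _+_ (cong₂ (λ a b → a + b * I) (zero-at f (triple-f a b c) len≡0) (zero-at y (triple-y a b c) len≡0))
          (cong (_* d) (zero-at h (triple-h a b c) len≡0))))
        where
        zero-at : ∀ x {t} → T x ≡ t → len T ≡ 0 → t ≡ 0
        zero-at x Tx len≡0 = n≤0⇒n≡0 (≮⇒≥ λ 0<t → n>0⇒n≢0 (len-positive T x (subst (0 <_) (sym Tx) 0<t)) len≡0)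
      U≡ : ∀ x → T x ≡ U x
      U≡ = minimal T (triple-≼ {U = U} a≤ b≤ c≤) (∣wt⇒zeroSum T T-weight) nonempty

    -- With f^a y^b of value s < m, d ∣ m gives d ∣ s, so that copies of h fill the gap m − s exactly.
    few-weight : ∀ {U} → MinimalZeroSum U → Supported U → U y * I < m → weight (U f) (U y) (U h) ≡ m
    few-weight {U} atom supp few = go (s <? m)
      where
      s total : ℕ
      s = U f + U y * I
      total = s + U h * d
      m∣total : m ∣ total
      m∣total = order-divides ordF (∣-resp-≈ (value (U f) (U y) (U h))
        (subst (n ∣_) (wt-supported supp toℕ) (zeroSum⇒∣wt U (proj₁ (proj₂ atom)))))
      instance
        m-nonZero : NonZero m
        m-nonZero = >-nonZero 0<m
        d-nonZero : NonZero d
        d-nonZero = ≢-nonZero λ { refl → n>0⇒n≢0 0<m (0∣⇒≡0 d∣m) }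
      0<total : 0 < total
      0<total = positive (supp x₀ 0<Ux₀) 0<Ux₀
        where
        x₀ = proj₁ (len-positive⇒nonempty U (proj₁ atom))
        0<Ux₀ = proj₂ (len-positive⇒nonempty U (proj₁ atom))
        positive : ∀ {x} → x ≡ f ⊎ x ≡ y ⊎ x ≡ h → 0 < U x → 0 < total
        positive (inj₁ refl)        0<Ux = ≤-trans 0<Ux (≤-trans (m≤m+n (U f) (U y * I)) (m≤m+n s (U h * d)))
        positive (inj₂ (inj₁ refl)) 0<Ux = ≤-trans (*-mono-≤ 0<Ux 0<I) (≤-trans (m≤n+m (U y * I) (U f)) (m≤m+n s (U h * d)))
        positive (inj₂ (inj₂ refl)) 0<Ux = ≤-trans 0<Ux (≤-trans (m≤m*n (U h) d) (m≤n+m (U h * d) s))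
      go : Dec (s < m) → weight (U f) (U y) (U h) ≡ m
      -- There are enough copies of f to fill the weight of the copies of y up to exactly m.
      go (no s≮m) = exact-weight {U} atom {m ∸ U y * I} {U y} {0}
        (m≤n+o⇒m∸n≤o m (U y * I) (subst (m ≤_) (+-comm (U f) (U y * I)) (≮⇒≥ s≮m))) ≤-refl z≤n
        (trans (+-identityʳ _) (m∸n+n≡m (<⇒≤ few)))
      go (yes s<m) = exact-weight {U} atom {U f} {U y} {z} ≤-refl ≤-refl z≤ (trans (cong (s +_) (sym z*d)) (m+[n∸m]≡n (<⇒≤ s<m)))
        where
        d∣s : d ∣ s
        d∣s = ∣m+n∣m⇒∣n (subst (d ∣_) (+-comm s (U h * d)) (∣-trans d∣m m∣total)) (n∣m*n (U h))
        d∣gap : d ∣ m ∸ s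
        d∣gap = ∣m+n∣m⇒∣n (subst (d ∣_) (sym (m+[n∸m]≡n (<⇒≤ s<m))) d∣m) d∣s
        z = quotient d∣gap
        z*d : m ∸ s ≡ z * d
        z*d = _∣_.equality d∣gap
        z≤ : z ≤ U h
        z≤ = *-cancelʳ-≤ z (U h) d (subst (_≤ U h * d) z*d (m≤n+o⇒m∸n≤o m s (∣⇒≤ {{>-nonZero 0<total}} m∣total)))

-- Differences of lengths

-- The two lengths need not be adjacent; this is what makes these numbers closed under multiples and
-- subtraction, hence under gcd.
Difference : ∀ {n} → Subset n → ℕ → Set
Difference G0 x = ∃[ B ] (InB G0 B × ∃[ l ] (InL B l × InL B (l + x)))

difference-⊛ : ∀ {n} {G0 : Subset n} {x} c → Difference G0 x → Difference G0 (c * x)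
difference-⊛ {x = x} c (B , inB , l , Ll , Lx) = c ⊛ B , InB-⊛ c inB , c * l , InL-⊛ c Ll ,
  subst (InL (c ⊛ B)) (*-distribˡ-+ c l x) (InL-⊛ c Lx)

-- In B · B′ the long factorization of one factor is paired with the short one of the other, so the
-- gaps y + x and y subtract.
difference-∸ : ∀ {n} {G0 : Subset n} {x y} → Difference G0 (y + x) → Difference G0 y → Difference G0 x
difference-∸ {x = x} {y} (B , inB , l , Ll , Lyx) (B′ , inB′ , l′ , Ll′ , Ly) =
  B · B′ , InB-· inB inB′ , l + (l′ + y) , InL-· Ll Ly , subst (InL (B · B′)) (lemma l y x l′) (InL-· Lyx Ll′)
  where
  lemma : ∀ l y x l′ → l + (y + x) + l′ ≡ l + (l′ + y) + x
  lemma = solve-∀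

difference-gcd : ∀ {n} {G0 : Subset n} {a b} → Difference G0 a → Difference G0 b → Difference G0 (gcd a b)
difference-gcd {n} {G0} {a} {b} Da Db = go (Bézout.identity (gcd-GCD a b))
  where
  go : Bézout.Identity (gcd a b) a b → Difference G0 (gcd a b)
  go (Bézout.+- x y eq) = difference-∸ (subst (Difference G0) (trans (sym eq) (+-comm (gcd a b) (y * b))) (difference-⊛ x Da)) (difference-⊛ y Db)
  go (Bézout.-+ x y eq) = difference-∸ (subst (Difference G0) (trans (sym eq) (+-comm (gcd a b) (x * a))) (difference-⊛ y Db)) (difference-⊛ x Da)

base-difference : ∀ {n} {G0 : Subset n} {f o} {W U : Fin n → ℕ} → f ∈ G0 → IsOrder f o → MinimalZeroSum U → Over G0 U →
  (∀ x → 0 < W x × W x ≤ o) → (∀ x → 0 < U x → toℕ x ≈ W x * toℕ f mod n) →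
  ∀ x → wt W U ≡ (1 + x) * o → Difference G0 x
base-difference {f = f} {o} {W} {U} f∈ ordF atom over range eq x total =
  1 ⊛ U · ∑ U ⊛ o ⊛ δ f , InB-· (InB-⊛ 1 (atom-inB {U = U} atom over)) (InB-⊛ (∑ U) (inB-⊛δ f∈ ordF)) , 1 + ∑ U ,
  proj₁ lengths , subst (InL _) (lemma x (∑ U)) (proj₂ lengths)
  where
  lengths = base-lengths {W = W} ordF atom range eq (1 + x) total
  lemma : ∀ x s → 1 + x + s ≡ 1 + s + x
  lemma = solve-∀

-- The congruence leaves no length strictly between l and l + k, and it makes every gap a multiple
-- of k.
difference⇒minΔ : ∀ {n} {G0 : Subset n} {k} → 0 < k → Difference G0 k →
  (∀ {B l l′} → Over G0 B → InL B l → InL B l′ → l ≈ l′ mod k) → IsMinΔ G0 k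
difference⇒minΔ {n} {G0} {k} 0<k (B , inB , l , Ll , Lk) lengths-≈ =
  (B , inB , 0<k , l , Ll , Lk , gap) ,
  λ e (B′ , inB′ , 0<e , l′ , Ll′ , Le , _) →
    ∣⇒≤ {{>-nonZero 0<e}} (≈⇒∣diff (lengths-≈ (proj₁ inB′) Ll′ Le))
  where
  gap : ∀ j → l < j → j < l + k → ¬ InL B j
  gap j l<j j<l+k Lj = n>0⇒n≢0 (m<n⇒0<n∸m l<j) (∣∧<⇒≡0
    (≈⇒∣diff (subst (λ t → l ≈ t mod k) (sym l+t) (lengths-≈ (proj₁ inB) Ll Lj)))
    (+-cancelˡ-< l (j ∸ l) k (subst (_< l + k) (sym l+t) j<l+k)))
    where
    l+t : l + (j ∸ l) ≡ j
    l+t = m+[n∸m]≡n (<⇒≤ l<j)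

-- The set realizing an element of I(m)

module Construction {n m u c₁ c₂ d a b k : ℕ} (0<n : 0 < n) (n≡ : n ≡ u * m)
  (0<c₁ : 0 < c₁) (0<c₂ : 0 < c₂) (0<a : 0 < a) (0<b : 0 < b) (d∣m : d ∣ m)
  (m≡ : m ≡ c₁ + c₂ + a * (c₁ * c₂)) (b≡ : b * m ≡ c₁ * a * d) (k≡ : k ≡ gcd a b) where

  private
    i i′ : ℕ
    i  = 1 + c₂ * a
    i′ = 1 + c₁ * a

  k∣a : k ∣ a
  k∣a = subst (_∣ a) (sym k≡) (gcd[m,n]∣m a b)

  k∣b : k ∣ b
  k∣b = subst (_∣ b) (sym k≡) (gcd[m,n]∣n a b)

  0<k : 0 < k
  0<k = n≢0⇒n>0 λ eq → n>0⇒n≢0 0<a (0∣⇒≡0 (subst (_∣ a) eq k∣a))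

  m≡c₁i+c₂ : m ≡ c₁ * i + c₂
  m≡c₁i+c₂ = trans m≡ (lemma c₁ c₂ a)
    where
    lemma : ∀ c₁ c₂ a → c₁ + c₂ + a * (c₁ * c₂) ≡ c₁ * (1 + c₂ * a) + c₂
    lemma = solve-∀

  m≡c₂i′+c₁ : m ≡ c₂ * i′ + c₁
  m≡c₂i′+c₁ = trans m≡ (lemma c₁ c₂ a)
    where
    lemma : ∀ c₁ c₂ a → c₁ + c₂ + a * (c₁ * c₂) ≡ c₂ * (1 + c₁ * a) + c₁
    lemma = solve-∀

  i*i′ : i * i′ ≡ 1 + a * m
  i*i′ = trans (lemma c₁ c₂ a) (cong (λ t → 1 + a * t) (sym m≡))
    where
    lemma : ∀ c₁ c₂ a → (1 + c₂ * a) * (1 + c₁ * a) ≡ 1 + a * (c₁ + c₂ + a * (c₁ * c₂))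
    lemma = solve-∀

  i<m : i < m
  i<m = subst (i <_) (sym m≡c₁i+c₂) (≤-<-trans (m≤n*m i c₁ {{>-nonZero 0<c₁}}) (m<m+n (c₁ * i) 0<c₂))

  i′<m : i′ < m
  i′<m = subst (i′ <_) (sym m≡c₂i′+c₁) (≤-<-trans (m≤n*m i′ c₂ {{>-nonZero 0<c₂}}) (m<m+n (c₂ * i′) 0<c₁))

  0<m : 0 < m
  0<m = ≤-trans z<s i<m

  1<m : 1 < m
  1<m = ≤-<-trans (s≤s z≤n) i<m

  0<d : 0 < d
  0<d = n≢0⇒n>0 λ { refl → n>0⇒n≢0 0<m (0∣⇒≡0 d∣m) }

  d≤m : d ≤ m
  d≤m = ∣⇒≤ {{>-nonZero 0<m}} d∣m

  0<u : 0 < u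
  0<u = n≢0⇒n>0 λ eq → n>0⇒n≢0 0<n (trans n≡ (cong (_* m) eq))

  instance
    u-nonZero : NonZero u
    u-nonZero = >-nonZero 0<u
    n-nonZero : NonZero n
    n-nonZero = >-nonZero 0<n

  multiple<n : ∀ {c} → c < m → c * u < n
  multiple<n {c} c<m = subst (c * u <_) (trans (*-comm m u) (sym n≡)) (*-monoˡ-< u c<m)

  e g h : Fin n
  e = fromℕ< (multiple<n 1<m)
  g = fromℕ< (multiple<n i<m)
  -- d = m is possible, and then h = 0; hence the reduction modulo n.
  h = fromℕ< (m%n<n (d * u) n)

  toℕ-e : toℕ e ≡ u
  toℕ-e = trans (toℕ-fromℕ< (multiple<n 1<m)) (*-identityˡ u)

  toℕ-g : toℕ g ≡ i * u
  toℕ-g = toℕ-fromℕ< (multiple<n i<m)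

  scale-≈ : ∀ {x y} → x ≈ y mod m → x * u ≈ y * u mod n
  scale-≈ {x} {y} x≈y = subst (λ t → x * u ≈ y * u mod t) (sym n≡) (subst₂ (λ s t → s ≈ t mod (u * m)) (*-comm u x) (*-comm u y) (≈-scale u x≈y))

  unscale-≈ : ∀ {x y} → x * u ≈ y * u mod n → x ≈ y mod m
  unscale-≈ {x} {y} e = ≈-unscale u 0<u (subst₂ (λ s t → s ≈ t mod (u * m)) (*-comm x u) (*-comm y u) (subst (λ t → x * u ≈ y * u mod t) n≡ e))

  h≈du : toℕ h ≈ d * u mod n
  h≈du = by (d * u / n) 0 (trans (cong (_+ d * u / n * n) (toℕ-fromℕ< (m%n<n (d * u) n)))
    (trans (sym (m≡m%n+[m/n]*n (d * u) n)) (sym (+-identityʳ (d * u)))))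

  h≈e : toℕ h ≈ d * toℕ e mod n
  h≈e = subst (λ t → toℕ h ≈ d * t mod n) (sym toℕ-e) h≈du

  g≈e : toℕ g ≈ i * toℕ e mod n
  g≈e = ≈-reflexive (trans toℕ-g (cong (i *_) (sym toℕ-e)))

  i′g≈ : i′ * toℕ g ≈ u mod n
  i′g≈ = subst₂ (λ s t → s ≈ t mod n) (trans (*-assoc i′ i u) (cong (i′ *_) (sym toℕ-g))) (*-identityˡ u)
    (scale-≈ (subst (λ t → t ≈ 1 mod m) (trans (sym i*i′) (*-comm i i′)) (∣⇒≈ (n∣m*n a))))

  e≈g : toℕ e ≈ i′ * toℕ g mod n
  e≈g = ≈-trans (≈-reflexive toℕ-e) (≈-sym i′g≈)

  -- This writes i d - d = a d c₂ as m (d a - b - c₂ a b). As k divides a and b, it gives i d ≡ d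
  -- modulo m k, and in particular d g = d e.
  split : (b + c₂ * a * b) * m + a * d * c₂ ≡ d * a * m
  split = begin
    (b + c₂ * a * b) * m + a * d * c₂                 ≡⟨ lemma₁ b c₂ a m d ⟩
    b * m + c₂ * a * (b * m) + a * d * c₂             ≡⟨ cong (λ t → t + c₂ * a * t + a * d * c₂) b≡ ⟩
    c₁ * a * d + c₂ * a * (c₁ * a * d) + a * d * c₂   ≡⟨ lemma₂ c₁ c₂ a d ⟩
    d * a * (c₁ + c₂ + a * (c₁ * c₂))                 ≡⟨ cong (d * a *_) m≡ ⟨
    d * a * m                                         ∎
    where
    open ≡-Reasoning
    lemma₁ : ∀ b c₂ a m d → (b + c₂ * a * b) * m + a * d * c₂ ≡ b * m + c₂ * a * (b * m) + a * d * c₂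
    lemma₁ = solve-∀
    lemma₂ : ∀ c₁ c₂ a d → c₁ * a * d + c₂ * a * (c₁ * a * d) + a * d * c₂ ≡ d * a * (c₁ + c₂ + a * (c₁ * c₂))
    lemma₂ = solve-∀

  m*k∣adc₂ : m * k ∣ a * d * c₂
  m*k∣adc₂ = ∣m+n∣m⇒∣n (subst (m * k ∣_) (trans (*-comm m (d * a)) (sym split)) (*-monoʳ-∣ m (∣n⇒∣m*n d k∣a)))
    (subst (m * k ∣_) (*-comm m _) (*-monoʳ-∣ m (∣m∣n⇒∣m+n k∣b (∣n⇒∣m*n (c₂ * a) k∣b))))

  id≡ : i * d ≡ d + a * d * c₂
  id≡ = lemma c₂ a d
    where
    lemma : ∀ c₂ a d → (1 + c₂ * a) * d ≡ d + a * d * c₂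
    lemma = solve-∀

  id≈d : i * d ≈ d mod (m * k)
  id≈d = subst (λ t → t ≈ d mod (m * k)) (sym id≡) (∣⇒≈ m*k∣adc₂)

  h≈g : toℕ h ≈ d * toℕ g mod n
  h≈g = ≈-trans h≈du (≈-sym (subst (λ t → t ≈ d * u mod n)
    (trans (cong (_* u) (*-comm i d)) (trans (*-assoc d i u) (cong (d *_) (sym toℕ-g))))
    (scale-≈ (≈-mono-∣ (m∣m*n k) id≈d))))

  n∣m*u : n ∣ m * u
  n∣m*u = ∣-reflexive (trans n≡ (*-comm u m))

  ord-e : IsOrder e m
  ord-e = record
    { order-positive = 0<m
    ; order-zero     = subst (λ t → n ∣ m * t) (sym toℕ-e) n∣m*u
    ; order-divides  = λ {y} n∣ → *-cancelˡ-∣ u (subst₂ _∣_ n≡ (trans (cong (y *_) toℕ-e) (*-comm y u)) n∣) }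

  ord-g : IsOrder g m
  ord-g = record
    { order-positive = 0<m
    ; order-zero     = subst (λ t → n ∣ m * t) (sym toℕ-g) (subst (n ∣_) (lemma i m u) (∣n⇒∣m*n i n∣m*u))
    ; order-divides  = λ {y} n∣ → order-divides ord-e (∣-resp-≈ (≈-sym (≈-*ˡ y e≈g))
        (subst (n ∣_) (lemma i′ y (toℕ g)) (∣n⇒∣m*n i′ n∣))) }
    where
    lemma : ∀ i m u → i * (m * u) ≡ m * (i * u)
    lemma = solve-∀

  -- For d = 1 the equation for b reads b m = c₁ a, but c₁ a < i′ < m ≤ b m.
  d≢1 : d ≢ 1
  d≢1 d≡1 = <⇒≢ small (sym (trans b≡ (trans (cong (c₁ * a *_) d≡1) (*-identityʳ _))))
    where
    small : c₁ * a < b * m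
    small = <-≤-trans (<-trans (n<1+n (c₁ * a)) i′<m) (m≤n*m m b {{>-nonZero 0<b}})

  -- For d = i it gives b m + a c₂ = a (c₁ i + c₂) = a m, so m ∣ a c₂, although 0 < a c₂ = i - 1 <
  -- m.
  d≢i : d ≢ i
  d≢i d≡i = n>0⇒n≢0 (*-mono-≤ 0<a 0<c₂) (∣∧<⇒≡0 m∣ac₂ (≤-<-trans (≤-reflexive (*-comm a c₂)) (<-trans (n<1+n (c₂ * a)) i<m)))
    where
    lemma : ∀ c a i c₂ → c * a * i + a * c₂ ≡ a * (c * i + c₂)
    lemma = solve-∀
    m∣ac₂ : m ∣ a * c₂
    m∣ac₂ = ∣m+n∣m⇒∣n {m = b * m} (divides a (trans (cong (_+ a * c₂) (trans b≡ (cong (c₁ * a *_) d≡i)))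
      (trans (lemma c₁ a i c₂) (cong (a *_) (sym m≡c₁i+c₂))))) (n∣m*n b)

  e≢g : e ≢ g
  e≢g e≡g = n>0⇒n≢0 (*-mono-≤ 0<c₂ 0<a) (sym (suc-injective (*-cancelʳ-≡ 1 i u (trans (*-identityˡ u)
    (trans (sym toℕ-e) (trans (cong toℕ e≡g) toℕ-g))))))

  multiple-of-e : ∀ {c} → 0 < c → c ≤ m → toℕ h ≈ c * u mod n → d ≡ c
  multiple-of-e 0<c c≤m h≈ = ≈∧range⇒≡ 0<d d≤m 0<c c≤m (unscale-≈ (≈-trans (≈-sym h≈du) h≈))

  e≢h : e ≢ h
  e≢h e≡h = d≢1 (multiple-of-e z<s (<⇒≤ 1<m) (≈-reflexive (trans (cong toℕ (sym e≡h)) (trans toℕ-e (sym (*-identityˡ u))))))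

  g≢h : g ≢ h
  g≢h g≡h = d≢i (multiple-of-e z<s (<⇒≤ i<m) (≈-reflexive (trans (cong toℕ (sym g≡h)) toℕ-g)))

  G0 : Subset n
  G0 = ⁅ e ⁆ ∪ (⁅ g ⁆ ∪ ⁅ h ⁆)

  e∈ : e ∈ G0
  e∈ = x∈p∪q⁺ (inj₁ (x∈⁅x⁆ e))

  g∈ : g ∈ G0
  g∈ = x∈p∪q⁺ {p = ⁅ e ⁆} (inj₂ (x∈p∪q⁺ (inj₁ (x∈⁅x⁆ g))))

  h∈ : h ∈ G0
  h∈ = x∈p∪q⁺ {p = ⁅ e ⁆} (inj₂ (x∈p∪q⁺ {p = ⁅ g ⁆} (inj₂ (x∈⁅x⁆ h))))

  member : ∀ {x} → x ∈ G0 → x ≡ e ⊎ x ≡ g ⊎ x ≡ h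
  member x∈ = Sum.map (x∈⁅y⁆⇒x≡y e) (λ x∈′ → Sum.map (x∈⁅y⁆⇒x≡y g) (x∈⁅y⁆⇒x≡y h) (x∈p∪q⁻ ⁅ g ⁆ ⁅ h ⁆ x∈′))
    (x∈p∪q⁻ ⁅ e ⁆ (⁅ g ⁆ ∪ ⁅ h ⁆) x∈)

  W W′ : Fin n → ℕ
  W x  = pick g i (pick h d 1 x) x
  W′ x = pick e i′ (pick h d 1 x) x

  W-e : W e ≡ 1
  W-e = trans (pick-diff _ _ (e≢g ∘ sym)) (pick-diff _ _ (e≢h ∘ sym))
  W-g : W g ≡ i
  W-g = pick-same g _ _
  W-h : W h ≡ d
  W-h = trans (pick-diff _ _ g≢h) (pick-same h _ _)
  W′-e : W′ e ≡ i′
  W′-e = pick-same e _ _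
  W′-g : W′ g ≡ 1
  W′-g = trans (pick-diff _ _ e≢g) (pick-diff _ _ (g≢h ∘ sym))
  W′-h : W′ h ≡ d
  W′-h = trans (pick-diff _ _ e≢h) (pick-same h _ _)

  pick-range : ∀ (y : Fin n) {s t} → 0 < s × s ≤ m → 0 < t × t ≤ m → ∀ x → 0 < pick y s t x × pick y s t x ≤ m
  pick-range y s∈ t∈ x with y ≟ x
  ... | yes _ = s∈
  ... | no _  = t∈

  W′-range : ∀ x → 0 < W′ x × W′ x ≤ m
  W′-range x = pick-range e (z<s , <⇒≤ i′<m) (pick-range h (0<d , d≤m) (z<s , 0<m) x) x

  value : ∀ {x} → x ∈ G0 → toℕ x ≈ W x * toℕ e mod n
  value x∈ = go (member x∈)
    where
    go : ∀ {x} → x ≡ e ⊎ x ≡ g ⊎ x ≡ h → toℕ x ≈ W x * toℕ e mod n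
    go (inj₁ refl)        = ≈-reflexive (sym (trans (cong (_* toℕ e) W-e) (*-identityˡ _)))
    go (inj₂ (inj₁ refl)) = subst (λ w → toℕ g ≈ w * toℕ e mod n) (sym W-g) g≈e
    go (inj₂ (inj₂ refl)) = subst (λ w → toℕ h ≈ w * toℕ e mod n) (sym W-h) h≈e

  value′ : ∀ {x} → x ∈ G0 → toℕ x ≈ W′ x * toℕ g mod n
  value′ x∈ = go (member x∈)
    where
    go : ∀ {x} → x ≡ e ⊎ x ≡ g ⊎ x ≡ h → toℕ x ≈ W′ x * toℕ g mod n
    go (inj₁ refl)        = subst (λ w → toℕ e ≈ w * toℕ g mod n) (sym W′-e) e≈g
    go (inj₂ (inj₁ refl)) = ≈-reflexive (sym (trans (cong (_* toℕ g) W′-g) (*-identityˡ _)))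
    go (inj₂ (inj₂ refl)) = subst (λ w → toℕ h ≈ w * toℕ g mod n) (sym W′-h) h≈g

  relation : ∀ {x} → x ∈ G0 → 1 * (i * W′ x) ≈ 1 * W x mod (m * k)
  relation x∈ = go (member x∈)
    where
    unit : ∀ {s t M} → s ≈ t mod M → 1 * s ≈ 1 * t mod M
    unit {s} {t} {M} = subst₂ (λ s t → s ≈ t mod M) (sym (*-identityˡ s)) (sym (*-identityˡ t))
    go : ∀ {x} → x ≡ e ⊎ x ≡ g ⊎ x ≡ h → 1 * (i * W′ x) ≈ 1 * W x mod (m * k)
    go (inj₁ refl) = unit (subst₂ (λ s t → s ≈ t mod (m * k)) (sym (trans (cong (i *_) W′-e) i*i′)) (sym W-e)
      (∣⇒≈ (subst (m * k ∣_) (*-comm m a) (*-monoʳ-∣ m k∣a))))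
    go (inj₂ (inj₁ refl)) = unit (≈-reflexive (trans (cong (i *_) W′-g) (trans (*-identityʳ i) (sym W-g))))
    go (inj₂ (inj₂ refl)) = unit (subst₂ (λ s t → s ≈ t mod (m * k)) (cong (i *_) (sym W′-h)) (sym W-h) id≈d)

  module E = Triple e≢g e≢h g≢h
  module EA = E.Atoms {m} {i} {d} 0<m z<s ord-e g≈e h≈e d∣m
  module G = Triple (e≢g ∘ sym) g≢h e≢h
  module GA = G.Atoms {m} {i′} {d} 0<m z<s ord-g e≈g h≈g d∣m

  -- An atom containing g^c₁ e^c₂ is equal to it; any other one has few copies of g or few copies of e.
  atom-weight : ∀ {U} → MinimalZeroSum U → Over G0 U → wt W U ≡ m ⊎ wt W′ U ≡ m
  atom-weight {U} atom over = go (c₁ ≤? U g) (c₂ ≤? U e)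
    where
    supp : E.Supported U
    supp x 0<Ux = member (over x 0<Ux)
    supp′ : G.Supported U
    supp′ x 0<Ux = reorder (member (over x 0<Ux))
      where
      reorder : x ≡ e ⊎ x ≡ g ⊎ x ≡ h → x ≡ g ⊎ x ≡ e ⊎ x ≡ h
      reorder (inj₁ eq)        = inj₂ (inj₁ eq)
      reorder (inj₂ (inj₁ eq)) = inj₁ eq
      reorder (inj₂ (inj₂ eq)) = inj₂ (inj₂ eq)
    lemma : ∀ x y i z d → x * 1 + (y * i + z * d) ≡ x + y * i + z * d
    lemma = solve-∀
    by-e : EA.weight (U e) (U g) (U h) ≡ m → wt W U ≡ m
    by-e eq = trans (E.wt-supported supp W) (trans (cong₂ _+_ (cong (U e *_) W-e) (cong₂ (λ s t → U g * s + U h * t) W-g W-h))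
      (trans (lemma (U e) (U g) i (U h) d) eq))
    by-g : GA.weight (U g) (U e) (U h) ≡ m → wt W′ U ≡ m
    by-g eq = trans (G.wt-supported supp′ W′) (trans (cong₂ _+_ (cong (U g *_) W′-g) (cong₂ (λ s t → U e * s + U h * t) W′-e W′-h))
      (trans (lemma (U g) (U e) i′ (U h) d) eq))
    go : Dec (c₁ ≤ U g) → Dec (c₂ ≤ U e) → wt W U ≡ m ⊎ wt W′ U ≡ m
    go (no c₁≰) _ = inj₁ (by-e (EA.few-weight {U} atom supp (≤-<-trans (*-monoˡ-≤ i (<⇒≤ (≰⇒> c₁≰)))
      (subst (c₁ * i <_) (sym m≡c₁i+c₂) (m<m+n (c₁ * i) 0<c₂)))))
    go _ (no c₂≰) = inj₂ (by-g (GA.few-weight {U} atom supp′ (≤-<-trans (*-monoˡ-≤ i′ (<⇒≤ (≰⇒> c₂≰)))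
      (subst (c₂ * i′ <_) (sym m≡c₂i′+c₁) (m<m+n (c₂ * i′) 0<c₁)))))
    go (yes c₁≤) (yes c₂≤) = inj₁ (by-e (EA.exact-weight {U} atom {c₂} {c₁} {0} c₂≤ c₁≤ z≤n
      (trans (+-identityʳ _) (trans (+-comm c₂ (c₁ * i)) (sym m≡c₁i+c₂)))))

  lengths-≈ : ∀ {B l l′} → Over G0 B → InL B l → InL B l′ → l ≈ l′ mod k
  lengths-≈ {B} {l} {l′} over Ll Ll′ = subst₂ (λ s t → s ≈ t mod k) (*-identityˡ l) (*-identityˡ l′)
    (length-functional W 1 0<m atomic over Ll Ll′)
    where
    atomic : ∀ U → MinimalZeroSum U → Over G0 U → ∃[ N ] (wt W U ≡ m * N × 1 * N ≈ 1 mod k)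
    atomic U atom over = N , wt≡ , two-base {U = U} {W} {W′} 1 i 0<m (λ x 0<Ux → relation (over x 0<Ux))
      (subst (λ t → t ≈ 1 mod k) (sym (*-identityˡ i)) (∣⇒≈ (∣n⇒∣m*n c₂ k∣a))) wt≡ wt′≡
      (Sum.map (norm wt≡) (norm wt′≡) (atom-weight atom over))
      where
      m∣wt = base-norm {W = W} {U = U} ord-e (λ x 0<Ux → value (over x 0<Ux)) (proj₁ (proj₂ atom))
      m∣wt′ = base-norm {W = W′} {U = U} ord-g (λ x 0<Ux → value′ (over x 0<Ux)) (proj₁ (proj₂ atom))
      N = quotient m∣wt
      N′ = quotient m∣wt′
      wt≡ : wt W U ≡ m * N
      wt≡ = trans (_∣_.equality m∣wt) (*-comm N m)
      wt′≡ : wt W′ U ≡ m * N′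
      wt′≡ = trans (_∣_.equality m∣wt′) (*-comm N′ m)
      norm : ∀ {w N} → w ≡ m * N → w ≡ m → N ≡ 1
      norm {w} {N} w≡ w≡m = *-cancelˡ-≡ N 1 m {{>-nonZero 0<m}} (trans (sym w≡) (trans w≡m (sym (*-identityʳ m))))

  difference : ∀ {U} → MinimalZeroSum U → Over G0 U → ∀ x → wt W′ U ≡ (1 + x) * m → Difference G0 x
  difference {U} atom over = base-difference {W = W′} {U = U} g∈ ord-g atom over W′-range (λ x 0<Ux → value′ (over x 0<Ux))

  -- In base g the atom e^m has norm i′ = 1 + c₁ a.
  difference-c₁a : Difference G0 (c₁ * a)
  difference-c₁a = difference (order-atom ord-e) (over-⊛δ m e∈) (c₁ * a)
    (trans (wt-⊛δ W′ m e) (trans (cong (m *_) W′-e) (*-comm m i′)))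

  -- The atom y · e^(m - w) arises from e^m by replacing w copies of e by one y; in base g this
  -- lowers the norm 1 + c₁ a by t.
  difference-pair : ∀ {y w v} → y ∈ G0 → 0 < w → w ≤ m → toℕ y ≈ w * toℕ e mod n → W′ y ≡ v →
    ∀ x t → x + t ≡ c₁ * a → w * i′ ≡ v + t * m → Difference G0 x
  difference-pair {y} {w} {v} y∈ 0<w w≤m y≈ W′y x t x+t wi′ =
    difference (base-atom ord-e 0<w w≤m y≈) (over-· (over-⊛δ 1 y∈) (over-⊛δ (m ∸ w) e∈)) x
      (+-cancelʳ-≡ (t * m) _ _ (begin
        wt W′ (1 ⊛ δ y · (m ∸ w) ⊛ δ e) + t * m  ≡⟨ cong (_+ t * m) (trans (wt-pair W′ 1 y (m ∸ w) e)
                                                     (cong₂ (λ p q → 1 * p + (m ∸ w) * q) W′y W′-e)) ⟩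
        1 * v + (m ∸ w) * i′ + t * m             ≡⟨ lemma v ((m ∸ w) * i′) (t * m) ⟩
        (m ∸ w) * i′ + (v + t * m)               ≡⟨ cong ((m ∸ w) * i′ +_) wi′ ⟨
        (m ∸ w) * i′ + w * i′                    ≡⟨ *-distribʳ-+ i′ (m ∸ w) w ⟨
        (m ∸ w + w) * i′                         ≡⟨ cong (_* i′) (m∸n+n≡m w≤m) ⟩
        m * i′                                   ≡⟨ *-comm m i′ ⟩
        (1 + c₁ * a) * m                         ≡⟨ cong (λ s → (1 + s) * m) x+t ⟨
        (1 + (x + t)) * m                        ≡⟨ lemma′ x t m ⟩
        (1 + x) * m + t * m                      ∎))
    where
    open ≡-Reasoning
    lemma : ∀ v x y → 1 * v + x + y ≡ x + (v + y)
    lemma = solve-∀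
    lemma′ : ∀ x t m → (1 + (x + t)) * m ≡ (1 + x) * m + t * m
    lemma′ = solve-∀

  a≤c₁a : a ≤ c₁ * a
  a≤c₁a = m≤n*m a c₁ {{>-nonZero 0<c₁}}

  b≤c₁a : b ≤ c₁ * a
  b≤c₁a = *-cancelʳ-≤ b (c₁ * a) m {{>-nonZero 0<m}} (≤-trans (≤-reflexive b≡) (*-monoʳ-≤ (c₁ * a) d≤m))

  -- The norm drops by a for y = g, since i i′ = 1 + a m, and in the same way by b for y = h, since
  -- d i′ = d + b m; subtraction from c₁ a isolates each drop.
  difference-a : Difference G0 a
  difference-a = difference-∸ (subst (Difference G0) (sym (m∸n+n≡m a≤c₁a)) difference-c₁a)
    (difference-pair g∈ z<s (<⇒≤ i<m) g≈e W′-g (c₁ * a ∸ a) a (m∸n+n≡m a≤c₁a) i*i′)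

  difference-b : Difference G0 b
  difference-b = difference-∸ (subst (Difference G0) (sym (m∸n+n≡m b≤c₁a)) difference-c₁a)
    (difference-pair h∈ 0<d d≤m h≈e W′-h (c₁ * a ∸ b) b (m∸n+n≡m b≤c₁a)
      (trans (lemma d c₁ a) (cong (d +_) (sym b≡))))
    where
    lemma : ∀ d c a → d * (1 + c * a) ≡ d + c * a * d
    lemma = solve-∀

  isMinΔ : IsMinΔ G0 k
  isMinΔ = difference⇒minΔ 0<k (subst (Difference G0) (sym k≡) (difference-gcd difference-a difference-b)) lengths-≈

divisorI⇒minΔ : ∀ {n k} → 0 < n → InDivisorI n k → InΔStar n k
divisorI⇒minΔ {n} {k} 0<n (m , divides u n≡ , c₁ , c₂ , d , a , b ,
  (0<c₁ , _) , (0<c₂ , _) , d∣m , c₁+c₂<m , (0<a , a≡) , (0<b , b≡) , k≡) =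
  C.G0 , C.isMinΔ
  where
  m≡ : m ≡ c₁ + c₂ + a * (c₁ * c₂)
  m≡ = trans (sym (m+[n∸m]≡n (<⇒≤ c₁+c₂<m))) (cong (c₁ + c₂ +_) (trans (sym (∸-+-assoc m c₁ c₂)) (sym a≡)))
  bm≡ : b * m ≡ c₁ * a * d
  bm≡ = *-cancelʳ-≡ _ _ c₂ {{>-nonZero 0<c₂}} (trans (lemma b m c₂) (trans b≡ (trans (cong (_* d) (sym a≡)) (lemma′ a c₁ c₂ d))))
    where
    lemma : ∀ b m c → b * m * c ≡ b * (c * m)
    lemma = solve-∀
    lemma′ : ∀ a c₁ c₂ d → a * (c₁ * c₂) * d ≡ c₁ * a * d * c₂
    lemma′ = solve-∀
  module C = Construction {u = u} 0<n n≡ 0<c₁ 0<c₂ 0<a 0<b d∣m m≡ bm≡ k≡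

theorem7p3 : ∀ (n : ℕ) → 2000 ≤ n → ∀ (k : ℕ) → n ≤ 10 * k →
    (InΔStar n k ⇔ (∃[ m ] (m ∣ n × InI m k)))
theorem7p3 n 2000≤n k n≤10k = mk⇔
  (λ (_ , isMin) → minΔ⇒divisorI isMin 100≤k n≤10k (≤-trans (m≤m+n 100 1900) 2000≤n))
  (divisorI⇒minΔ (≤-trans z<s 2000≤n))
  where
  100≤k : 100 ≤ k
  100≤k = *-cancelˡ-≤ 10 (≤-trans (m≤m+n 1000 1000) (≤-trans 2000≤n n≤10k))
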